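{- Let $k\ge 2$ be an integer and let $H=(V+s,E)$ be a graph that is $(2k,k)$-connected in $V$ and such that $d_H(s)\ge 4$ is even. There is a complete admissible splitting-off at $s$ if and only if there exists no obstacle at $s$.
   Context: All graphs are finite and undirected; loops and parallel edges are allowed. $H=(V+s,E)$ denotes a graph with vertex set $V\cup\{s\}$, where $s\notin V$ is a special vertex. $N_H(s)$ is the set of neighbors of $s$; $d_H(s)$ is the number of edges between $s$ and $V$; for $t\in V$, $d_H(s,t)$ is the number of edges between $s$ and $t$. Bi-sets. A bi-set of a ground set $\Omega$ is $\mathsf{X}=(X_O,X_I)$ with $X_I\subseteq X_O\subseteq\Omega$; $X_I$ is its inner-set, $X_O$ its outer-set, and $w(\mathsf{X})=X_O\setminus X_I$ its wall. It is trivial if $X_I=\emptyset$ or $X_O=\Omega$, and non-trivial otherwise. A bi-set with non-empty wall is called a pair. Two bi-sets $\mathsf X,\mathsf Y$ are innerly-disjoint if $X_I\cap Y_I=\emptyset$. An edge of $H$ enters $\mathsf{X}$ if one end-vertex is in $X_I$ and the other is not in $X_O$ (it may be $s$). $\hat d_H(\mathsf{X})$ is the number of edges of $H$ entering $\mathsf{X}$, and $f_H(\mathsf{X})=\hat d_H(\mathsf{X})+k|w(\mathsf{X})|$. Connectivity. $H$ is $(2k,k)$-connected in $V$ if $|V|\ge 3$ and $f_H(\mathsf{X})\ge 2k$ for every non-trivial bi-set $\mathsf{X}$ of $V$ (ground set $V$). Splitting-off. Splitting-off a pair $(su,sv)$ of distinct (possibly parallel) edges at $s$ means replacing $su,sv$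 by a new edge $uv$ (a loop if $u=v$). If $d_H(s)$ is even, a complete splitting-off at $s$ is a sequence of $\frac12 d_H(s)$ splitting-offs of disjoint pairs of edges at $s$; it is admissible if the resulting graph is $(2k,k)$-connected in $V$. Critical pairs. A non-trivial bi-set $\mathsf{X}$ of $V$ is a critical pair (in $H$) if for some pair $(su,sv)$ of edges at $s$ we have $u\in X_I$, $w(\mathsf{X})=\{v\}$ and $f_H(\mathsf{X})\le 2k$. Obstacles. For $d_H(s)$ even, $(t,\mathcal{C})$ is a $t$-star obstacle at $s$ (an obstacle, for short) if: $t$ is a neighbor of $s$ with $d_H(s,t)$ odd; $\mathcal{C}$ is a collection of critical pairs; each element of $\mathcal{C}$ has wall $\{t\}$; the elements of $\mathcal{C}$ are pairwise innerly-disjoint; and $N_H(s)\setminus\{t\}\subseteq\bigcup_{\mathsf{X}\in\mathcal{C}}X_I$. -}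

module Defs where

open import Data.Fin using (Fin)
import Data.Fin.Properties as Fin
open import Data.Fin.Subset
open import Data.Fin.Subset.Properties using (_∈?_)
open import Data.List using (List; _∷_; length; filter)
import Data.List.Relation.Unary.All as All
import Data.List.Relation.Unary.Any as Any
open import Data.List.Relation.Unary.AllPairs using (AllPairs)
open import Data.List.Relation.Binary.Permutation.Propositional using (_↭_)
open import Data.Maybe using (Maybe; just; nothing)
import Data.Maybe.Properties as Maybe
import Data.Maybe.Relation.Unary.Any as MaybeAny
open import Data.Nat using (ℕ; suc; _+_; _*_; _≤_; ⌊_/2⌋)
open import Data.Nat.Divisibility using (_∣_; _∤_)
open import Data.Product using (∃; ∃-syntax; _×_; _,_)
import Data.Product.Properties as Product
open import Data.Sum using (_⊎_)
open import Relation.Nullary using (Dec; ¬_; ¬?; _×-dec_; _⊎-dec_)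
open import Relation.Binary using (DecidableEquality)
open import Relation.Binary.PropositionalEquality using (_≡_)

-- V is Fin n; the special vertex s is the extra point of Maybe (Fin n).
Vertex : ℕ → Set
Vertex n = Maybe (Fin n)

pattern s = nothing

-- The order of the two end-vertices carries no meaning: edges are only
-- ever inspected through Joins and Enters, which are symmetric in them.
Edge : ℕ → Set
Edge n = Vertex n × Vertex n

-- A list records the multiplicity of parallel edges; loops are allowed.
Graph : ℕ → Set
Graph n = List (Edge n)

module _ {n : ℕ} where

  _≟ᴱ_ : DecidableEquality (Edge n)
  _≟ᴱ_ = Product.≡-dec (Maybe.≡-dec Fin._≟_) (Maybe.≡-dec Fin._≟_)

  Joins : Vertex n → Vertex n → Edge n → Set
  Joins x y e = e ≡ (x , y) ⊎ e ≡ (y , x)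

  joins? : ∀ x y e → Dec (Joins x y e)
  joins? x y e = (e ≟ᴱ (x , y)) ⊎-dec (e ≟ᴱ (y , x))

  -- Loops at s are not edges between s and V, so they do not count.
  AtS : Edge n → Set
  AtS e = ∃[ v ] Joins s (just v) e

  atS? : ∀ e → Dec (AtS e)
  atS? e = Fin.any? (λ v → joins? s (just v) e)

  degS : Graph n → ℕ
  degS H = length (filter atS? H)

  degST : Graph n → Fin n → ℕ
  degST H t = length (filter (joins? s (just t)) H)

  NeighbourOfS : Graph n → Fin n → Set
  NeighbourOfS H v = Any.Any (Joins s (just v)) H

  -- An edge su and a different (possibly parallel) edge sv of H, where
  -- rest consists of the other edges of H.
  PairAtS : Graph n → Fin n → Fin n → Graph n → Set
  PairAtS H u v rest =
    ∃[ e ] ∃[ f ] Joins s (just u) e × Joins s (just v) f × H ↭ e ∷ f ∷ rest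

  record BiSet : Set where
    field
      outer : Subset n
      inner : Subset n
      inner⊆outer : inner ⊆ outer

  open BiSet public

  wall : BiSet → Subset n
  wall X = outer X ─ inner X

  Trivial : BiSet → Set
  Trivial X = inner X ≡ ⊥ ⊎ outer X ≡ ⊤

  NonTrivial : BiSet → Set
  NonTrivial X = ¬ Trivial X

  InnerlyDisjoint : BiSet → BiSet → Set
  InnerlyDisjoint X Y = inner X ∩ inner Y ≡ ⊥

  -- Membership of a vertex of H in a subset of V; s belongs to none.
  _∈ⱽ_ : Vertex n → Subset n → Set
  x ∈ⱽ p = MaybeAny.Any (_∈ p) x

  _∈ⱽ?_ : ∀ x p → Dec (x ∈ⱽ p)
  x ∈ⱽ? p = MaybeAny.dec (_∈? p) x

  Enters : BiSet → Edge n → Set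
  Enters X (x , y) =
      (x ∈ⱽ inner X × ¬ y ∈ⱽ outer X)
    ⊎ (y ∈ⱽ inner X × ¬ x ∈ⱽ outer X)

  enters? : ∀ X e → Dec (Enters X e)
  enters? X (x , y) =
    ((x ∈ⱽ? inner X) ×-dec ¬? (y ∈ⱽ? outer X))
    ⊎-dec ((y ∈ⱽ? inner X) ×-dec ¬? (x ∈ⱽ? outer X))

  d̂ : Graph n → BiSet → ℕ
  d̂ H X = length (filter (enters? X) H)

  f : ℕ → Graph n → BiSet → ℕ
  f k H X = d̂ H X + k * ∣ wall X ∣

  -- (2k,k)-connectivity in V.
  Connected : ℕ → Graph n → Set
  Connected k H = 3 ≤ n × (∀ X → NonTrivial X → 2 * k ≤ f k H X)

  SplitOff : Graph n → Graph n → Set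
  SplitOff H H′ =
    ∃[ u ] ∃[ v ] ∃[ rest ]
      PairAtS H u v rest × H′ ≡ (just u , just v) ∷ rest

  -- The pairs used along the sequence are automatically disjoint: the two
  -- edges of a pair are removed, and the new edge is not incident to s.
  data SplitOffs : ℕ → Graph n → Graph n → Set where
    done : ∀ {H} → SplitOffs 0 H H
    step : ∀ {m H H′ H″} →
           SplitOff H H′ → SplitOffs m H′ H″ → SplitOffs (suc m) H H″

  -- Meant for even degS H.
  CompleteSplittingOff : Graph n → Graph n → Set
  CompleteSplittingOff H H′ = SplitOffs ⌊ degS H /2⌋ H H′

  HasCompleteAdmissibleSplittingOff : ℕ → Graph n → Set
  HasCompleteAdmissibleSplittingOff k H =
    ∃[ H′ ] CompleteSplittingOff H H′ × Connected k H′

  CriticalPair : ℕ → Graph n → BiSet → Set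
  CriticalPair k H X =
    NonTrivial X ×
    (∃[ u ] ∃[ v ]
      (∃[ rest ] PairAtS H u v rest) ×
      u ∈ inner X × wall X ≡ ⁅ v ⁆ × f k H X ≤ 2 * k)

  -- A collection of bi-sets is given as a list. Critical pairs have
  -- non-empty inner-sets, so pairwise disjointness excludes repetitions.
  record IsObstacle (k : ℕ) (H : Graph n) (t : Fin n) (C : List BiSet) : Set where
    field
      neighbour : NeighbourOfS H t
      odd       : 2 ∤ degST H t
      critical  : All.All (CriticalPair k H) C
      walls     : All.All (λ X → wall X ≡ ⁅ t ⁆) C
      disjoint  : AllPairs InnerlyDisjoint C
      covers    : ∀ v → NeighbourOfS H v → ¬ v ≡ t → Any.Any (λ X → v ∈ inner X) C

  HasObstacle : ℕ → Graph n → Set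
  HasObstacle k H = ∃[ t ] ∃[ C ] IsObstacle k H t C

{-# OPTIONS --safe #-}
module Submission where

-- Necessity: f_H never increases, and it decreases on a bi-set X of an obstacle
-- at t when st is split off together with an edge sv, v ∈ X_I. As d_H(s,t) is
-- odd, this happens at some point, and f(X) drops below 2k.
--
-- Sufficiency: it is enough to find an admissible pair that creates no obstacle.
-- If all pairs at s were inadmissible, then uncrossing inclusionwise maximal bi-sets
-- with f_H ≤ 2k + 1 that contain two edges of s (sub- and posimodularity of f_H)
-- would lead to an obstacle or to a contradiction with k ≥ 2 or the parity of
-- d_H(s). If an admissible pair creates an obstacle at t, then (st,sw) is
-- admissible for some w that is not blocked with t by a tight bi-set with
-- wall {t} when d_H(s,t) is odd, and (st,st) is admissible when d_H(s,t) is
-- even. This second pair creates no obstacle: its centre r would differ from t,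
-- and the bi-sets with wall {t} and those with wall {r} would contradict each
-- other by uncrossing and by counting edges at s.

open import Data.Bool using (Bool; true; false; T; _∧_; not)
open import Data.Bool.Properties using (T-∧)
open import Data.Empty using (⊥; ⊥-elim)
open import Data.Fin using (Fin; zero; suc)
import Data.Fin.Properties as Fin
open import Data.Fin.Subset using (Subset; ⁅_⁆; ∣_∣; _─_)
  renaming (_∈_ to _∈ˢ_; _∉_ to _∉ˢ_)
open import Data.Fin.Subset.Properties
  using (_∈?_; ∉⊥; ∈⊤; ⊆⊤; ⊆-antisym; Empty-unique; nonempty?; x∈⁅x⁆; x∈⁅y⁆⇒x≡y; x∈p∧x∉q⇒x∈p─q; p─q⊆p; x∈p∩q⁻)
open import Data.List using (List; []; _∷_; allFin; filter; length; map)
open import Data.List.Membership.Propositional using (_∈_; find)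
open import Data.List.Membership.Propositional.Properties using (∈-allFin)
open import Data.List.Relation.Binary.Permutation.Propositional using (_↭_; ↭-refl; ↭-trans; prep; swap)
open import Data.List.Relation.Unary.All as All using (All; []; _∷_)
import Data.List.Relation.Unary.All.Properties as All
open import Data.List.Relation.Unary.AllPairs as AllPairs using (AllPairs; []; _∷_)
import Data.List.Relation.Unary.AllPairs.Properties as AllPairs
open import Data.List.Relation.Unary.Any as Any using (Any; here; there)
import Data.List.Relation.Unary.Any.Properties as Any
open import Data.Maybe as Maybe using (Maybe; just; nothing)
import Data.Maybe.Relation.Unary.Any as MaybeAny
open import Data.Nat using (ℕ; zero; suc; _+_; _*_; _∸_; _≤_; _<_; z≤n; s≤s; s≤s⁻¹; _≤ᵇ_; _≤?_; ⌊_/2⌋)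
open import Data.Nat.Divisibility using (_∣_; divides)
open import Data.Nat.Properties hiding (_≟_)
open import Data.Nat.Tactic.RingSolver using (solve-∀)
open import Data.Product using (_×_; _,_; proj₁; proj₂; ∃-syntax)
open import Data.Sum using (_⊎_; inj₁; inj₂; [_,_]′)
open import Data.Unit using (tt)
open import Data.Vec as Vec using (Vec; []; _∷_; here; there)
open import Data.Vec.N-ary using (N-ary; _$ⁿ_)
open import Data.Vec.Properties using (lookup⇒[]=; []=⇒lookup; lookup∘tabulate)
open import Defs
open import Function using (_∘_; _$_; Equivalence)
open import Function.Bundles using (_⇔_; mk⇔)
open import Relation.Binary.Definitions using (DecidableEquality)
open import Relation.Binary.PropositionalEquality hiding ([_])
open import Relation.Nullary using (Dec; yes; no; ¬_; ¬?; _×-dec_; _⊎-dec_; decidable-stable)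

-- Linear arithmetic over ℕ

-- The contradictions are slack counts. A bi-set that makes a pair inadmissible has f_H at most 2k +
-- 1, and every non-trivial bi-set produced by uncrossing has f_H at least 2k, so only a few units
-- are spare. They are exceeded by the edges at s that the uncrossing inequality loses, or by a
-- bi-set with two vertices in its wall, whose f_H is at least 2k plus its number of edges to s.
-- Where this fails, connectivity of the complement bounds the edges from s into a bi-set by those
-- that end outside it, and a parity settles the equality case. The main difficulty is that a
-- critical pair of a new obstacle at t need not be critical before the splitting-off. If it is not,
-- then a fixed end-vertex of the split pair, other than t, is in its inner-set; disjointness leaves
-- at most one such member, and the others serve as tight bi-sets of H. Maximal bi-sets and families
-- are never computed. They exist only under a double negation, so sufficiency is argued towards ⊥
-- until the decidability of the final statement yields an actual splitting-off.

infixr 8 _⊛_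
infixl 7 _⊕_
infix 6 _⊑_

data Expr (m : ℕ) : Set where
  var : Fin m → Expr m
  con : ℕ → Expr m
  _⊕_ : Expr m → Expr m → Expr m
  _⊛_ : ℕ → Expr m → Expr m

record Inequality (m : ℕ) : Set where
  constructor _⊑_
  field
    lhs rhs : Expr m

open Inequality

module _ {m : ℕ} where

  value : Vec ℕ m → Expr m → ℕ
  value ρ (var i) = Vec.lookup ρ i
  value ρ (con c) = c
  value ρ (a ⊕ b) = value ρ a + value ρ b
  value ρ (c ⊛ a) = c * value ρ a

  Holds : Vec ℕ m → Inequality m → Set
  Holds ρ h = value ρ (lhs h) ≤ value ρ (rhs h)

dot : ∀ {m} → Vec ℕ m → Vec ℕ m → ℕ
dot [] [] = 0
dot (a ∷ as) (x ∷ xs) = a * x + dot as xs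

dot-0 : ∀ {m} (ρ : Vec ℕ m) → dot (Vec.replicate m 0) ρ ≡ 0
dot-0 [] = refl
dot-0 (x ∷ ρ) = dot-0 ρ

dot-+ : ∀ {m} (u v ρ : Vec ℕ m) → dot (Vec.zipWith _+_ u v) ρ ≡ dot u ρ + dot v ρ
dot-+ [] [] [] = refl
dot-+ (a ∷ u) (b ∷ v) (x ∷ ρ) rewrite dot-+ u v ρ = eq a b x (dot u ρ) (dot v ρ)
  where
  eq : ∀ a b x p q → (a + b) * x + (p + q) ≡ a * x + p + (b * x + q)
  eq = solve-∀

dot-* : ∀ {m} c (u ρ : Vec ℕ m) → dot (Vec.map (c *_) u) ρ ≡ c * dot u ρ
dot-* c [] [] = sym (*-zeroʳ c)
dot-* c (a ∷ u) (x ∷ ρ) rewrite dot-* c u ρ = eq c a x (dot u ρ)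
  where
  eq : ∀ c a x p → c * a * x + c * p ≡ c * (a * x + p)
  eq = solve-∀

unit : ∀ {m} → Fin m → Vec ℕ m
unit zero = 1 ∷ Vec.replicate _ 0
unit (suc i) = 0 ∷ unit i

dot-unit : ∀ {m} (i : Fin m) ρ → dot (unit i) ρ ≡ Vec.lookup ρ i
dot-unit zero (x ∷ ρ) rewrite dot-0 ρ = trans (+-identityʳ _) (+-identityʳ x)
dot-unit (suc i) (x ∷ ρ) = dot-unit i ρ

-- The constant term is the coefficient of an extra variable with value 1.
coefficients : ∀ {m} → Expr m → Vec ℕ (suc m)
coefficients (var i) = 0 ∷ unit i
coefficients (con c) = c ∷ Vec.replicate _ 0
coefficients (a ⊕ b) = Vec.zipWith _+_ (coefficients a) (coefficients b)
coefficients (c ⊛ a) = Vec.map (c *_) (coefficients a)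

coefficients-correct : ∀ {m} (ρ : Vec ℕ m) e → dot (coefficients e) (1 ∷ ρ) ≡ value ρ e
coefficients-correct ρ (var i) = dot-unit i ρ
coefficients-correct ρ (con c) rewrite dot-0 ρ = trans (+-identityʳ _) (*-identityʳ c)
coefficients-correct ρ (a ⊕ b) =
  trans (dot-+ (coefficients a) (coefficients b) (1 ∷ ρ))
        (cong₂ _+_ (coefficients-correct ρ a) (coefficients-correct ρ b))
coefficients-correct ρ (c ⊛ a) =
  trans (dot-* c (coefficients a) (1 ∷ ρ)) (cong (c *_) (coefficients-correct ρ a))

_≤ᵛ_ : ∀ {m} → Vec ℕ m → Vec ℕ m → Bool
[] ≤ᵛ [] = true
(a ∷ u) ≤ᵛ (b ∷ v) = (a ≤ᵇ b) ∧ (u ≤ᵛ v)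

dot-mono : ∀ {m} (u v ρ : Vec ℕ m) → T (u ≤ᵛ v) → dot u ρ ≤ dot v ρ
dot-mono [] [] [] _ = z≤n
dot-mono (a ∷ u) (b ∷ v) (x ∷ ρ) t with Equivalence.to T-∧ t
... | a≤b , u≤v = +-mono-≤ (*-monoˡ-≤ x (≤ᵇ⇒≤ a b a≤b)) (dot-mono u v ρ u≤v)

total : ∀ {m} → (Inequality m → Expr m) → List (Inequality m) → Expr m
total side [] = con 0
total side (h ∷ hs) = side h ⊕ total side hs

total-mono : ∀ {m} (ρ : Vec ℕ m) hs → All (Holds ρ) hs →
  value ρ (total lhs hs) ≤ value ρ (total rhs hs)
total-mono ρ [] [] = z≤n
total-mono ρ (h ∷ hs) (p ∷ ps) = +-mono-≤ p (total-mono ρ hs ps)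

variables : ∀ m → Vec (Expr m) m
variables m = Vec.map var (Vec.allFin m)

-- Comparing coefficients is enough because all variables are natural numbers; `con 1` makes the
-- inequality strict. The comparison is settled by evaluation, so that a use of `refute` only lists
-- inequalities and their proofs.
Refutes : ∀ {m} → List (Inequality m) → Set
Refutes hs = T (coefficients (con 1 ⊕ total rhs hs) ≤ᵛ coefficients (total lhs hs))

-- The sum of the inequalities must be absurd; to use an inequality with a
-- multiplicity, repeat it.
refute : ∀ m (hs : N-ary m (Expr m) (List (Inequality m))) (ρ : Vec ℕ m)
  {_ : Refutes (hs $ⁿ variables m)} → All (Holds ρ) (hs $ⁿ variables m) → ⊥
refute m hs ρ {check} ps = <-irrefl refl (≤-trans
  (subst₂ _≤_ (coefficients-correct ρ (con 1 ⊕ r)) (coefficients-correct ρ l)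
    (dot-mono (coefficients (con 1 ⊕ r)) (coefficients l) (1 ∷ ρ) check))
  (total-mono ρ (hs $ⁿ variables m) ps))
  where
  l r : Expr m
  l = total lhs (hs $ⁿ variables m)
  r = total rhs (hs $ⁿ variables m)

-- Labelings

-- A bi-set is handled as the map that sends a vertex to I, W or O according
-- to whether it is in the inner-set, in the wall or outside the outer-set.
data Label : Set where
  O W I : Label

_≟ᴸ_ : DecidableEquality Label
O ≟ᴸ O = yes refl
O ≟ᴸ W = no λ ()
O ≟ᴸ I = no λ ()
W ≟ᴸ O = no λ ()
W ≟ᴸ W = yes refl
W ≟ᴸ I = no λ ()
I ≟ᴸ O = no λ ()
I ≟ᴸ W = no λ ()
I ≟ᴸ I = yes refl

∁ : Label → Label
∁ O = I
∁ W = W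
∁ I = O

infixr 7 _⊓ᴸ_
infixr 6 _⊔ᴸ_

-- Minimum and maximum for O < W < I, that is, intersection and union taken separately for
-- outer-sets and inner-sets. The difference has inner-set X_I minus Y_O and outer-set X_O minus
-- Y_I.
_⊓ᴸ_ _⊔ᴸ_ _⊖ᴸ_ : Label → Label → Label
O ⊓ᴸ _ = O
W ⊓ᴸ O = O
W ⊓ᴸ W = W
W ⊓ᴸ I = W
I ⊓ᴸ b = b
O ⊔ᴸ b = b
W ⊔ᴸ O = W
W ⊔ᴸ W = W
W ⊔ᴸ I = I
I ⊔ᴸ _ = I
a ⊖ᴸ b = a ⊓ᴸ ∁ b

#I #W #O rank : Label → ℕ
#I I = 1
#I _ = 0
#W W = 1
#W _ = 0
#O O = 1
#O _ = 0
rank O = 0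
rank W = 1
rank I = 2

entering : Label → Label → ℕ
entering I O = 1
entering O I = 1
entering _ _ = 0

Labeling : ℕ → Set
Labeling n = Fin n → Label

module _ {n : ℕ} where

  infix 8 _⊖_
  infixr 7 _⊓ˢ_
  infixr 6 _⊔ˢ_

  _⊓ˢ_ _⊔ˢ_ _⊖_ : Labeling n → Labeling n → Labeling n
  (X ⊓ˢ Y) v = X v ⊓ᴸ Y v
  (X ⊔ˢ Y) v = X v ⊔ᴸ Y v
  (X ⊖ Y) v = X v ⊖ᴸ Y v

  -- The label of s is `O` in a bi-set and also in its complement, so complementation changes `F`
  -- exactly by edges at s. This is why the inequalities below carry `D` terms.
  labelⱽ : Labeling n → Vertex n → Label
  labelⱽ L nothing = O
  labelⱽ L (just v) = L v

-- Sums over the vertices and over the edges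

sumᶠ : ∀ {n} → (Fin n → ℕ) → ℕ
sumᶠ {zero} g = 0
sumᶠ {suc n} g = g zero + sumᶠ (g ∘ suc)

sumᶠ-mono : ∀ {n} {g h : Fin n → ℕ} → (∀ v → g v ≤ h v) → sumᶠ g ≤ sumᶠ h
sumᶠ-mono {zero} p = z≤n
sumᶠ-mono {suc n} p = +-mono-≤ (p zero) (sumᶠ-mono (p ∘ suc))

sumᶠ-+ : ∀ {n} (g h : Fin n → ℕ) → sumᶠ (λ v → g v + h v) ≡ sumᶠ g + sumᶠ h
sumᶠ-+ {zero} g h = refl
sumᶠ-+ {suc n} g h rewrite sumᶠ-+ (g ∘ suc) (h ∘ suc) =
  eq (g zero) (h zero) (sumᶠ (g ∘ suc)) (sumᶠ (h ∘ suc))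
  where
  eq : ∀ a b c d → a + b + (c + d) ≡ a + c + (b + d)
  eq = solve-∀

sumᶠ-0 : ∀ n → sumᶠ {n} (λ _ → 0) ≡ 0
sumᶠ-0 zero = refl
sumᶠ-0 (suc n) = sumᶠ-0 n

sumᶠ-strict : ∀ {n} {g h : Fin n → ℕ} → (∀ v → g v ≤ h v) →
  ∀ w → g w < h w → sumᶠ g < sumᶠ h
sumᶠ-strict p zero q = +-mono-<-≤ q (sumᶠ-mono (p ∘ suc))
sumᶠ-strict p (suc w) q = +-mono-≤-< (p zero) (sumᶠ-strict (p ∘ suc) w q)

sumᶠ-bound : ∀ {n} c {g : Fin n → ℕ} → (∀ v → g v ≤ c) → sumᶠ g ≤ n * c
sumᶠ-bound {zero} c p = z≤n
sumᶠ-bound {suc n} c p = +-mono-≤ (p zero) (sumᶠ-bound c (p ∘ suc))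

δ : ∀ {n} → Fin n → Fin n → ℕ
δ t v with t Fin.≟ v
... | yes _ = 1
... | no _ = 0

δ-refl : ∀ {n} (t : Fin n) → δ t t ≡ 1
δ-refl t with t Fin.≟ t
... | yes _ = refl
... | no ne = ⊥-elim (ne refl)

δ-≢ : ∀ {n} {t v : Fin n} → ¬ t ≡ v → δ t v ≡ 0
δ-≢ {t = t} {v} ne with t Fin.≟ v
... | yes eq = ⊥-elim (ne eq)
... | no _ = refl

δ-≤ : ∀ {n} {t : Fin n} {g : Fin n → ℕ} → 1 ≤ g t → ∀ v → δ t v ≤ g v
δ-≤ {t = t} p v with t Fin.≟ v
... | yes refl = p
... | no _ = z≤n

δ-+-≤ : ∀ {n} {t : Fin n} {g h : Fin n → ℕ} → (∀ v → h v ≤ g v) → h t < g t → ∀ v → δ t v + h v ≤ g v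
δ-+-≤ {t = t} p q v with t Fin.≟ v
... | yes refl = q
... | no _ = p v

δ-δ-≤ : ∀ {n} {t u : Fin n} {g : Fin n → ℕ} → ¬ t ≡ u → 1 ≤ g t → 1 ≤ g u → ∀ v → δ t v + δ u v ≤ g v
δ-δ-≤ {t = t} {g = g} ne p q = δ-+-≤ (δ-≤ q) (subst (λ i → suc i ≤ g t) (sym (δ-≢ (ne ∘ sym))) p)

sumᶠ-δ : ∀ {n} (t : Fin n) → sumᶠ (δ t) ≡ 1
sumᶠ-δ {suc n} zero = cong suc (sumᶠ-0 n)
sumᶠ-δ (suc t) = trans (step-sum t) (sumᶠ-δ t)
  where
  pointwise : ∀ {n} (t v : Fin n) → δ (suc t) (suc v) ≡ δ t v
  pointwise t v with t Fin.≟ v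
  ... | yes _ = refl
  ... | no _ = refl
  step-sum : ∀ {n} (t : Fin n) → sumᶠ (λ v → δ (suc t) (suc v)) ≡ sumᶠ (δ t)
  step-sum t = ≤-antisym (sumᶠ-mono (≤-reflexive ∘ pointwise t)) (sumᶠ-mono (≤-reflexive ∘ sym ∘ pointwise t))

module _ {n : ℕ} where

  cutᴱ : Labeling n → Edge n → ℕ
  cutᴱ L (x , y) = entering (labelⱽ L x) (labelⱽ L y)

  atSᴱ : (Fin n → ℕ) → Edge n → ℕ
  atSᴱ g (nothing , just v) = g v
  atSᴱ g (just v , nothing) = g v
  atSᴱ g _ = 0

  sumᴱ : (Edge n → ℕ) → Graph n → ℕ
  sumᴱ w [] = 0
  sumᴱ w (e ∷ H) = w e + sumᴱ w H

  sumᴱ-mono : ∀ {w w′} → (∀ e → w e ≤ w′ e) → ∀ H → sumᴱ w H ≤ sumᴱ w′ H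
  sumᴱ-mono p [] = z≤n
  sumᴱ-mono p (e ∷ H) = +-mono-≤ (p e) (sumᴱ-mono p H)

  sumᴱ-+ : ∀ w w′ H → sumᴱ (λ e → w e + w′ e) H ≡ sumᴱ w H + sumᴱ w′ H
  sumᴱ-+ w w′ [] = refl
  sumᴱ-+ w w′ (e ∷ H) rewrite sumᴱ-+ w w′ H = eq (w e) (w′ e) (sumᴱ w H) (sumᴱ w′ H)
    where
    eq : ∀ a b c d → a + b + (c + d) ≡ a + c + (b + d)
    eq = solve-∀

  -- F k H L is f_H(L), and D H g is the sum of g(v) over the edges sv of H.
  F : ℕ → Graph n → Labeling n → ℕ
  F k H L = sumᴱ (cutᴱ L) H + k * sumᶠ (#W ∘ L)

  D : Graph n → (Fin n → ℕ) → ℕ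
  D H g = sumᴱ (atSᴱ g) H

  degree : Graph n → ℕ
  degree H = D H (λ _ → 1)

  atSᴱ-mono : ∀ {g h} → (∀ v → g v ≤ h v) → ∀ e → atSᴱ g e ≤ atSᴱ h e
  atSᴱ-mono p (nothing , nothing) = z≤n
  atSᴱ-mono p (nothing , just v) = p v
  atSᴱ-mono p (just v , nothing) = p v
  atSᴱ-mono p (just _ , just _) = z≤n

  D-mono : ∀ H {g h} → (∀ v → g v ≤ h v) → D H g ≤ D H h
  D-mono H p = sumᴱ-mono (atSᴱ-mono p) H

  D-+ : ∀ H g h → D H (λ v → g v + h v) ≡ D H g + D H h
  D-+ H g h = trans (≤-antisym (sumᴱ-mono (≤-reflexive ∘ pointwise) H) (sumᴱ-mono (≤-reflexive ∘ sym ∘ pointwise) H))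
                    (sumᴱ-+ (atSᴱ g) (atSᴱ h) H)
    where
    pointwise : ∀ e → atSᴱ (λ v → g v + h v) e ≡ atSᴱ g e + atSᴱ h e
    pointwise (nothing , nothing) = refl
    pointwise (nothing , just v) = refl
    pointwise (just v , nothing) = refl
    pointwise (just _ , just _) = refl

  Neighbour : Graph n → Fin n → Set
  Neighbour H v = 1 ≤ D H (δ v)

  D-nbr-mono : ∀ H {g h} → (∀ v → Neighbour H v → g v ≤ h v) → D H g ≤ D H h
  D-nbr-mono [] p = z≤n
  D-nbr-mono (e ∷ H) {g} {h} p =
    +-mono-≤ (head e (λ v q → p v (m≤n⇒m≤n+o _ q)))
             (D-nbr-mono H (λ v q → p v (≤-trans q (m≤n+m _ (atSᴱ (δ v) e)))))
    where
    head : ∀ e → (∀ v → 1 ≤ atSᴱ (δ v) e → g v ≤ h v) → atSᴱ g e ≤ atSᴱ h e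
    head (nothing , nothing) _ = z≤n
    head (nothing , just v) q = q v (≤-reflexive (sym (δ-refl v)))
    head (just v , nothing) q = q v (≤-reflexive (sym (δ-refl v)))
    head (just _ , just _) _ = z≤n

  D-0 : ∀ H → D H (λ _ → 0) ≡ 0
  D-0 [] = refl
  D-0 ((nothing , nothing) ∷ H) = D-0 H
  D-0 ((nothing , just v) ∷ H) = D-0 H
  D-0 ((just v , nothing) ∷ H) = D-0 H
  D-0 ((just _ , just _) ∷ H) = D-0 H

  D-positive : ∀ H g → 1 ≤ D H g → ∃[ v ] Neighbour H v × 1 ≤ g v
  D-positive (e ∷ H) g p with D H g in eq
  ... | suc _ with D-positive H g (subst (1 ≤_) (sym eq) (s≤s z≤n))
  ... | v , q , r = v , ≤-trans q (m≤n+m _ (atSᴱ (δ v) e)) , r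
  D-positive (e ∷ H) g p | zero = head e (subst (1 ≤_) (+-identityʳ _) p)
    where
    head : ∀ e → 1 ≤ atSᴱ g e → ∃[ v ] Neighbour (e ∷ H) v × 1 ≤ g v
    head (nothing , just v) q = v , m≤n⇒m≤n+o _ (≤-reflexive (sym (δ-refl v))) , q
    head (just v , nothing) q = v , m≤n⇒m≤n+o _ (≤-reflexive (sym (δ-refl v))) , q

  F-mono : ∀ k H {L L′} → (∀ v → L v ≡ L′ v) → F k H L ≤ F k H L′
  F-mono k H {L} {L′} p = +-mono-≤
    (sumᴱ-mono (λ { (x , y) → ≤-reflexive (cong₂ entering (pⱽ x) (pⱽ y)) }) H)
    (*-monoʳ-≤ k (sumᶠ-mono (λ v → ≤-reflexive (cong #W (p v)))))
    where
    pⱽ : ∀ x → labelⱽ L x ≡ labelⱽ L′ x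
    pⱽ nothing = refl
    pⱽ (just v) = p v

-- Inequalities between sums of F-values, checked edge by edge

record Finite : Set₁ where
  field
    Carrier : Set
    every : (Carrier → Bool) → Bool
    every-sound : ∀ p → T (every p) → ∀ x → T (p x)

open Finite

labels : Finite
labels .Carrier = Label
labels .every p = p O ∧ p W ∧ p I
labels .every-sound p t x with Equivalence.to (T-∧ {p O}) t
... | o , t′ with Equivalence.to (T-∧ {p W}) t′
... | w , i with x
... | O = o
... | W = w
... | I = i

_⊗_ : Finite → Finite → Finite
(A ⊗ B) .Carrier = Carrier A × Carrier B
(A ⊗ B) .every p = every A λ a → every B λ b → p (a , b)
(A ⊗ B) .every-sound p t (a , b) = every-sound B _ (every-sound A _ t a) b

_⇒ᵇ_ : Bool → Bool → Bool
true ⇒ᵇ b = b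
false ⇒ᵇ _ = true

⇒ᵇ-elim : ∀ a {b} → T (a ⇒ᵇ b) → T a → T b
⇒ᵇ-elim true h _ = h

-- Both sides of an uncrossing inequality are sums over edges and vertices, so it suffices to
-- compare contributions for every combination of labels. These are finitely many and are checked by
-- evaluation. `ok` singles out the combinations that the hypotheses on the walls allow.
module Count (A : Finite) (ok : Carrier A → Bool) where

  -- The clause for one-element lists avoids a trailing `+ 0`, so that instances of `F-inequality`
  -- reduce to the sums in which they are stated.
  total-of : List (Carrier A → Label) → ((Carrier A → Label) → ℕ) → ℕ
  total-of [] w = 0
  total-of (φ ∷ []) w = w φ
  total-of (φ ∷ ψ ∷ φs) w = w φ + total-of (ψ ∷ φs) w

  total-of-+ : ∀ φs w w′ → total-of φs (λ φ → w φ + w′ φ) ≡ total-of φs w + total-of φs w′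
  total-of-+ [] w w′ = refl
  total-of-+ (φ ∷ []) w w′ = refl
  total-of-+ (φ ∷ ψ ∷ φs) w w′ rewrite total-of-+ (ψ ∷ φs) w w′ =
    eq (w φ) (w′ φ) (total-of (ψ ∷ φs) w) (total-of (ψ ∷ φs) w′)
    where
    eq : ∀ a b c d → a + b + (c + d) ≡ a + c + (b + d)
    eq = solve-∀

  total-of-* : ∀ k φs w → total-of φs (λ φ → k * w φ) ≡ k * total-of φs w
  total-of-* k [] w = sym (*-zeroʳ k)
  total-of-* k (φ ∷ []) w = refl
  total-of-* k (φ ∷ ψ ∷ φs) w rewrite total-of-* k (ψ ∷ φs) w = sym (*-distribˡ-+ k (w φ) _)

  total-of-0 : ∀ φs → total-of φs (λ _ → 0) ≡ 0
  total-of-0 [] = refl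
  total-of-0 (φ ∷ []) = refl
  total-of-0 (φ ∷ ψ ∷ φs) = total-of-0 (ψ ∷ φs)

  -- An edge inside V has two labels to run through; an edge at s has one, and it alone carries the
  -- terms `g` and `h`; walls are compared separately because of the factor k.
  edgeᵇ endᵇ wallᵇ : List (Carrier A → Label) → (Carrier A → ℕ) →
    List (Carrier A → Label) → (Carrier A → ℕ) → Bool
  edgeᵇ φs g ψs h = every A λ x → ok x ⇒ᵇ every A λ y → ok y ⇒ᵇ
    (total-of φs (λ φ → entering (φ x) (φ y)) ≤ᵇ total-of ψs (λ φ → entering (φ x) (φ y)))
  endᵇ φs g ψs h = every A λ x → ok x ⇒ᵇ
    (total-of φs (λ φ → entering (φ x) O) + g x ≤ᵇ total-of ψs (λ φ → entering (φ x) O) + h x)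
  wallᵇ φs g ψs h = every A λ x → ok x ⇒ᵇ
    (total-of φs (λ φ → #W (φ x)) ≤ᵇ total-of ψs (λ φ → #W (φ x)))

  module _ {n : ℕ} (k : ℕ) (H : Graph n) (c : Fin n → Carrier A) (okay : ∀ v → T (ok (c v))) where

    sumᴱ-total : ∀ φs (w : (Carrier A → Label) → Edge n → ℕ) →
      total-of φs (λ φ → sumᴱ (w φ) H) ≡ sumᴱ (λ e → total-of φs (λ φ → w φ e)) H
    sumᴱ-total φs w = go H
      where
      go : ∀ H → total-of φs (λ φ → sumᴱ (w φ) H) ≡ sumᴱ (λ e → total-of φs (λ φ → w φ e)) H
      go [] = total-of-0 φs
      go (e ∷ H) = trans (total-of-+ φs (λ φ → w φ e) (λ φ → sumᴱ (w φ) H))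
        (cong (total-of φs (λ φ → w φ e) +_) (go H))

    sumᶠ-total : ∀ φs {m} (w : (Carrier A → Label) → Fin m → ℕ) →
      total-of φs (λ φ → sumᶠ (w φ)) ≡ sumᶠ (λ v → total-of φs (λ φ → w φ v))
    sumᶠ-total φs {zero} w = total-of-0 φs
    sumᶠ-total φs {suc m} w = trans (total-of-+ φs (λ φ → w φ zero) (λ φ → sumᶠ (w φ ∘ suc)))
      (cong (total-of φs (λ φ → w φ zero) +_) (sumᶠ-total φs (λ φ → w φ ∘ suc)))

    F-total : ∀ φs → total-of φs (λ φ → F k H (φ ∘ c)) ≡
      sumᴱ (λ e → total-of φs (λ φ → cutᴱ (φ ∘ c) e)) H + k * sumᶠ (λ v → total-of φs (λ φ → #W (φ (c v))))
    F-total φs = trans (total-of-+ φs _ _) (cong₂ _+_ (sumᴱ-total φs (λ φ → cutᴱ (φ ∘ c)))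
      (trans (total-of-* k φs _) (cong (k *_) (sumᶠ-total φs (λ φ → #W ∘ φ ∘ c)))))

    F-inequality : ∀ φs g ψs h → {T (edgeᵇ φs g ψs h)} → {T (endᵇ φs g ψs h)} → {T (wallᵇ φs g ψs h)} →
      total-of φs (λ φ → F k H (φ ∘ c)) + D H (g ∘ c) ≤ total-of ψs (λ φ → F k H (φ ∘ c)) + D H (h ∘ c)
    F-inequality φs g ψs h {edge} {end} {wall} = begin
      total-of φs (λ φ → F k H (φ ∘ c)) + D H (g ∘ c)
        ≡⟨ cong (_+ D H (g ∘ c)) (F-total φs) ⟩
      E φs + k * w φs + D H (g ∘ c)
        ≡⟨ exchange (E φs) (k * w φs) (D H (g ∘ c)) ⟩
      E φs + D H (g ∘ c) + k * w φs
        ≡⟨ cong (_+ k * w φs) (sumᴱ-+ _ _ H) ⟨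
      sumᴱ (λ e → total-of φs (λ φ → cutᴱ (φ ∘ c) e) + atSᴱ (g ∘ c) e) H + k * w φs
        ≤⟨ +-mono-≤ (sumᴱ-mono edges H) (*-monoʳ-≤ k (sumᶠ-mono walls)) ⟩
      sumᴱ (λ e → total-of ψs (λ φ → cutᴱ (φ ∘ c) e) + atSᴱ (h ∘ c) e) H + k * w ψs
        ≡⟨ cong (_+ k * w ψs) (sumᴱ-+ _ _ H) ⟩
      E ψs + D H (h ∘ c) + k * w ψs
        ≡⟨ exchange (E ψs) (k * w ψs) (D H (h ∘ c)) ⟨
      E ψs + k * w ψs + D H (h ∘ c)
        ≡⟨ cong (_+ D H (h ∘ c)) (F-total ψs) ⟨
      total-of ψs (λ φ → F k H (φ ∘ c)) + D H (h ∘ c) ∎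
      where
      open ≤-Reasoning
      E w : List (Carrier A → Label) → ℕ
      E φs = sumᴱ (λ e → total-of φs (λ φ → cutᴱ (φ ∘ c) e)) H
      w φs = sumᶠ (λ v → total-of φs (λ φ → #W (φ (c v))))
      exchange : ∀ a b d → a + b + d ≡ a + d + b
      exchange = solve-∀
      walls : ∀ v → total-of φs (λ φ → #W (φ (c v))) ≤ total-of ψs (λ φ → #W (φ (c v)))
      walls v = ≤ᵇ⇒≤ _ _ (⇒ᵇ-elim (ok (c v)) (every-sound A _ wall (c v)) (okay v))
      ends : ∀ v → total-of φs (λ φ → entering (φ (c v)) O) + g (c v) ≤
        total-of ψs (λ φ → entering (φ (c v)) O) + h (c v)
      ends v = ≤ᵇ⇒≤ _ _ (⇒ᵇ-elim (ok (c v)) (every-sound A _ end (c v)) (okay v))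
      entering-sym : ∀ a b → entering a b ≡ entering b a
      entering-sym O O = refl
      entering-sym O W = refl
      entering-sym O I = refl
      entering-sym W O = refl
      entering-sym W W = refl
      entering-sym W I = refl
      entering-sym I O = refl
      entering-sym I W = refl
      entering-sym I I = refl
      total-sym : ∀ φs v → total-of φs (λ φ → entering (φ (c v)) O) ≡ total-of φs (λ φ → entering O (φ (c v)))
      total-sym [] v = refl
      total-sym (φ ∷ []) v = entering-sym (φ (c v)) O
      total-sym (φ ∷ ψ ∷ φs) v = cong₂ _+_ (entering-sym (φ (c v)) O) (total-sym (ψ ∷ φs) v)
      edges : ∀ e → total-of φs (λ φ → cutᴱ (φ ∘ c) e) + atSᴱ (g ∘ c) e ≤
        total-of ψs (λ φ → cutᴱ (φ ∘ c) e) + atSᴱ (h ∘ c) e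
      edges (nothing , nothing) = ≤-trans (≤-reflexive (cong (_+ 0) (total-of-0 φs))) z≤n
      edges (nothing , just v) = subst₂ _≤_ (cong (_+ g (c v)) (total-sym φs v))
        (cong (_+ h (c v)) (total-sym ψs v)) (ends v)
      edges (just v , nothing) = ends v
      edges (just u , just v) = +-mono-≤ {u = 0} {v = 0} (≤ᵇ⇒≤ _ _ (⇒ᵇ-elim (ok (c v))
        (every-sound A _ (⇒ᵇ-elim (ok (c u)) (every-sound A _ edge (c u)) (okay u)) (c v)) (okay v))) z≤n

-- The slack of posimodularity at an edge from s whose other end has these two labels.
shared : Label → Label → ℕ
shared I I = 2
shared I W = 1
shared W I = 1
shared _ _ = 0

#II #IO : Label → Label → ℕ
#II a b = #I a * #I b
#IO a b = #I a * #O b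

-- The bi-set with the same wall and empty inner-set. No edge enters it, so its f_H is k times the
-- size of the wall: a way to write wall sizes as values of `F`.
wall-only : Label → Label
wall-only W = W
wall-only _ = O

isOᵇ isWᵇ isIᵇ : Label → Bool
isOᵇ O = true
isOᵇ _ = false
isWᵇ W = true
isWᵇ _ = false
isIᵇ I = true
isIᵇ _ = false

separated nested equal-walls : Label → Label → Bool
separated x y = (isWᵇ x ⇒ᵇ isOᵇ y) ∧ (isWᵇ y ⇒ᵇ isOᵇ x)
nested x y = not (isWᵇ x) ∧ (isWᵇ y ⇒ᵇ isIᵇ x)
equal-walls x y = (isWᵇ x ⇒ᵇ isWᵇ y) ∧ (isWᵇ y ⇒ᵇ isWᵇ x)

T-separated : ∀ x y → (x ≡ W → y ≡ O) → (y ≡ W → x ≡ O) → T (separated x y)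
T-separated W y p q rewrite p refl = tt
T-separated O O p q = tt
T-separated O W p q = tt
T-separated O I p q = tt
T-separated I O p q = tt
T-separated I W p q with () ← q refl
T-separated I I p q = tt

T-nested : ∀ x y → (x ≡ W → ⊥) → (y ≡ W → x ≡ I) → T (nested x y)
T-nested W y p q = ⊥-elim (p refl)
T-nested x W p q rewrite q refl = tt
T-nested O O p q = tt
T-nested O I p q = tt
T-nested I O p q = tt
T-nested I I p q = tt

T-equal-walls : ∀ x y → (x ≡ W → y ≡ W) → (y ≡ W → x ≡ W) → T (equal-walls x y)
T-equal-walls W y p q rewrite p refl = tt
T-equal-walls x W p q rewrite q refl = tt
T-equal-walls O O p q = tt
T-equal-walls O I p q = tt
T-equal-walls I O p q = tt
T-equal-walls I I p q = tt

-- A vertex t that is the whole outer-set of X and the wall of the disjoint Y and Z.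
star : Label → Label → Label → Bool
star x y z = not (isWᵇ x) ∧ (isWᵇ y ⇒ᵇ isIᵇ x) ∧ (isWᵇ z ⇒ᵇ isIᵇ x) ∧
  (isIᵇ x ⇒ᵇ isWᵇ y) ∧ (isIᵇ x ⇒ᵇ isWᵇ z) ∧ (isIᵇ y ⇒ᵇ isOᵇ z)

T-star : ∀ x y z → (x ≡ W → ⊥) → (y ≡ W → x ≡ I) → (z ≡ W → x ≡ I) →
  (x ≡ I → y ≡ W) → (x ≡ I → z ≡ W) → (y ≡ I → z ≡ I → ⊥) → T (star x y z)
T-star W y z a b c d e g = ⊥-elim (a refl)
T-star I y z a b c d e g rewrite d refl | e refl = tt
T-star O W z a b c d e g with () ← b refl
T-star O y W a b c d e g with () ← c refl
T-star O I I a b c d e g = ⊥-elim (g refl refl)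
T-star O O O a b c d e g = tt
T-star O O I a b c d e g = tt
T-star O I O a b c d e g = tt

module Inequalities {n : ℕ} (k : ℕ) (H : Graph n) where

  without-D : ∀ {a b} → a ≤ b + D H (λ _ → 0) → a ≤ b
  without-D {b = b} p = ≤-trans p (≤-reflexive (trans (cong (b +_) (D-0 H)) (+-identityʳ b)))

  always : ∀ {A : Set} → A → Bool
  always _ = true

  -- An edge inside V enters a bi-set if and only if it enters the complement; only the edges at s
  -- tell them apart.
  complement-≤ : ∀ X → F k H (∁ ∘ X) + D H (#I ∘ X) ≤ F k H X + D H (#O ∘ X)
  complement-≤ X = F-inequality k H X (λ _ → tt) (∁ ∷ []) #I ((λ x → x) ∷ []) #O
    where open Count labels always

  submodular : ∀ X Y → F k H (X ⊓ˢ Y) + F k H (X ⊔ˢ Y) ≤ F k H X + F k H Y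
  submodular X Y = ≤-trans (m≤m+n _ _) $ without-D $ F-inequality k H (λ v → X v , Y v) (λ _ → tt)
    ((λ (x , y) → x ⊓ᴸ y) ∷ (λ (x , y) → x ⊔ᴸ y) ∷ []) (λ _ → 0) (proj₁ ∷ proj₂ ∷ []) (λ _ → 0)
    where open Count (labels ⊗ labels) always

  -- Submodularity for X and the complement of Y, corrected at the edges of s.
  posimodular : ∀ X Y → F k H (X ⊖ Y) + F k H (Y ⊖ X) + D H (λ v → shared (X v) (Y v)) ≤ F k H X + F k H Y
  posimodular X Y = without-D $ F-inequality k H (λ v → X v , Y v) (λ _ → tt)
    ((λ (x , y) → x ⊖ᴸ y) ∷ (λ (x , y) → y ⊖ᴸ x) ∷ []) (λ (x , y) → shared x y) (proj₁ ∷ proj₂ ∷ []) (λ _ → 0)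
    where open Count (labels ⊗ labels) always

  -- X is taken twice because an edge between X ⊓ Y and Y ⊖ X enters both of them, but on the right
  -- only X. Neither of the two contains the wall of X, so its cost 2k|w(X)| is left over.
  separated-≤ : ∀ X Y → (∀ v → X v ≡ W → Y v ≡ O) → (∀ v → Y v ≡ W → X v ≡ O) →
    F k H (X ⊓ˢ Y) + (F k H (Y ⊖ X) + (F k H (wall-only ∘ X) + F k H (wall-only ∘ X))) + D H (λ v → #I (X v) + #I (X v)) ≤
    F k H X + (F k H X + F k H Y)
  separated-≤ X Y p q = without-D $ F-inequality k H (λ v → X v , Y v) (λ v → T-separated (X v) (Y v) (p v) (q v))
    ((λ (x , y) → x ⊓ᴸ y) ∷ (λ (x , y) → y ⊖ᴸ x) ∷ (wall-only ∘ proj₁) ∷ (wall-only ∘ proj₁) ∷ [])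
    (λ (x , y) → #I x + #I x) (proj₁ ∷ proj₁ ∷ proj₂ ∷ []) (λ _ → 0)
    where open Count (labels ⊗ labels) (λ (x , y) → separated x y)

  -- This is `separated-≤` for Y and the complement of X, up to the edges at s.
  nested-≤ : ∀ X Y → (∀ v → X v ≡ W → ⊥) → (∀ v → Y v ≡ W → X v ≡ I) →
    F k H (X ⊔ˢ Y) + (F k H (Y ⊖ X) + (F k H (wall-only ∘ Y) + F k H (wall-only ∘ Y))) + D H (λ v → #II (X v) (Y v) + #II (X v) (Y v)) ≤
    F k H X + (F k H Y + F k H Y)
  nested-≤ X Y p q = without-D $ F-inequality k H (λ v → X v , Y v) (λ v → T-nested (X v) (Y v) (p v) (q v))
    ((λ (x , y) → x ⊔ᴸ y) ∷ (λ (x , y) → y ⊖ᴸ x) ∷ (wall-only ∘ proj₂) ∷ (wall-only ∘ proj₂) ∷ [])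
    (λ (x , y) → #II x y + #II x y) (proj₁ ∷ proj₂ ∷ proj₂ ∷ []) (λ _ → 0)
    where open Count (labels ⊗ labels) (λ (x , y) → nested x y)

  -- The three-set inequality for cuts. The common wall occurs in four bi-sets on the left and in
  -- three on the right; `wall-only` pays for the fourth.
  three-sets-≤ : ∀ X Y Z → (∀ v → T (equal-walls (X v) (Y v))) → (∀ v → T (equal-walls (X v) (Z v))) →
    F k H (X ⊓ˢ Y ⊓ˢ Z) + (F k H (X ⊖ (Y ⊔ˢ Z)) + (F k H (Y ⊖ (X ⊔ˢ Z)) + F k H (Z ⊖ (X ⊔ˢ Y)))) +
      D H (λ v → #II (X v) (Y v) * #I (Z v) + #II (X v) (Y v) * #I (Z v)) ≤
    F k H X + (F k H Y + (F k H Z + F k H (wall-only ∘ X)))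
  three-sets-≤ X Y Z p q = without-D $ F-inequality k H (λ v → X v , Y v , Z v)
    (λ v → Equivalence.from T-∧ (p v , q v))
    ((λ (x , y , z) → x ⊓ᴸ y ⊓ᴸ z) ∷ (λ (x , y , z) → x ⊖ᴸ (y ⊔ᴸ z)) ∷ (λ (x , y , z) → y ⊖ᴸ (x ⊔ᴸ z)) ∷ (λ (x , y , z) → z ⊖ᴸ (x ⊔ᴸ y)) ∷ [])
    (λ (x , y , z) → #II x y * #I z + #II x y * #I z)
    (proj₁ ∷ (proj₁ ∘ proj₂) ∷ (proj₂ ∘ proj₂) ∷ (wall-only ∘ proj₁) ∷ []) (λ _ → 0)
    where open Count (labels ⊗ (labels ⊗ labels)) (λ (x , y , z) → equal-walls x y ∧ equal-walls x z)

  -- Removing t from the wall of Y exposes the edges between t and Y_I, and likewise for Z. They all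
  -- enter X, and X pays for both because Y and Z are disjoint.
  star-≤ : ∀ X Y Z → (∀ v → T (star (X v) (Y v) (Z v))) →
    F k H (Y ⊖ X) + (F k H (Z ⊖ X) + (F k H (wall-only ∘ Y) + F k H (wall-only ∘ Y))) + D H (#I ∘ X) ≤
    F k H X + (F k H Y + F k H Z)
  star-≤ X Y Z p = without-D $ F-inequality k H (λ v → X v , Y v , Z v) p
    ((λ (x , y , z) → y ⊖ᴸ x) ∷ (λ (x , y , z) → z ⊖ᴸ x) ∷ (λ (x , y , z) → wall-only y) ∷ (λ (x , y , z) → wall-only y) ∷ [])
    (λ (x , y , z) → #I x) (proj₁ ∷ (proj₁ ∘ proj₂) ∷ (proj₂ ∘ proj₂) ∷ []) (λ _ → 0)
    where open Count (labels ⊗ (labels ⊗ labels)) (λ (x , y , z) → star x y z)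

Conn : ∀ {n} → ℕ → Graph n → Set
Conn k H = ∀ L i o → L i ≡ I → L o ≡ O → 2 * k ≤ F k H L

value-≥ : ∀ {m a b : ℕ} → m ≡ a → b ≡ a → m ≤ b
value-≥ p q = ≤-reflexive (trans p (sym q))

-- Elementary properties of f_H

module Basic {n : ℕ} (k : ℕ) (H : Graph n) where

  open Inequalities k H public

  𝔽 : Labeling n → ℕ
  𝔽 = F k H

  𝔻 : (Fin n → ℕ) → ℕ
  𝔻 = D H

  𝔻-δ : ∀ {t g} → 1 ≤ g t → 𝔻 (δ t) ≤ 𝔻 g
  𝔻-δ p = D-mono H (δ-≤ p)

  𝔻-δδ : ∀ {t u g} → ¬ t ≡ u → 1 ≤ g t → 1 ≤ g u → 𝔻 (δ t) + 𝔻 (δ u) ≤ 𝔻 g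
  𝔻-δδ {t} {u} ne p q = ≤-trans (≤-reflexive (sym (D-+ H (δ t) (δ u)))) (D-mono H (δ-δ-≤ ne p q))

  boundary : ∀ L → 𝔻 (#I ∘ L) + k * sumᶠ (#W ∘ L) ≤ 𝔽 L
  boundary L = +-monoˡ-≤ _ (sumᴱ-mono pointwise H)
    where
    head : ∀ a → #I a ≤ entering O a
    head O = z≤n
    head W = z≤n
    head I = s≤s z≤n
    head′ : ∀ a → #I a ≤ entering a O
    head′ O = z≤n
    head′ W = z≤n
    head′ I = s≤s z≤n
    pointwise : ∀ e → atSᴱ (#I ∘ L) e ≤ cutᴱ L e
    pointwise (nothing , nothing) = z≤n
    pointwise (nothing , just v) = head (L v)
    pointwise (just v , nothing) = head′ (L v)
    pointwise (just _ , just _) = z≤n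

  one-wall : ∀ L {p} → L p ≡ W → k ≤ 𝔽 L
  one-wall L {p} e = begin
    k                        ≡⟨ *-identityʳ k ⟨
    k * 1                    ≡⟨ cong (k *_) (sumᶠ-δ p) ⟨
    k * sumᶠ (δ p)           ≤⟨ *-monoʳ-≤ k (sumᶠ-mono {n} (δ-≤ (value-≥ refl (cong #W e)))) ⟩
    k * sumᶠ (#W ∘ L)        ≤⟨ m≤n+m _ _ ⟩
    𝔽 L                      ∎
    where open ≤-Reasoning

  -- The wall alone accounts for 2k, so every edge between s and the inner-set is surplus.
  -- Connectivity is not involved.
  two-walls : ∀ L {p q} → ¬ p ≡ q → L p ≡ W → L q ≡ W → 2 * k + 𝔻 (#I ∘ L) ≤ 𝔽 L
  two-walls L {p} {q} ne a b = begin
    2 * k + 𝔻 (#I ∘ L)                  ≡⟨ +-comm (2 * k) _ ⟩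
    𝔻 (#I ∘ L) + 2 * k                  ≡⟨ cong (𝔻 (#I ∘ L) +_) (*-comm 2 k) ⟩
    𝔻 (#I ∘ L) + k * 2                  ≡⟨ cong (λ m → 𝔻 (#I ∘ L) + k * m) (cong₂ _+_ (sumᶠ-δ p) (sumᶠ-δ q)) ⟨
    𝔻 (#I ∘ L) + k * (sumᶠ (δ p) + sumᶠ (δ q))
      ≡⟨ cong (λ m → 𝔻 (#I ∘ L) + k * m) (sumᶠ-+ (δ p) (δ q)) ⟨
    𝔻 (#I ∘ L) + k * sumᶠ (λ v → δ p v + δ q v)
      ≤⟨ +-monoʳ-≤ (𝔻 (#I ∘ L)) (*-monoʳ-≤ k (sumᶠ-mono {n} (δ-δ-≤ ne (value-≥ refl (cong #W a)) (value-≥ refl (cong #W b))))) ⟩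
    𝔻 (#I ∘ L) + k * sumᶠ (#W ∘ L)      ≤⟨ boundary L ⟩
    𝔽 L                                  ∎
    where open ≤-Reasoning

  wall-only-≤ : ∀ L → (∀ {p q} → L p ≡ W → L q ≡ W → p ≡ q) → 𝔽 (wall-only ∘ L) ≤ k
  wall-only-≤ L unique = begin
    sumᴱ (cutᴱ (wall-only ∘ L)) H + k * sumᶠ (#W ∘ wall-only ∘ L)
      ≤⟨ +-mono-≤ (≤-trans (sumᴱ-mono pointwise H) (≤-reflexive (D-0 H))) (*-monoʳ-≤ k count) ⟩
    k * 1                    ≡⟨ *-identityʳ k ⟩
    k                        ∎
    where
    open ≤-Reasoning
    none : ∀ a b → entering (wall-only a) (wall-only b) ≡ 0
    none O O = refl
    none O W = refl
    none O I = refl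
    none W O = refl
    none W W = refl
    none W I = refl
    none I O = refl
    none I W = refl
    none I I = refl
    pointwise : ∀ e → cutᴱ (wall-only ∘ L) e ≤ atSᴱ (λ _ → 0) e
    pointwise (nothing , nothing) = z≤n
    pointwise (nothing , just v) = ≤-reflexive (none O (L v))
    pointwise (just v , nothing) = ≤-reflexive (none (L v) O)
    pointwise (just u , just v) = ≤-reflexive (none (L u) (L v))
    count : sumᶠ (#W ∘ wall-only ∘ L) ≤ 1
    count with Fin.any? (λ v → L v ≟ᴸ W)
    ... | yes (p , e) = ≤-trans (sumᶠ-mono {n} below) (≤-reflexive (sumᶠ-δ p))
      where
      below : ∀ v → #W (wall-only (L v)) ≤ δ p v
      below v with L v in eq
      ... | O = z≤n
      ... | I = z≤n
      ... | W rewrite unique e eq = ≤-reflexive (sym (δ-refl v))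
    ... | no ∄ = ≤-trans (sumᶠ-mono {n} below) (≤-trans (≤-reflexive (sumᶠ-0 n)) z≤n)
      where
      below : ∀ v → #W (wall-only (L v)) ≤ 0
      below v with L v in eq
      ... | O = z≤n
      ... | I = z≤n
      ... | W = ⊥-elim (∄ (v , eq))

  -- A critical pair with wall {t}, except that the neighbour of s in the inner-set is asked for
  -- separately, in `Member` or `Blocked`.
  record Tight (t : Fin n) (L : Labeling n) : Set where
    field
      at : L t ≡ W
      only : ∀ {v} → L v ≡ W → v ≡ t
      out : ∃[ o ] L o ≡ O
      bound : 𝔽 L ≤ 2 * k

  open Tight public

  -- st and sx are not an admissible pair because of a bi-set with wall {t}.
  Blocked : Fin n → Fin n → Set
  Blocked t x = ∃[ L ] Tight t L × L x ≡ I

  -- Splitting off two edges that end in the inner-set lowers f_H by 2, hence the bound 2k + 1.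
  record Dangerous (L : Labeling n) : Set where
    field
      outside : ∃[ o ] L o ≡ O
      small : 𝔽 L ≤ 1 + 2 * k
      two : 2 ≤ 𝔻 (#I ∘ L)

  open Dangerous public

  dangerous-wall : ∀ {L p q} → Dangerous L → L p ≡ W → L q ≡ W → p ≡ q
  dangerous-wall {L} {p} {q} d a b with p Fin.≟ q
  ... | yes eq = eq
  ... | no ne = ⊥-elim $ refute 3 (λ i f k →
    2 ⊛ k ⊕ i ⊑ f ∷ f ⊑ con 1 ⊕ 2 ⊛ k ∷ con 2 ⊑ i ∷ [])
    (𝔻 (#I ∘ L) ∷ 𝔽 L ∷ k ∷ []) (two-walls L ne a b ∷ small d ∷ two d ∷ [])

  tight : ∀ {L t x} → L t ≡ W → L x ≡ I → Neighbour H x → (∃[ o ] L o ≡ O) → 𝔽 L ≤ 2 * k → Tight t L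
  tight {L} {t} {x} a b nx o f .at = a
  tight {L} {t} {x} a b nx o f .only {v} w with v Fin.≟ t
  ... | yes eq = eq
  ... | no ne = ⊥-elim $ refute 4 (λ d i f k →
    2 ⊛ k ⊕ i ⊑ f ∷ f ⊑ 2 ⊛ k ∷ con 1 ⊑ d ∷ d ⊑ i ∷ [])
    (𝔻 (δ x) ∷ 𝔻 (#I ∘ L) ∷ 𝔽 L ∷ k ∷ [])
    (two-walls L ne w a ∷ f ∷ nx ∷ 𝔻-δ (value-≥ refl (cong #I b)) ∷ [])
  tight a b nx o f .out = o
  tight a b nx o f .bound = f

  not-blocked : ∀ {L t x} → ¬ Blocked t x → L t ≡ W → L x ≡ I → Neighbour H x → (∃[ o ] L o ≡ O) → 1 + 2 * k ≤ 𝔽 L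
  not-blocked {L} nb a b nx o = ≰⇒> λ f → nb (L , tight a b nx o f , b)

-- Tight bi-sets with different walls

module Connectivity {n : ℕ} (k : ℕ) (H : Graph n) (conn : Conn k H) where

  open Basic k H public

  -- Connectivity for the complement. If f_H ≤ 2k + 1, then s has at most one more edge into the
  -- inner-set than to the outside of the outer-set.
  balance : ∀ L {i o} → L i ≡ I → L o ≡ O → 𝔻 (#I ∘ L) + 2 * k ≤ 𝔽 L + 𝔻 (#O ∘ L)
  balance L {i} {o} a b = ≤-trans
    (≤-trans (≤-reflexive (+-comm (𝔻 (#I ∘ L)) (2 * k)))
      (+-monoˡ-≤ (𝔻 (#I ∘ L)) (conn (∁ ∘ L) o i (cong ∁ b) (cong ∁ a))))
    (complement-≤ L)

  -- The union has both t and r in its wall and receives the edge sx, so it costs 2k + 1, while the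
  -- intersection still costs 2k.
  tight-disjoint : ∀ {t r X Y x} → Tight t X → Tight r Y → ¬ t ≡ r → Y t ≡ O → X r ≡ O →
    X x ≡ I → Y x ≡ I → Neighbour H x → ⊥
  tight-disjoint {t} {r} {X} {Y} {x} tX tY ne yt xr xx yx nx = refute 7 (λ a b x y d i k →
    a ⊕ b ⊑ x ⊕ y ∷ x ⊑ 2 ⊛ k ∷ y ⊑ 2 ⊛ k ∷ 2 ⊛ k ⊑ a ∷ 2 ⊛ k ⊕ i ⊑ b ∷ con 1 ⊑ d ∷ d ⊑ i ∷ [])
    (𝔽 (X ⊓ˢ Y) ∷ 𝔽 (X ⊔ˢ Y) ∷ 𝔽 X ∷ 𝔽 Y ∷ 𝔻 (δ x) ∷ 𝔻 (#I ∘ (X ⊔ˢ Y)) ∷ k ∷ [])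
    (submodular X Y ∷ bound tX ∷ bound tY ∷
     conn (X ⊓ˢ Y) x t (cong₂ _⊓ᴸ_ xx yx) (cong₂ _⊓ᴸ_ (at tX) yt) ∷
     two-walls (X ⊔ˢ Y) ne (cong₂ _⊔ᴸ_ (at tX) yt) (cong₂ _⊔ᴸ_ xr (at tY)) ∷
     nx ∷ 𝔻-δ (value-≥ refl (cong #I (cong₂ _⊔ᴸ_ xx yx))) ∷ [])

  -- Otherwise Y ⊖ X is non-trivial and X ⊖ Y has both t and r in its wall, so both cost 2k; the
  -- edge sr lost by posimodularity is one too many.
  tight-nested : ∀ {t r X Y} → Tight t X → Neighbour H r → X r ≡ I → Y r ≡ W → Y t ≡ O → 𝔽 Y ≤ 2 * k →
    ∀ {v} → Y v ≡ I → X v ≡ I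
  tight-nested {t} {r} {X} {Y} tX nr xr yr yt fY {v} yv with X v in xv
  ... | I = refl
  ... | W with refl ← only tX xv with () ← trans (sym yt) yv
  ... | O = ⊥-elim $ refute 8 (λ a b s x y d i k →
    a ⊕ b ⊕ s ⊑ x ⊕ y ∷ x ⊑ 2 ⊛ k ∷ y ⊑ 2 ⊛ k ∷ 2 ⊛ k ⊕ i ⊑ a ∷ 2 ⊛ k ⊑ b ∷ con 1 ⊑ d ∷ d ⊑ s ∷ [])
    (𝔽 (X ⊖ Y) ∷ 𝔽 (Y ⊖ X) ∷ 𝔻 (λ v → shared (X v) (Y v)) ∷ 𝔽 X ∷ 𝔽 Y ∷ 𝔻 (δ r) ∷ 𝔻 (#I ∘ (X ⊖ Y)) ∷ k ∷ [])
    (posimodular X Y ∷ bound tX ∷ fY ∷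
     two-walls (X ⊖ Y) t≢r (cong₂ _⊖ᴸ_ (at tX) yt) (cong₂ _⊖ᴸ_ xr yr) ∷
     conn (Y ⊖ X) v t (cong₂ _⊖ᴸ_ yv xv) (cong₂ _⊖ᴸ_ yt (at tX)) ∷
     nr ∷ 𝔻-δ (value-≥ refl (cong₂ shared xr yr)) ∷ [])
    where
    t≢r : t ≡ r → ⊥
    t≢r refl with () ← trans (sym yt) yr

-- Uncrossing two dangerous bi-sets

⊓ᴸ-O : ∀ a → a ⊓ᴸ O ≡ O
⊓ᴸ-O O = refl
⊓ᴸ-O W = refl
⊓ᴸ-O I = refl

⊔ᴸ-O : ∀ a → a ⊔ᴸ O ≡ a
⊔ᴸ-O O = refl
⊔ᴸ-O W = refl
⊔ᴸ-O I = refl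

⊔ᴸ-I : ∀ a → a ⊔ᴸ I ≡ I
⊔ᴸ-I O = refl
⊔ᴸ-I W = refl
⊔ᴸ-I I = refl

⊔ᴸ-comm : ∀ a b → a ⊔ᴸ b ≡ b ⊔ᴸ a
⊔ᴸ-comm O b = sym (⊔ᴸ-O b)
⊔ᴸ-comm I b = sym (⊔ᴸ-I b)
⊔ᴸ-comm W O = refl
⊔ᴸ-comm W W = refl
⊔ᴸ-comm W I = refl

I≢O : ∀ {a : Label} → a ≡ I → a ≡ O → ⊥
I≢O refl ()

I≢W : ∀ {a : Label} → a ≡ I → a ≡ W → ⊥
I≢W refl ()

O≢W : ∀ {a : Label} → a ≡ O → a ≡ W → ⊥
O≢W refl ()

label-I : ∀ {a} → ¬ a ≡ O → ¬ a ≡ W → a ≡ I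
label-I {O} p q = ⊥-elim (p refl)
label-I {W} p q = ⊥-elim (q refl)
label-I {I} p q = refl

module EvenDegree {n : ℕ} (k : ℕ) (H : Graph n) (conn : Conn k H)
  (half : ℕ) (even : degree H ≡ 2 * half) where

  open Connectivity k H conn public

  𝔻-cong : ∀ {g h} → (∀ v → g v ≡ h v) → 𝔻 g ≡ 𝔻 h
  𝔻-cong p = ≤-antisym (D-mono H (≤-reflexive ∘ p)) (D-mono H (≤-reflexive ∘ sym ∘ p))

  𝔻-2δ : ∀ {t g} → 2 ≤ g t → 𝔻 (δ t) + 𝔻 (δ t) ≤ 𝔻 g
  𝔻-2δ {t} {g} p = ≤-trans (≤-reflexive (sym (D-+ H (δ t) (δ t)))) (D-mono H (δ-+-≤ below strict))
    where
    below : ∀ v → δ t v ≤ g v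
    below = δ-≤ (≤-trans (s≤s z≤n) p)
    strict : δ t t < g t
    strict rewrite δ-refl t = p

  𝔻-δ-+ : ∀ {t g h} → (∀ v → h v ≤ g v) → h t < g t → 𝔻 (δ t) + 𝔻 h ≤ 𝔻 g
  𝔻-δ-+ {t} {g} {h} p q = ≤-trans (≤-reflexive (sym (D-+ H (δ t) h))) (D-mono H (δ-+-≤ p q))

  degree-partition : ∀ L → 2 * half ≡ 𝔻 (#I ∘ L) + 𝔻 (#O ∘ L) + 𝔻 (#W ∘ L)
  degree-partition L = begin
    2 * half                                       ≡⟨ even ⟨
    𝔻 (λ _ → 1)                                    ≡⟨ 𝔻-cong (one ∘ L) ⟩
    𝔻 (λ v → #I (L v) + #O (L v) + #W (L v))       ≡⟨ D-+ H _ _ ⟩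
    𝔻 (λ v → #I (L v) + #O (L v)) + 𝔻 (#W ∘ L)     ≡⟨ cong (_+ 𝔻 (#W ∘ L)) (D-+ H _ _) ⟩
    𝔻 (#I ∘ L) + 𝔻 (#O ∘ L) + 𝔻 (#W ∘ L)           ∎
    where
    open ≡-Reasoning
    one : ∀ a → 1 ≡ #I a + #O a + #W a
    one O = refl
    one W = refl
    one I = refl

  -- With equal walls submodularity bounds the union only by 2k + 2, one more than is needed. These
  -- are the bounds that posimodularity gives instead.
  record Parallel (X Y : Labeling n) : Set where
    field
      wall→ : ∀ {v} → X v ≡ W → Y v ≡ W
      wall← : ∀ {v} → Y v ≡ W → X v ≡ W
      difference : 𝔽 (X ⊖ Y) ≤ 2 * k
      common : 𝔻 (λ v → #II (X v) (Y v)) ≤ 1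

  open Parallel public

  -- Two dangerous bi-sets have a dangerous union or equal walls. The cases
  -- are the positions of the wall of each of them relative to the other.
  module Uncross {X Y : Labeling n} {t y : Fin n} (dX : Dangerous X) (dY : Dangerous Y)
    (xt : X t ≡ I) (yt : Y t ≡ I) (nt : Neighbour H t) (xy : X y ≡ O)
    (hy : (Y y ≡ I × Neighbour H y) ⊎ (Y y ≡ W × 𝔽 Y ≤ 2 * k))
    (union : 𝔽 (X ⊔ˢ Y) ≤ 1 + 2 * k → ∃[ o ] (X ⊔ˢ Y) o ≡ O → ⊥)
    (parallel : Parallel X Y → Y y ≡ I → ∃[ b ] X b ≡ I × Y b ≡ O → ⊥) where

    contained : (∀ v → X v ⊔ᴸ Y v ≡ Y v) → ⊥
    contained p with outside dY
    ... | o , e = union (≤-trans (F-mono k H p) (small dY)) (o , trans (p o) e)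

    yy : (Y y ≡ W → ⊥) → Y y ≡ I
    yy no-wall = [ proj₁ , (λ (e , _) → ⊥-elim (no-wall e)) ]′ hy

    escape : (∀ {v} → X v ≡ W → Y v ≡ I ⊎ Y v ≡ W) → (∀ {v} → Y v ≡ W → X v ≡ I → ⊥) →
      (∃[ b ] X b ≡ I × Y b ≡ O → ⊥) → ⊥
    escape w e k with Fin.any? (λ v → (X v ≟ᴸ I) ×-dec (Y v ≟ᴸ O))
    ... | yes b = k b
    ... | no ∄ = contained inside
      where
      inside : ∀ v → X v ⊔ᴸ Y v ≡ Y v
      inside v with X v in ex
      ... | O = refl
      ... | I = sym (label-I (λ o → ∄ (v , ex , o)) (λ w → e w ex))
      ... | W with w ex
      ...   | inj₁ i rewrite i = refl
      ...   | inj₂ i rewrite i = refl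

    2k≤X⊓Y : 2 * k ≤ 𝔽 (X ⊓ˢ Y)
    2k≤X⊓Y = conn (X ⊓ˢ Y) t y (cong₂ _⊓ᴸ_ xt yt) (cong (_⊓ᴸ Y y) xy)

    2k≤X⊖Y : ∃[ b ] X b ≡ I × Y b ≡ O → 2 * k ≤ 𝔽 (X ⊖ Y)
    2k≤X⊖Y (b , xb , yb) = conn (X ⊖ Y) b t (cong₂ _⊖ᴸ_ xb yb) (cong₂ _⊖ᴸ_ xt yt)

    2k≤Y⊖X : Y y ≡ I → 2 * k ≤ 𝔽 (Y ⊖ X)
    2k≤Y⊖X e = conn (Y ⊖ X) y t (cong₂ _⊖ᴸ_ e xy) (cong₂ _⊖ᴸ_ yt xt)

    shared≥2 : 2 ≤ 𝔻 (λ v → shared (X v) (Y v))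
    shared≥2 = ≤-trans (+-mono-≤ nt nt) (𝔻-2δ (value-≥ refl (cong₂ shared xt yt)))

    #I-join : ∀ v → #I (X v) ≤ #I ((X ⊔ˢ Y) v)
    #I-join v with X v
    ... | O = z≤n
    ... | W = z≤n
    ... | I = s≤s z≤n

    wallless-union : (∀ {v} → X v ≡ W → Y v ≡ I) → (∀ {v} → Y v ≡ W → X v ≡ I) → 𝔽 (X ⊔ˢ Y) ≤ 1 + 2 * k → ⊥
    wallless-union wx wy le with Fin.any? (λ v → (X ⊔ˢ Y) v ≟ᴸ O)
    ... | yes o = union le o
    -- The union has all of V as outer-set. Each neighbour of s that is not inside one bi-set is
    -- inside the other, and t is inside both. With `balance` for both this leaves no neighbour in
    -- the walls and iX = oX + 1, so d_H(s) would be 2 oX + 1.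
    ... | no ∄ = even≢odd half oX (≤-antisym (≮⇒≥ upper) (≮⇒≥ lower))
      where
      iX oX wX iY oY wY ii : ℕ
      iX = 𝔻 (#I ∘ X)
      oX = 𝔻 (#O ∘ X)
      wX = 𝔻 (#W ∘ X)
      iY = 𝔻 (#I ∘ Y)
      oY = 𝔻 (#O ∘ Y)
      wY = 𝔻 (#W ∘ Y)
      ii = 𝔻 (δ t)
      covering : ∀ {x y : Label} → (x ≡ W → y ≡ I) → (y ≡ W → x ≡ I) → (x ⊔ᴸ y ≡ O → ⊥) → #O y + #W y ≤ #I x
      covering {O} {O} p q r = ⊥-elim (r refl)
      covering {x} {W} p q r rewrite q refl = s≤s z≤n
      covering {W} {O} p q r with () ← p refl
      covering {I} {O} p q r = s≤s z≤n
      covering {x} {I} p q r = z≤n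
      rest : ∀ L → 𝔻 (#O ∘ L) + 𝔻 (#W ∘ L) ≡ 𝔻 (λ v → #O (L v) + #W (L v))
      rest L = sym (D-+ H _ _)
      t-strict : ∀ {L M : Labeling n} → L t ≡ I → M t ≡ I → #O (M t) + #W (M t) < #I (L t)
      t-strict p q rewrite p | q = s≤s z≤n
      inX : ii + (oY + wY) ≤ iX
      inX rewrite rest Y = 𝔻-δ-+ (λ v → covering wx wy (λ e → ∄ (v , e))) (t-strict {X} {Y} xt yt)
      inY : ii + (oX + wX) ≤ iY
      inY rewrite rest X = 𝔻-δ-+ (λ v → covering wy wx (λ e → ∄ (v , trans (⊔ᴸ-comm (X v) (Y v)) e)))
        (t-strict {Y} {X} yt xt)
      balX : iX ≤ 1 + oX
      balX = ≮⇒≥ λ lt → refute 4 (λ i o f k → i ⊕ 2 ⊛ k ⊑ f ⊕ o ∷ f ⊑ con 1 ⊕ 2 ⊛ k ∷ con 2 ⊕ o ⊑ i ∷ [])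
        (iX ∷ oX ∷ 𝔽 X ∷ k ∷ []) (balance X xt xy ∷ small dX ∷ lt ∷ [])
      balY : iY ≤ 1 + oY
      balY = ≮⇒≥ λ lt → refute 4 (λ i o f k → i ⊕ 2 ⊛ k ⊑ f ⊕ o ∷ f ⊑ con 1 ⊕ 2 ⊛ k ∷ con 2 ⊕ o ⊑ i ∷ [])
        (iY ∷ oY ∷ 𝔽 Y ∷ k ∷ []) (balance Y yt (proj₂ (outside dY)) ∷ small dY ∷ lt ∷ [])
      upper : 1 + 2 * oX < 2 * half → ⊥
      upper lt = refute 8 (λ h iX oX wX iY oY wY ii →
        con 2 ⊕ 2 ⊛ oX ⊑ 2 ⊛ h ∷ 2 ⊛ h ⊑ iX ⊕ oX ⊕ wX ∷ iX ⊑ con 1 ⊕ oX ∷ iY ⊑ con 1 ⊕ oY ∷ iX ⊑ con 1 ⊕ oX ∷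
        ii ⊕ (oY ⊕ wY) ⊑ iX ∷ ii ⊕ (oX ⊕ wX) ⊑ iY ∷ con 1 ⊑ ii ∷ con 1 ⊑ ii ∷ [])
        (half ∷ iX ∷ oX ∷ wX ∷ iY ∷ oY ∷ wY ∷ ii ∷ [])
        (lt ∷ ≤-reflexive (degree-partition X) ∷ balX ∷ balY ∷ balX ∷ inX ∷ inY ∷ nt ∷ nt ∷ [])
      lower : 2 * half < 1 + 2 * oX → ⊥
      lower lt = refute 8 (λ h iX oX wX iY oY wY ii →
        con 1 ⊕ 2 ⊛ h ⊑ con 1 ⊕ 2 ⊛ oX ∷ iX ⊕ oX ⊕ wX ⊑ 2 ⊛ h ∷ iY ⊑ con 1 ⊕ oY ∷
        ii ⊕ (oY ⊕ wY) ⊑ iX ∷ ii ⊕ (oX ⊕ wX) ⊑ iY ∷ con 1 ⊑ ii ∷ con 1 ⊑ ii ∷ [])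
        (half ∷ iX ∷ oX ∷ wX ∷ iY ∷ oY ∷ wY ∷ ii ∷ [])
        (lt ∷ ≤-reflexive (sym (degree-partition X)) ∷ balY ∷ inX ∷ inY ∷ nt ∷ nt ∷ [])

    equal : (∀ {v} → X v ≡ W → Y v ≡ W) → (∀ {v} → Y v ≡ W → X v ≡ W) → ⊥
    equal p q = escape (inj₂ ∘ p) (λ w i → I≢W i (q w)) λ b →
      parallel (record
        { wall→ = p ; wall← = q
        ; difference = ≮⇒≥ λ lt → refute 6 (λ a b s x y k →
            a ⊕ b ⊕ s ⊑ x ⊕ y ∷ con 1 ⊕ 2 ⊛ k ⊑ a ∷ 2 ⊛ k ⊑ b ∷ con 2 ⊑ s ∷ x ⊑ con 1 ⊕ 2 ⊛ k ∷ y ⊑ con 1 ⊕ 2 ⊛ k ∷ [])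
            (𝔽 (X ⊖ Y) ∷ 𝔽 (Y ⊖ X) ∷ 𝔻 (λ v → shared (X v) (Y v)) ∷ 𝔽 X ∷ 𝔽 Y ∷ k ∷ [])
            (posimodular X Y ∷ lt ∷ 2k≤Y⊖X y-in ∷ shared≥2 ∷ small dX ∷ small dY ∷ [])
        ; common = ≮⇒≥ λ lt → refute 7 (λ a b s x y k i →
            a ⊕ b ⊕ s ⊑ x ⊕ y ∷ 2 ⊛ k ⊑ a ∷ 2 ⊛ k ⊑ b ∷ i ⊕ i ⊑ s ∷ con 2 ⊑ i ∷ con 2 ⊑ i ∷ x ⊑ con 1 ⊕ 2 ⊛ k ∷ y ⊑ con 1 ⊕ 2 ⊛ k ∷ [])
            (𝔽 (X ⊖ Y) ∷ 𝔽 (Y ⊖ X) ∷ 𝔻 (λ v → shared (X v) (Y v)) ∷ 𝔽 X ∷ 𝔽 Y ∷ k ∷ 𝔻 (λ v → #II (X v) (Y v)) ∷ [])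
            (posimodular X Y ∷ 2k≤X⊖Y b ∷ 2k≤Y⊖X y-in ∷
             ≤-trans (≤-reflexive (sym (D-+ H _ _))) (D-mono H (λ v → double (X v) (Y v))) ∷
             lt ∷ lt ∷ small dX ∷ small dY ∷ [])
        }) y-in b
      where
      y-in : Y y ≡ I
      y-in = yy (λ w → O≢W xy (q w))
      double : ∀ a b → #II a b + #II a b ≤ shared a b
      double I I = s≤s (s≤s z≤n)
      double I O = z≤n
      double I W = z≤n
      double O b = z≤n
      double W b = z≤n

    -- p and q are the walls of X and of Y.
    only-outer-q : ∀ {q} → Y q ≡ W → X q ≡ O → (∀ {v} → X v ≡ W → ⊥) → ⊥
    only-outer-q {q} yq xq noX = escape (⊥-elim ∘ noX) (λ w i → I≢O (subst (λ v → X v ≡ I) (dangerous-wall dY w yq) i) xq) λ b →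
      refute 8 (λ a b c d i j x k →
        a ⊕ (b ⊕ (c ⊕ c)) ⊕ d ⊑ i ⊕ (i ⊕ x) ∷ 2 ⊛ k ⊑ a ∷ 2 ⊛ k ⊑ b ∷ k ⊑ c ∷ k ⊑ c ∷ j ⊕ j ⊑ d ∷ con 2 ⊑ j ∷ con 2 ⊑ j ∷
        i ⊑ con 1 ⊕ 2 ⊛ k ∷ i ⊑ con 1 ⊕ 2 ⊛ k ∷ x ⊑ con 1 ⊕ 2 ⊛ k ∷ [])
        (𝔽 (Y ⊓ˢ X) ∷ 𝔽 (X ⊖ Y) ∷ 𝔽 (wall-only ∘ Y) ∷ 𝔻 (λ v → #I (Y v) + #I (Y v)) ∷ 𝔽 Y ∷ 𝔻 (#I ∘ Y) ∷ 𝔽 X ∷ k ∷ [])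
        (separated-≤ Y X (λ v w → subst (λ v → X v ≡ O) (dangerous-wall dY yq w) xq) (λ v w → ⊥-elim (noX w)) ∷
         conn (Y ⊓ˢ X) t y (cong₂ _⊓ᴸ_ yt xt) (trans (cong (Y y ⊓ᴸ_) xy) (⊓ᴸ-O (Y y))) ∷ 2k≤X⊖Y b ∷
         one-wall (wall-only ∘ Y) (cong wall-only yq) ∷ one-wall (wall-only ∘ Y) (cong wall-only yq) ∷
         ≤-reflexive (sym (D-+ H _ _)) ∷ two dY ∷ two dY ∷ small dY ∷ small dY ∷ small dX ∷ [])

    only-inner-q : ∀ {q} → Y q ≡ W → X q ≡ I → (∀ {v} → X v ≡ W → ⊥) → ⊥
    only-inner-q {q} yq xq noX = wallless-union (⊥-elim ∘ noX) in-X $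
      ≮⇒≥ λ lt → refute 8 (λ a b c d i x y k →
        a ⊕ (b ⊕ (c ⊕ c)) ⊕ d ⊑ x ⊕ (y ⊕ y) ∷ con 2 ⊕ 2 ⊛ k ⊑ a ∷ 2 ⊛ k ⊑ b ∷ k ⊑ c ∷ k ⊑ c ∷ i ⊕ i ⊑ d ∷ con 1 ⊑ i ∷ con 1 ⊑ i ∷
        x ⊑ con 1 ⊕ 2 ⊛ k ∷ y ⊑ con 1 ⊕ 2 ⊛ k ∷ y ⊑ con 1 ⊕ 2 ⊛ k ∷ [])
        (𝔽 (X ⊔ˢ Y) ∷ 𝔽 (Y ⊖ X) ∷ 𝔽 (wall-only ∘ Y) ∷ 𝔻 (λ v → #II (X v) (Y v) + #II (X v) (Y v)) ∷ 𝔻 (δ t) ∷ 𝔽 X ∷ 𝔽 Y ∷ k ∷ [])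
        (nested-≤ X Y (λ v → noX) (λ v → in-X) ∷ lt ∷ 2k≤Y⊖X (yy (λ w → I≢O (in-X w) xy)) ∷
         one-wall (wall-only ∘ Y) (cong wall-only yq) ∷ one-wall (wall-only ∘ Y) (cong wall-only yq) ∷
         𝔻-2δ (value-≥ refl (cong₂ (λ a b → #II a b + #II a b) xt yt)) ∷ nt ∷ nt ∷ small dX ∷ small dY ∷ small dY ∷ [])
      where
      in-X : ∀ {v} → Y v ≡ W → X v ≡ I
      in-X w = subst (λ v → X v ≡ I) (dangerous-wall dY yq w) xq

    only-outer-p : ∀ {p} → X p ≡ W → Y p ≡ O → (∀ {v} → Y v ≡ W → ⊥) → ⊥
    only-outer-p {p} xp yp noY = refute 8 (λ a b c d i j x k →
        a ⊕ (b ⊕ (c ⊕ c)) ⊕ d ⊑ i ⊕ (i ⊕ x) ∷ 2 ⊛ k ⊑ a ∷ 2 ⊛ k ⊑ b ∷ k ⊑ c ∷ k ⊑ c ∷ j ⊕ j ⊑ d ∷ con 2 ⊑ j ∷ con 2 ⊑ j ∷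
        i ⊑ con 1 ⊕ 2 ⊛ k ∷ i ⊑ con 1 ⊕ 2 ⊛ k ∷ x ⊑ con 1 ⊕ 2 ⊛ k ∷ [])
        (𝔽 (X ⊓ˢ Y) ∷ 𝔽 (Y ⊖ X) ∷ 𝔽 (wall-only ∘ X) ∷ 𝔻 (λ v → #I (X v) + #I (X v)) ∷ 𝔽 X ∷ 𝔻 (#I ∘ X) ∷ 𝔽 Y ∷ k ∷ [])
        (separated-≤ X Y (λ v w → subst (λ v → Y v ≡ O) (dangerous-wall dX xp w) yp) (λ v w → ⊥-elim (noY w)) ∷
         2k≤X⊓Y ∷ 2k≤Y⊖X (yy noY) ∷
         one-wall (wall-only ∘ X) (cong wall-only xp) ∷ one-wall (wall-only ∘ X) (cong wall-only xp) ∷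
         ≤-reflexive (sym (D-+ H _ _)) ∷ two dX ∷ two dX ∷ small dX ∷ small dX ∷ small dY ∷ [])

    only-inner-p : ∀ {p} → X p ≡ W → Y p ≡ I → (∀ {v} → Y v ≡ W → ⊥) → ⊥
    only-inner-p {p} xp yp noY = escape (inj₁ ∘ in-Y) (λ w _ → noY w) λ b → wallless-union in-Y (⊥-elim ∘ noY) $
      ≤-trans (F-mono k H (λ v → ⊔ᴸ-comm (X v) (Y v))) $
      ≮⇒≥ λ lt → refute 8 (λ a b c d i x y k →
        a ⊕ (b ⊕ (c ⊕ c)) ⊕ d ⊑ x ⊕ (y ⊕ y) ∷ con 2 ⊕ 2 ⊛ k ⊑ a ∷ 2 ⊛ k ⊑ b ∷ k ⊑ c ∷ k ⊑ c ∷ i ⊕ i ⊑ d ∷ con 1 ⊑ i ∷ con 1 ⊑ i ∷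
        x ⊑ con 1 ⊕ 2 ⊛ k ∷ y ⊑ con 1 ⊕ 2 ⊛ k ∷ y ⊑ con 1 ⊕ 2 ⊛ k ∷ [])
        (𝔽 (Y ⊔ˢ X) ∷ 𝔽 (X ⊖ Y) ∷ 𝔽 (wall-only ∘ X) ∷ 𝔻 (λ v → #II (Y v) (X v) + #II (Y v) (X v)) ∷ 𝔻 (δ t) ∷ 𝔽 Y ∷ 𝔽 X ∷ k ∷ [])
        (nested-≤ Y X (λ v → noY) (λ v → in-Y) ∷ lt ∷ 2k≤X⊖Y b ∷
         one-wall (wall-only ∘ X) (cong wall-only xp) ∷ one-wall (wall-only ∘ X) (cong wall-only xp) ∷
         𝔻-2δ (value-≥ refl (cong₂ (λ a b → #II a b + #II a b) yt xt)) ∷ nt ∷ nt ∷ small dY ∷ small dX ∷ small dX ∷ [])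
      where
      in-Y : ∀ {v} → X v ≡ W → Y v ≡ I
      in-Y w = subst (λ v → Y v ≡ I) (dangerous-wall dX xp w) yp

    -- If both walls are non-empty and distinct, some combination of X and Y inherits both: the
    -- union if each wall is outside the other bi-set, a difference in the two mixed cases, the
    -- intersection if each is inside. `two-walls` makes it too expensive, or forces a small union.
    outer-p-outer-q : ∀ {p q} → X p ≡ W → Y q ≡ W → Y p ≡ O → X q ≡ O → ⊥
    outer-p-outer-q {p} {q} xp yq yp xq = refute 6 (λ a b i x y k →
      a ⊕ b ⊑ x ⊕ y ∷ 2 ⊛ k ⊑ a ∷ 2 ⊛ k ⊕ i ⊑ b ∷ y ⊕ con 2 ⊑ 2 ⊛ k ⊕ i ∷ x ⊑ con 1 ⊕ 2 ⊛ k ∷ [])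
      (𝔽 (X ⊓ˢ Y) ∷ 𝔽 (X ⊔ˢ Y) ∷ 𝔻 (#I ∘ (X ⊔ˢ Y)) ∷ 𝔽 X ∷ 𝔽 Y ∷ k ∷ [])
      (submodular X Y ∷ 2k≤X⊓Y ∷
       two-walls (X ⊔ˢ Y) (λ e → O≢W yp (subst (λ v → Y v ≡ W) (sym e) yq)) (cong₂ _⊔ᴸ_ xp yp) (cong₂ _⊔ᴸ_ xq yq) ∷
       bounded hy ∷ small dX ∷ [])
      where
      -- Either sy is an edge into the union beyond the two into X, or y is in the wall of Y and
      -- f_H(Y) is one smaller.
      bounded : (Y y ≡ I × Neighbour H y) ⊎ (Y y ≡ W × 𝔽 Y ≤ 2 * k) → 𝔽 Y + 2 ≤ 2 * k + 𝔻 (#I ∘ (X ⊔ˢ Y))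
      bounded (inj₁ (e , ny)) = ≮⇒≥ λ lt → refute 5 (λ y k i j d →
        con 1 ⊕ (2 ⊛ k ⊕ i) ⊑ y ⊕ con 2 ∷ y ⊑ con 1 ⊕ 2 ⊛ k ∷ d ⊕ j ⊑ i ∷ con 1 ⊑ d ∷ con 2 ⊑ j ∷ [])
        (𝔽 Y ∷ k ∷ 𝔻 (#I ∘ (X ⊔ˢ Y)) ∷ 𝔻 (#I ∘ X) ∷ 𝔻 (δ y) ∷ [])
        (lt ∷ small dY ∷ 𝔻-δ-+ #I-join strict ∷ ny ∷ two dX ∷ [])
        where
        strict : #I (X y) < #I ((X ⊔ˢ Y) y)
        strict rewrite xy | e = s≤s z≤n
      bounded (inj₂ (_ , le)) = ≮⇒≥ λ lt → refute 4 (λ y k i j →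
        con 1 ⊕ (2 ⊛ k ⊕ i) ⊑ y ⊕ con 2 ∷ y ⊑ 2 ⊛ k ∷ j ⊑ i ∷ con 2 ⊑ j ∷ [])
        (𝔽 Y ∷ k ∷ 𝔻 (#I ∘ (X ⊔ˢ Y)) ∷ 𝔻 (#I ∘ X) ∷ []) (lt ∷ le ∷ D-mono H #I-join ∷ two dX ∷ [])

    inner-p-outer-q : ∀ {p q} → X p ≡ W → Y q ≡ W → Y p ≡ I → X q ≡ O → ⊥
    inner-p-outer-q {p} {q} xp yq yp xq =
      escape (λ w → inj₁ (subst (λ v → Y v ≡ I) (dangerous-wall dX xp w) yp))
             (λ w i → I≢O (subst (λ v → X v ≡ I) (dangerous-wall dY w yq) i) xq) λ b →
      refute 7 (λ a b i s x y k →
      a ⊕ b ⊕ s ⊑ x ⊕ y ∷ 2 ⊛ k ⊑ a ∷ 2 ⊛ k ⊕ i ⊑ b ∷ con 2 ⊑ s ∷ y ⊑ 2 ⊛ k ⊕ i ∷ x ⊑ con 1 ⊕ 2 ⊛ k ∷ [])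
      (𝔽 (X ⊖ Y) ∷ 𝔽 (Y ⊖ X) ∷ 𝔻 (#I ∘ (Y ⊖ X)) ∷ 𝔻 (λ v → shared (X v) (Y v)) ∷ 𝔽 X ∷ 𝔽 Y ∷ k ∷ [])
      (posimodular X Y ∷ 2k≤X⊖Y b ∷
       two-walls (Y ⊖ X) (λ e → I≢W yp (subst (λ v → Y v ≡ W) (sym e) yq)) (cong₂ _⊖ᴸ_ yp xp) (cong₂ _⊖ᴸ_ yq xq) ∷
       shared≥2 ∷ bounded hy ∷ small dX ∷ [])
      where
      bounded : (Y y ≡ I × Neighbour H y) ⊎ (Y y ≡ W × 𝔽 Y ≤ 2 * k) → 𝔽 Y ≤ 2 * k + 𝔻 (#I ∘ (Y ⊖ X))
      bounded (inj₁ (e , ny)) = ≮⇒≥ λ lt → refute 4 (λ y k i d →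
        con 1 ⊕ (2 ⊛ k ⊕ i) ⊑ y ∷ y ⊑ con 1 ⊕ 2 ⊛ k ∷ d ⊑ i ∷ con 1 ⊑ d ∷ [])
        (𝔽 Y ∷ k ∷ 𝔻 (#I ∘ (Y ⊖ X)) ∷ 𝔻 (δ y) ∷ [])
        (lt ∷ small dY ∷ 𝔻-δ (value-≥ refl (cong #I (cong₂ _⊖ᴸ_ e xy))) ∷ ny ∷ [])
      bounded (inj₂ (_ , le)) = ≤-trans le (m≤m+n _ _)

    outer-p-inner-q : ∀ {p q} → X p ≡ W → Y q ≡ W → Y p ≡ O → X q ≡ I → ⊥
    outer-p-inner-q {p} {q} xp yq yp xq = refute 9 (λ a b i s x y k d j →
      a ⊕ b ⊕ s ⊑ x ⊕ y ∷ 2 ⊛ k ⊕ i ⊑ a ∷ 2 ⊛ k ⊑ b ∷ d ⊕ j ⊑ i ⊕ s ∷ con 1 ⊑ d ∷ con 2 ⊑ j ∷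
      y ⊑ con 1 ⊕ 2 ⊛ k ∷ x ⊑ con 1 ⊕ 2 ⊛ k ∷ [])
      (𝔽 (X ⊖ Y) ∷ 𝔽 (Y ⊖ X) ∷ 𝔻 (#I ∘ (X ⊖ Y)) ∷ 𝔻 (λ v → shared (X v) (Y v)) ∷ 𝔽 X ∷ 𝔽 Y ∷ k ∷ 𝔻 (δ t) ∷ 𝔻 (#I ∘ X) ∷ [])
      (posimodular X Y ∷
       two-walls (X ⊖ Y) (λ e → O≢W yp (subst (λ v → Y v ≡ W) (sym e) yq)) (cong₂ _⊖ᴸ_ xp yp) (cong₂ _⊖ᴸ_ xq yq) ∷
       2k≤Y⊖X (yy (λ w → I≢O (subst (λ v → X v ≡ I) (dangerous-wall dY yq w) xq) xy)) ∷
       ≤-trans (𝔻-δ-+ (λ v → covered (X v) (Y v)) strict) (≤-reflexive (D-+ H _ _)) ∷ nt ∷ two dX ∷ small dY ∷ small dX ∷ [])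
      where
      covered : ∀ a b → #I a ≤ #I (a ⊖ᴸ b) + shared a b
      covered O b = z≤n
      covered W b = z≤n
      covered I O = s≤s z≤n
      covered I W = s≤s z≤n
      covered I I = s≤s z≤n
      strict : #I (X t) < #I ((X ⊖ Y) t) + shared (X t) (Y t)
      strict rewrite xt | yt = s≤s (s≤s z≤n)

    inner-p-inner-q : ∀ {p q} → X p ≡ W → Y q ≡ W → Y p ≡ I → X q ≡ I → ⊥
    inner-p-inner-q {p} {q} xp yq yp xq = wallless-union
      (λ w → subst (λ v → Y v ≡ I) (dangerous-wall dX xp w) yp)
      (λ w → subst (λ v → X v ≡ I) (dangerous-wall dY yq w) xq) $
      ≮⇒≥ λ lt → refute 7 (λ a b i x y k d →
      a ⊕ b ⊑ x ⊕ y ∷ 2 ⊛ k ⊕ i ⊑ a ∷ con 2 ⊕ 2 ⊛ k ⊑ b ∷ d ⊑ i ∷ con 1 ⊑ d ∷ y ⊑ con 1 ⊕ 2 ⊛ k ∷ x ⊑ con 1 ⊕ 2 ⊛ k ∷ [])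
      (𝔽 (X ⊓ˢ Y) ∷ 𝔽 (X ⊔ˢ Y) ∷ 𝔻 (#I ∘ (X ⊓ˢ Y)) ∷ 𝔽 X ∷ 𝔽 Y ∷ k ∷ 𝔻 (δ t) ∷ [])
      (submodular X Y ∷
       two-walls (X ⊓ˢ Y) (λ e → I≢W yp (subst (λ v → Y v ≡ W) (sym e) yq)) (cong₂ _⊓ᴸ_ xp yp) (cong₂ _⊓ᴸ_ xq yq) ∷
       lt ∷ 𝔻-δ (value-≥ refl (cong #I (cong₂ _⊓ᴸ_ xt yt))) ∷ nt ∷ small dY ∷ small dX ∷ [])

    uncross : ⊥
    uncross with Fin.any? (λ v → X v ≟ᴸ W) | Fin.any? (λ v → Y v ≟ᴸ W)
    ... | no ∄p | no ∄q = equal (λ w → ⊥-elim (∄p (_ , w))) (λ w → ⊥-elim (∄q (_ , w)))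
    ... | no ∄p | yes (q , yq) with X q in xq
    ...   | O = only-outer-q yq xq (λ w → ∄p (_ , w))
    ...   | W = ∄p (q , xq)
    ...   | I = only-inner-q yq xq (λ w → ∄p (_ , w))
    uncross | yes (p , xp) | no ∄q with Y p in yp
    ...   | O = only-outer-p xp yp (λ w → ∄q (_ , w))
    ...   | W = ∄q (p , yp)
    ...   | I = only-inner-p xp yp (λ w → ∄q (_ , w))
    uncross | yes (p , xp) | yes (q , yq) with X q in xq | Y p in yp
    ...   | W | _ = equal
      (λ w → subst (λ v → Y v ≡ W) (dangerous-wall dX xq w) yq)
      (λ w → subst (λ v → X v ≡ W) (dangerous-wall dY yq w) xq)
    ...   | _ | W = equal
      (λ w → subst (λ v → Y v ≡ W) (dangerous-wall dX xp w) yp)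
      (λ w → subst (λ v → X v ≡ W) (dangerous-wall dY yp w) xp)
    ...   | O | O = outer-p-outer-q xp yq yp xq
    ...   | O | I = inner-p-outer-q xp yq yp xq
    ...   | I | O = outer-p-inner-q xp yq yp xq
    ...   | I | I = inner-p-inner-q xp yq yp xq

  uncrossing : ∀ {X Y t y} → Dangerous X → Dangerous Y → X t ≡ I → Y t ≡ I → Neighbour H t → X y ≡ O →
    (Y y ≡ I × Neighbour H y) ⊎ (Y y ≡ W × 𝔽 Y ≤ 2 * k) →
    (𝔽 (X ⊔ˢ Y) ≤ 1 + 2 * k → ∃[ o ] (X ⊔ˢ Y) o ≡ O → ⊥) →
    (Parallel X Y → Y y ≡ I → ∃[ b ] X b ≡ I × Y b ≡ O → ⊥) → ⊥
  uncrossing = Uncross.uncross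

-- Maximal bi-sets, measured by |X_O| + |X_I|

μ : ∀ {n} → Labeling n → ℕ
μ L = sumᶠ (rank ∘ L)

μ-bound : ∀ {n} (L : Labeling n) → μ L ≤ n * 2
μ-bound L = sumᶠ-bound 2 (λ v → rank≤2 (L v))
  where
  rank≤2 : ∀ a → rank a ≤ 2
  rank≤2 O = z≤n
  rank≤2 W = s≤s z≤n
  rank≤2 I = s≤s (s≤s z≤n)

μ-⊔ : ∀ {n} (X Y : Labeling n) {y} → X y ≡ O → ¬ Y y ≡ O → μ X < μ (X ⊔ˢ Y)
μ-⊔ {n} X Y {y} xy yy = sumᶠ-strict {n} (λ v → below (X v) (Y v)) y strict
  where
  below : ∀ a b → rank a ≤ rank (a ⊔ᴸ b)
  below O b = z≤n
  below W O = s≤s z≤n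
  below W W = s≤s z≤n
  below W I = s≤s z≤n
  below I b = ≤-refl
  positive : ∀ a → ¬ a ≡ O → 0 < rank a
  positive O p = ⊥-elim (p refl)
  positive W p = s≤s z≤n
  positive I p = s≤s z≤n
  strict : rank (X y) < rank ((X ⊔ˢ Y) y)
  strict rewrite xy = positive (Y y) yy

-- `P` is not decidable, so a maximal bi-set cannot be searched for. As the goal is ⊥, each larger
-- bi-set that turns up is pursued instead, and the bound 2n on `μ` ends the climb.
with-maximal : ∀ {n} (P : Labeling n → Set) →
  (∀ X → P X → (∀ Y → P Y → μ X < μ Y → ⊥) → ⊥) → ∀ X → P X → ⊥
with-maximal {n} P go X pX = climb (n * 2) X pX (m≤n+m _ _)
  where
  climb : ∀ j X → P X → n * 2 ≤ μ X + j → ⊥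
  climb zero X pX le = go X pX λ Y pY lt →
    <-irrefl refl (<-≤-trans lt (≤-trans (μ-bound Y) (subst (n * 2 ≤_) (+-identityʳ _) le)))
  climb (suc j) X pX le = go X pX λ Y pY lt →
    climb j Y pY (≤-trans le (≤-trans (≤-reflexive (+-suc (μ X) j)) (+-monoˡ-≤ j lt)))

⊔ᴸ-≢O : ∀ {a} b → ¬ a ≡ O → ¬ a ⊔ᴸ b ≡ O
⊔ᴸ-≢O {O} b p q = p refl
⊔ᴸ-≢O {W} O p ()
⊔ᴸ-≢O {W} W p ()
⊔ᴸ-≢O {W} I p ()

-- Blocking

module Blocking {n : ℕ} (k : ℕ) (H : Graph n) (conn : Conn k H)
  (half : ℕ) (even : degree H ≡ 2 * half) where

  open EvenDegree k H conn half even public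

  -- The bounds are 2k - 1 plus the decrease of f_H: it is 2 if both edges end in the inner-set, 1
  -- if one ends there and the other in the wall, and 0 otherwise.
  data Obstruction (t w : Fin n) (L : Labeling n) : Set where
    both : L t ≡ I → L w ≡ I → 𝔽 L ≤ 1 + 2 * k → Obstruction t w L
    left : L t ≡ I → L w ≡ W → 𝔽 L ≤ 2 * k → Obstruction t w L
    right : L t ≡ W → L w ≡ I → 𝔽 L ≤ 2 * k → Obstruction t w L

  -- The pair (st,sw) is not admissible; doubly negated since the
  -- obstructing bi-set is never needed except to derive a contradiction.
  Inadmissible : Fin n → Fin n → Set
  Inadmissible t w = (∀ L → ∃[ o ] L o ≡ O → Obstruction t w L → ⊥) → ⊥

  outside-degree : ∀ {Z t} → Dangerous Z → Z t ≡ I → 1 ≤ 𝔻 (#O ∘ Z)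
  outside-degree {Z} d e = ≮⇒≥ λ lt → refute 4 (λ i o f k →
    i ⊕ 2 ⊛ k ⊑ f ⊕ o ∷ f ⊑ con 1 ⊕ 2 ⊛ k ∷ con 2 ⊑ i ∷ con 1 ⊕ o ⊑ con 1 ∷ [])
    (𝔻 (#I ∘ Z) ∷ 𝔻 (#O ∘ Z) ∷ 𝔽 Z ∷ k ∷ [])
    (balance Z e (proj₂ (outside d)) ∷ small d ∷ two d ∷ lt ∷ [])

  nbr-outside : ∀ Z → 1 ≤ 𝔻 (#O ∘ Z) → ∃[ y ] Neighbour H y × Z y ≡ O
  nbr-outside Z p = let (y , ny , q) = D-positive H (#O ∘ Z) p in y , ny , label-O (Z y) q
    where
    label-O : ∀ a → 1 ≤ #O a → a ≡ O
    label-O O _ = refl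

  dangerous-nbr : ∀ {Z t} → Dangerous Z → Z t ≡ I → ∃[ y ] Neighbour H y × Z y ≡ O
  dangerous-nbr {Z} d e = nbr-outside Z (outside-degree d e)

  two-neighbours : ∀ {Z t y} → ¬ t ≡ y → Neighbour H t → Neighbour H y → Z t ≡ I → Z y ≡ I → 2 ≤ 𝔻 (#I ∘ Z)
  two-neighbours ne nt ny zt zy = ≤-trans (+-mono-≤ nt ny)
    (𝔻-δδ ne (value-≥ refl (cong #I zt)) (value-≥ refl (cong #I zy)))

  dangerous-union : ∀ {X Y} → Dangerous X → 𝔽 (X ⊔ˢ Y) ≤ 1 + 2 * k → ∃[ o ] (X ⊔ˢ Y) o ≡ O → Dangerous (X ⊔ˢ Y)
  dangerous-union d le o .outside = o
  dangerous-union d le o .small = le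
  dangerous-union {X} {Y} d le o .two = ≤-trans (two d) (D-mono H below)
    where
    below : ∀ v → #I (X v) ≤ #I ((X ⊔ˢ Y) v)
    below v with X v
    ... | O = z≤n
    ... | W = z≤n
    ... | I = s≤s z≤n

  module _ {t : Fin n} (nt : Neighbour H t) where

    -- If v were outside Z, then Y ⊖ Z would cost at least as much as Y. Also Z ⊖ Y costs at least
    -- as much as Z: it has t in its wall, and y is either an unblocked inner vertex or a second
    -- wall vertex. The lost edge st is one too many.
    tight-covered : ∀ {y Y Z} → Neighbour H y → ¬ y ≡ t → ¬ Blocked t y → Tight t Y → ∃[ o ] Z o ≡ O → Z t ≡ I →
      (Z y ≡ I × 𝔽 Z ≤ 1 + 2 * k) ⊎ (Z y ≡ W × 𝔽 Z ≤ 2 * k) → ∀ {v} → Y v ≡ I → ¬ Z v ≡ O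
    tight-covered {y} {Y} {Z} ny y≢t nb tY (o , zo) zt hy {v} yv zv = refute 6 (λ a b d z y k →
      a ⊕ b ⊕ d ⊑ z ⊕ y ∷ con 1 ⊕ z ⊑ con 1 ⊕ a ∷ 2 ⊛ k ⊑ b ∷ con 1 ⊑ d ∷ y ⊑ 2 ⊛ k ∷ [])
      (𝔽 (Z ⊖ Y) ∷ 𝔽 (Y ⊖ Z) ∷ 𝔻 (λ v → shared (Z v) (Y v)) ∷ 𝔽 Z ∷ 𝔽 Y ∷ k ∷ [])
      (posimodular Z Y ∷ s≤s (large hy) ∷ conn (Y ⊖ Z) v t (cong₂ _⊖ᴸ_ yv zv) (cong₂ _⊖ᴸ_ (at tY) zt) ∷
       ≤-trans nt (𝔻-δ (value-≥ refl (cong₂ shared zt (at tY)))) ∷ bound tY ∷ [])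
      where
      yy : Y y ≡ O
      yy with Y y in eq
      ... | O = refl
      ... | W = ⊥-elim (y≢t (only tY eq))
      ... | I = ⊥-elim (nb (Y , tY , eq))
      large : (Z y ≡ I × 𝔽 Z ≤ 1 + 2 * k) ⊎ (Z y ≡ W × 𝔽 Z ≤ 2 * k) → 𝔽 Z ≤ 𝔽 (Z ⊖ Y)
      large (inj₁ (zy , le)) = ≤-trans le
        (not-blocked nb (cong₂ _⊖ᴸ_ zt (at tY)) (cong₂ _⊖ᴸ_ zy yy) ny (o , cong (_⊓ᴸ ∁ (Y o)) zo))
      large (inj₂ (zy , le)) = ≤-trans le (≤-trans (m≤m+n _ _)
        (two-walls (Z ⊖ Y) (y≢t ∘ sym) (cong₂ _⊖ᴸ_ zt (at tY)) (cong₂ _⊖ᴸ_ zy yy)))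

    module _ {M x} (tM : Tight t M) (nx : Neighbour H x) (mx : M x ≡ I)
      (all-inadmissible : ∀ {w} → Neighbour H w → ¬ w ≡ t → ¬ Blocked t w → Inadmissible t w) where

      -- A maximal candidate leaves out a neighbour y of s; since y is not
      -- blocked, it comes with a second candidate, which crosses the first one.
      record Candidate (Z : Labeling n) : Set where
        field
          dangerous : Dangerous Z
          centre : Z t ≡ I
          covers-blocked : ∀ {v} → Blocked t v → ¬ Z v ≡ O

      open Candidate

      x≢t : ¬ x ≡ t
      x≢t refl = I≢W mx (at tM)

      candidate : ∀ {w Z} → Neighbour H w → ¬ w ≡ t → ¬ Blocked t w → ∃[ o ] Z o ≡ O → Obstruction t w Z →
        (Candidate Z → (Z w ≡ I × Neighbour H w) ⊎ (Z w ≡ W × 𝔽 Z ≤ 2 * k) → ⊥) → ⊥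
      candidate {w} {Z} nw w≢t nb out (both zt zw le) k = k (record
        { dangerous = record { outside = out ; small = le ; two = two-neighbours (w≢t ∘ sym) nt nw zt zw }
        ; centre = zt
        ; covers-blocked = λ (Y , tY , yv) → tight-covered nw w≢t nb tY out zt (inj₁ (zw , le)) yv
        }) (inj₁ (zw , nw))
      -- With w in the wall only st is known to end inside Z; the second edge is sx, because the
      -- blocked vertex x must lie in Z.
      candidate {w} {Z} nw w≢t nb out (left zt zw le) kont = kont (record
        { dangerous = record { outside = out ; small = m≤n⇒m≤1+n le ; two = two-neighbours (x≢t ∘ sym) nt nx zt zx }
        ; centre = zt
        ; covers-blocked = covers
        }) (inj₂ (zw , le))
        where
        covers : ∀ {v} → Blocked t v → ¬ Z v ≡ O
        covers (Y , tY , yv) = tight-covered nw w≢t nb tY out zt (inj₂ (zw , le)) yv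
        zx : Z x ≡ I
        zx with Z x in eq
        ... | I = refl
        ... | O = ⊥-elim (covers (M , tM , mx) eq)
        ... | W with x Fin.≟ w
        ...   | yes refl = ⊥-elim (nb (M , tM , mx))
        ...   | no ne = ⊥-elim $ refute 4 (λ f i k d →
          2 ⊛ k ⊕ i ⊑ f ∷ f ⊑ 2 ⊛ k ∷ con 1 ⊑ d ∷ d ⊑ i ∷ [])
          (𝔽 Z ∷ 𝔻 (#I ∘ Z) ∷ k ∷ 𝔻 (δ t) ∷ [])
          (two-walls Z ne eq zw ∷ le ∷ nt ∷ 𝔻-δ (value-≥ refl (cong #I zt)) ∷ [])
      candidate {w} {Z} nw w≢t nb out (right zt zw le) k = nb (Z , tight zt zw nw out le , zw)

      -- Used to conclude that as soon as one neighbour of s is blocked with t, all neighbours other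
      -- than t are, which is what an obstacle requires.
      some-admissible : ∀ {w} → Neighbour H w → ¬ w ≡ t → ¬ Blocked t w → ⊥
      some-admissible nw w≢t nb = all-inadmissible nw w≢t nb λ Z out obs →
        candidate nw w≢t nb out obs λ cZ _ → with-maximal Candidate maximal Z cZ
        where
        maximal : ∀ X → Candidate X → (∀ Y → Candidate Y → μ X < μ Y → ⊥) → ⊥
        maximal X cX max = go-on (dangerous-nbr (dangerous cX) (centre cX))
         where
         go-on : ∃[ y ] Neighbour H y × X y ≡ O → ⊥
         go-on (y , ny , xy) = all-inadmissible ny y≢t y-free λ Y out obs →
           candidate ny y≢t y-free out obs λ cY hy →
           uncrossing {X} {Y} {t} {y} (dangerous cX) (dangerous cY) (centre cX) (centre cY) nt xy hy
             (λ le o → max (X ⊔ˢ Y) (record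
               { dangerous = dangerous-union (dangerous cX) le o
               ; centre = cong (_⊔ᴸ Y t) (centre cX)
               ; covers-blocked = λ {v} b → ⊔ᴸ-≢O (Y v) (covers-blocked cX b)
               }) (μ-⊔ X Y xy (λ e → [ (λ (i , _) → I≢O i e) , (λ (w , _) → O≢W e w) ]′ hy)))
             (exceptional Y cY)
           where
           y≢t : ¬ y ≡ t
           y≢t refl = I≢O (centre cX) xy
           y-free : ¬ Blocked t y
           y-free b = covers-blocked cX b xy
           -- The blocked vertex x excludes parallel candidates. If it is inside both, st and sx are
           -- two common edges. If it is in the common wall, X ⊖ Y lies inside M by `tight-nested`,
           -- so b is blocked, and Y must not leave it out.
           exceptional : ∀ Y → Candidate Y → Parallel X Y → Y y ≡ I → ∃[ b ] X b ≡ I × Y b ≡ O → ⊥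
           exceptional Y cY par yy (b , xb , yb) with X x in xx
           ... | O = covers-blocked cX (M , tM , mx) xx
           ... | W = covers-blocked cY (M , tM , tight-nested tM nx mx
                   (cong₂ _⊖ᴸ_ xx (wall→ par xx)) (cong₂ _⊖ᴸ_ (centre cX) (centre cY)) (difference par) (cong₂ _⊖ᴸ_ xb yb)) yb
           ... | I with Y x in yx
           ...   | O = covers-blocked cY (M , tM , mx) yx
           ...   | W = I≢W xx (wall← par yx)
           ...   | I = refute 3 (λ i t x → i ⊑ con 1 ∷ con 1 ⊑ t ∷ con 1 ⊑ x ∷ t ⊕ x ⊑ i ∷ [])
                   (𝔻 (λ v → #II (X v) (Y v)) ∷ 𝔻 (δ t) ∷ 𝔻 (δ x) ∷ [])
                   (common par ∷ nt ∷ nx ∷ 𝔻-δδ (x≢t ∘ sym)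
                     (value-≥ refl (cong₂ #II (centre cX) (centre cY))) (value-≥ refl (cong₂ #II xx yx)) ∷ [])

-- The case in which no neighbours of s block each other

#OO : Label → Label → ℕ
#OO a b = #O a * #O b

module Unblocked {n : ℕ} (k : ℕ) (H : Graph n) (conn : Conn k H)
  (half : ℕ) (even : degree H ≡ 2 * half) where

  open Blocking k H conn half even public

  another : ∀ u → 1 + 𝔻 (δ u) ≤ 2 * half → ∃[ v ] Neighbour H v × ¬ v ≡ u
  another u lt = let (v , nv , p) = D-positive H rest positive in v , nv , λ v≡u → not-u v p (sym v≡u)
    where
    rest : Fin n → ℕ
    rest v = 1 ∸ δ u v
    split : 2 * half ≤ 𝔻 (δ u) + 𝔻 rest
    split = begin
      2 * half                        ≡⟨ even ⟨
      𝔻 (λ _ → 1)                     ≤⟨ D-mono H (λ v → m≤n+m∸n 1 (δ u v)) ⟩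
      𝔻 (λ v → δ u v + rest v)        ≡⟨ D-+ H (δ u) rest ⟩
      𝔻 (δ u) + 𝔻 rest                ∎
      where open ≤-Reasoning
    positive : 1 ≤ 𝔻 rest
    positive = ≮⇒≥ λ r<1 → refute 3 (λ h d r →
      con 1 ⊕ d ⊑ 2 ⊛ h ∷ 2 ⊛ h ⊑ d ⊕ r ∷ con 1 ⊕ r ⊑ con 1 ∷ [])
      (half ∷ 𝔻 (δ u) ∷ 𝔻 rest ∷ []) (lt ∷ split ∷ r<1 ∷ [])
    not-u : ∀ v → 1 ≤ rest v → u ≡ v → ⊥
    not-u v p refl = <-irrefl refl (subst (λ i → 1 ≤ 1 ∸ i) (δ-refl v) p)

  half-bound : ∀ {Z t} → Dangerous Z → Z t ≡ I → (∀ {g} → Neighbour H g → Z g ≡ W → ⊥) → 𝔻 (#I ∘ Z) ≤ half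
  half-bound {Z} d e free = ≮⇒≥ λ lt → refute 6 (λ h i o w f k →
    con 1 ⊕ h ⊑ i ∷ con 1 ⊕ h ⊑ i ∷ i ⊕ 2 ⊛ k ⊑ f ⊕ o ∷ f ⊑ con 1 ⊕ 2 ⊛ k ∷ i ⊕ o ⊕ w ⊑ 2 ⊛ h ∷ [])
    (half ∷ 𝔻 (#I ∘ Z) ∷ 𝔻 (#O ∘ Z) ∷ 𝔻 (#W ∘ Z) ∷ 𝔽 Z ∷ k ∷ [])
    (lt ∷ lt ∷ balance Z e (proj₂ (outside d)) ∷ small d ∷ ≤-reflexive (sym (degree-partition Z)) ∷ [])

  no-wall-degree : ∀ Z → (∀ {g} → Neighbour H g → Z g ≡ W → ⊥) → 𝔻 (#W ∘ Z) ≤ 0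
  no-wall-degree Z free = ≤-trans (D-nbr-mono H zero-at) (≤-reflexive (D-0 H))
    where
    zero-at : ∀ v → Neighbour H v → #W (Z v) ≤ 0
    zero-at v nv with Z v in eq
    ... | O = z≤n
    ... | W = ⊥-elim (free nv eq)
    ... | I = z≤n

  module _ (2≤k : 2 ≤ k) (1≤half : 1 ≤ half)
    (unblocked : ∀ {t x} → Neighbour H t → Neighbour H x → ¬ Blocked t x)
    (all-inadmissible : ∀ {u v} → Neighbour H u → Neighbour H v → (u ≡ v → 2 ≤ 𝔻 (δ u)) → Inadmissible u v) where

    dangerous-pair : ∀ {t w} → Neighbour H t → Neighbour H w → ¬ t ≡ w →
      (∀ Z → Dangerous Z → Z t ≡ I → Z w ≡ I → ⊥) → ⊥
    dangerous-pair {t} {w} nt nw ne κ = all-inadmissible nt nw (⊥-elim ∘ ne) λ where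
      Z out (both zt zw le) → κ Z (record { outside = out ; small = le ; two = two-neighbours ne nt nw zt zw }) zt zw
      Z out (left zt zw le) → unblocked nw nt (Z , tight zw zt nt out le , zt)
      Z out (right zt zw le) → unblocked nt nw (Z , tight zt zw nw out le , zw)

    some-dangerous : (∀ Z → Dangerous Z → ⊥) → ⊥
    some-dangerous κ = choose (D-positive H (λ _ → 1) (≤-trans 1≤half (≤-trans (m≤m+n half _) (≤-reflexive (sym even)))))
      where
      same : ∀ {u} → Neighbour H u → 2 ≤ 𝔻 (δ u) → ⊥
      same nu le = all-inadmissible nu nu (λ _ → le) λ where
        Z out (both zu _ le′) → κ Z (record { outside = out ; small = le′ ; two = ≤-trans le (𝔻-δ (value-≥ refl (cong #I zu))) })
        Z out (left zu zu′ _) → I≢W zu zu′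
        Z out (right zu′ zu _) → I≢W zu zu′
      different : ∀ {u} → Neighbour H u → ∃[ v ] Neighbour H v × ¬ v ≡ u → ⊥
      different nu (v , nv , v≢u) = dangerous-pair nv nu v≢u λ Z d _ _ → κ Z d
      choose : ∃[ u ] Neighbour H u × 1 ≤ 1 → ⊥
      choose (u , nu , _) = different nu (another u (≤-trans (≰⇒> (same nu))
        (≤-trans (≤-reflexive (sym (*-identityʳ 2))) (*-monoʳ-≤ 2 1≤half))))

    -- When no pair is blocked, a maximal dangerous bi-set may cross another one
    -- in a single edge of s. Then all walls are equal, and three such bi-sets
    -- through t contradict k ≥ 2.
    record Escaping (X : Labeling n) (t : Fin n) (Y : Labeling n) : Set where
      field
        dangerous : Dangerous Y
        centre : Y t ≡ I
        escapes : ∃[ y ] Neighbour H y × X y ≡ O × Y y ≡ I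

    open Escaping

    parallel-outside : ∀ {X Y t x} → Parallel X Y → Neighbour H t → X t ≡ I → Y t ≡ I →
      X x ≡ I → Neighbour H x → ¬ x ≡ t → Y x ≡ O
    parallel-outside {X} {Y} {t} {x} par nt xt yt xx nx x≢t with Y x in yx
    ... | O = refl
    ... | W = ⊥-elim (I≢W xx (wall← par yx))
    ... | I = ⊥-elim $ refute 3 (λ i t x → i ⊑ con 1 ∷ con 1 ⊑ t ∷ con 1 ⊑ x ∷ t ⊕ x ⊑ i ∷ [])
                  (𝔻 (λ v → #II (X v) (Y v)) ∷ 𝔻 (δ t) ∷ 𝔻 (δ x) ∷ [])
                  (common par ∷ nt ∷ nx ∷ 𝔻-δδ (x≢t ∘ sym)
                    (value-≥ refl (cong₂ #II xt yt)) (value-≥ refl (cong₂ #II xx yx)) ∷ [])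

    -- The four bi-sets on the left of `three-sets-≤` are non-trivial and st is lost twice: 8k + 2
    -- against 3(2k + 1) + k. This is where k ≥ 2 is decisive.
    three-parallel : ∀ {X Y Z t x y z} → Dangerous X → Dangerous Y → Dangerous Z → Neighbour H t →
      X t ≡ I → Y t ≡ I → Z t ≡ I → Parallel X Y → Parallel X Z →
      X x ≡ I → Y x ≡ O → Z x ≡ O → X y ≡ O → Y y ≡ I → Z y ≡ O → X z ≡ O → Y z ≡ O → Z z ≡ I → ⊥
    three-parallel {X} {Y} {Z} {t} {x} {y} {z} dX dY dZ nt xt yt zt XY XZ xx yx zx xy yy zy xz yz zz =
      refute 11 (λ a b c d s x y z w k t →
        a ⊕ (b ⊕ (c ⊕ d)) ⊕ s ⊑ x ⊕ (y ⊕ (z ⊕ w)) ∷ 2 ⊛ k ⊑ a ∷ 2 ⊛ k ⊑ b ∷ 2 ⊛ k ⊑ c ∷ 2 ⊛ k ⊑ d ∷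
        x ⊑ con 1 ⊕ 2 ⊛ k ∷ y ⊑ con 1 ⊕ 2 ⊛ k ∷ z ⊑ con 1 ⊕ 2 ⊛ k ∷ w ⊑ k ∷ con 2 ⊑ k ∷ t ⊕ t ⊑ s ∷ con 1 ⊑ t ∷ con 1 ⊑ t ∷ [])
        (𝔽 (X ⊓ˢ Y ⊓ˢ Z) ∷ 𝔽 (X ⊖ (Y ⊔ˢ Z)) ∷ 𝔽 (Y ⊖ (X ⊔ˢ Z)) ∷ 𝔽 (Z ⊖ (X ⊔ˢ Y)) ∷
         𝔻 (λ v → #II (X v) (Y v) * #I (Z v) + #II (X v) (Y v) * #I (Z v)) ∷ 𝔽 X ∷ 𝔽 Y ∷ 𝔽 Z ∷ 𝔽 (wall-only ∘ X) ∷ k ∷ 𝔻 (δ t) ∷ [])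
        (three-sets-≤ X Y Z
          (λ v → T-equal-walls (X v) (Y v) (wall→ XY) (wall← XY))
          (λ v → T-equal-walls (X v) (Z v) (wall→ XZ) (wall← XZ)) ∷
         conn (X ⊓ˢ Y ⊓ˢ Z) t y (cong₂ _⊓ᴸ_ xt (cong₂ _⊓ᴸ_ yt zt)) (cong (_⊓ᴸ (Y ⊓ˢ Z) y) xy) ∷
         conn (X ⊖ (Y ⊔ˢ Z)) x t (cong₂ _⊖ᴸ_ xx (cong₂ _⊔ᴸ_ yx zx)) (cong₂ _⊖ᴸ_ xt (cong₂ _⊔ᴸ_ yt zt)) ∷
         conn (Y ⊖ (X ⊔ˢ Z)) y t (cong₂ _⊖ᴸ_ yy (cong₂ _⊔ᴸ_ xy zy)) (cong₂ _⊖ᴸ_ yt (cong₂ _⊔ᴸ_ xt zt)) ∷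
         conn (Z ⊖ (X ⊔ˢ Y)) z t (cong₂ _⊖ᴸ_ zz (cong₂ _⊔ᴸ_ xz yz)) (cong₂ _⊖ᴸ_ zt (cong₂ _⊔ᴸ_ xt yt)) ∷
         small dX ∷ small dY ∷ small dZ ∷ wall-only-≤ X (dangerous-wall dX) ∷ 2≤k ∷
         𝔻-2δ (value-≥ refl (cong₂ (λ a b → a + b) (cong₂ _*_ (cong₂ #II xt yt) (cong #I zt)) (cong₂ _*_ (cong₂ #II xt yt) (cong #I zt)))) ∷
         nt ∷ nt ∷ [])

    module _ {X : Labeling n} (dX : Dangerous X) (maxX : ∀ Y → Dangerous Y → μ X < μ Y → ⊥)
      {t} (nt : Neighbour H t) (xt : X t ≡ I) where

      with-parallel : ∀ {Y y} → Dangerous Y → Y t ≡ I → Neighbour H y → X y ≡ O → Y y ≡ I →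
        (Parallel X Y → ⊥) → ⊥
      with-parallel {Y} dY yt ny xy yy κ = uncrossing dX dY xt yt nt xy (inj₁ (yy , ny))
        (λ le o → maxX (X ⊔ˢ Y) (dangerous-union dX le o) (μ-⊔ X Y xy (I≢O yy)))
        (λ par _ _ → κ par)

      module _ {Y : Labeling n} (eY : Escaping X t Y) (maxY : ∀ Z → Escaping X t Z → μ Y < μ Z → ⊥) (par : Parallel X Y) where

        dY : Dangerous Y
        dY = dangerous eY
        yt : Y t ≡ I
        yt = centre eY

        leaving : ∃[ u ] Neighbour H u × X u ≡ I × Y u ≡ O
        leaving = let (u , nu , p) = D-positive H (λ v → #IO (X v) (Y v)) positive in u , nu , labels-IO (X u) (Y u) p
          where
          split : ∀ v → #I (X v) ≤ #II (X v) (Y v) + #IO (X v) (Y v)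
          split v with X v in ex | Y v in ey
          ... | O | _ = z≤n
          ... | W | _ = z≤n
          ... | I | I = s≤s z≤n
          ... | I | O = s≤s z≤n
          ... | I | W = ⊥-elim (I≢W ex (wall← par ey))
          positive : 1 ≤ 𝔻 (λ v → #IO (X v) (Y v))
          positive = ≮⇒≥ λ lt → refute 3 (λ i j o →
            con 2 ⊑ i ∷ i ⊑ j ⊕ o ∷ j ⊑ con 1 ∷ con 1 ⊕ o ⊑ con 1 ∷ [])
            (𝔻 (#I ∘ X) ∷ 𝔻 (λ v → #II (X v) (Y v)) ∷ 𝔻 (λ v → #IO (X v) (Y v)) ∷ [])
            (two dX ∷ ≤-trans (D-mono H split) (≤-reflexive (D-+ H _ _)) ∷ common par ∷ lt ∷ [])
          labels-IO : ∀ a b → 1 ≤ #IO a b → a ≡ I × b ≡ O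
          labels-IO I O _ = refl , refl

        -- A neighbour g in the wall would be blocked by X ⊖ Y with the neighbour u that `leaving`
        -- provides.
        wall-free : ∀ {g} → Neighbour H g → X g ≡ W → ⊥
        wall-free {g} ng xg = go leaving
          where
          go : ∃[ u ] Neighbour H u × X u ≡ I × Y u ≡ O → ⊥
          go (u , nu , xu , yu) = unblocked ng nu (X ⊖ Y ,
            tight (cong₂ _⊖ᴸ_ xg (wall→ par xg)) (cong₂ _⊖ᴸ_ xu yu) nu (t , cong₂ _⊖ᴸ_ xt yt) (difference par) ,
            cong₂ _⊖ᴸ_ xu yu)

        -- Each of X and Y receives at most half of the edges at s, no edge ends in the common wall,
        -- and st is counted in both; hence X and Y cannot receive all edges.
        outside-both : ∃[ z ] Neighbour H z × X z ≡ O × Y z ≡ O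
        outside-both = let (z , nz , p) = D-positive H (λ v → #OO (X v) (Y v)) positive in z , nz , labels-OO (X z) (Y z) p
          where
          split : ∀ v → #O (X v) + #II (X v) (Y v) ≤ #OO (X v) (Y v) + #I (Y v)
          split v with X v in ex | Y v in ey
          ... | O | O = s≤s z≤n
          ... | O | W = ⊥-elim (O≢W ex (wall← par ey))
          ... | O | I = s≤s z≤n
          ... | W | _ = z≤n
          ... | I | O = z≤n
          ... | I | W = z≤n
          ... | I | I = s≤s z≤n
          positive : 1 ≤ 𝔻 (λ v → #OO (X v) (Y v))
          positive = ≮⇒≥ λ lt → refute 8 (λ h iX oX wX iY ii oo t →
            con 1 ⊕ oo ⊑ con 1 ∷ 2 ⊛ h ⊑ iX ⊕ oX ⊕ wX ∷ wX ⊑ con 0 ∷ iX ⊑ h ∷ iY ⊑ h ∷ oX ⊕ ii ⊑ oo ⊕ iY ∷ con 1 ⊑ t ∷ t ⊑ ii ∷ [])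
            (half ∷ 𝔻 (#I ∘ X) ∷ 𝔻 (#O ∘ X) ∷ 𝔻 (#W ∘ X) ∷ 𝔻 (#I ∘ Y) ∷ 𝔻 (λ v → #II (X v) (Y v)) ∷ 𝔻 (λ v → #OO (X v) (Y v)) ∷ 𝔻 (δ t) ∷ [])
            (lt ∷ ≤-reflexive (degree-partition X) ∷ no-wall-degree X wall-free ∷ half-bound dX xt wall-free ∷
             half-bound dY yt (λ ng → wall-free ng ∘ wall← par) ∷
             subst₂ _≤_ (D-+ H _ _) (D-+ H _ _) (D-mono H split) ∷ nt ∷ 𝔻-δ (value-≥ refl (cong₂ #II xt yt)) ∷ [])
          labels-OO : ∀ a b → 1 ≤ #OO a b → a ≡ O × b ≡ O
          labels-OO O O _ = refl , refl

        -- The pair (st,sz) yields a third dangerous bi-set. The maximality of X, and that of Y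
        -- among the escaping ones, make it parallel to both.
        third-set : ⊥
        third-set = go leaving (escapes eY) outside-both
         where
         go : ∃[ x ] Neighbour H x × X x ≡ I × Y x ≡ O → ∃[ y ] Neighbour H y × X y ≡ O × Y y ≡ I →
           ∃[ z ] Neighbour H z × X z ≡ O × Y z ≡ O → ⊥
         go (x , nx , xx , yx) (y , ny , xy , yy) (z , nz , xz , yz) =
          dangerous-pair nt nz (λ { refl → I≢O xt xz }) λ Z dZ zt zz →
          with-parallel dZ zt nz xz zz λ XZ →
          uncrossing dY dZ yt zt nt yz (inj₁ (zz , nz))
            (λ le o → maxY (Y ⊔ˢ Z) (record
              { dangerous = dangerous-union dY le o
              ; centre = cong (_⊔ᴸ Z t) yt
              ; escapes = y , ny , xy , cong (_⊔ᴸ Z y) yy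
              }) (μ-⊔ Y Z yz (I≢O zz)))
            λ YZ _ _ → three-parallel dX dY dZ nt xt yt zt par XZ
              xx yx (parallel-outside XZ nt xt zt xx nx (λ { refl → I≢O yt yx }))
              xy yy (parallel-outside YZ nt yt zt yy ny (λ { refl → I≢O xt xy }))
              xz yz zz

    some-unblocked-admissible : ⊥
    some-unblocked-admissible = some-dangerous λ Z dZ → with-maximal Dangerous
      (λ X dX maxX → start X dX maxX (D-positive H (#I ∘ X) (≤-trans (s≤s z≤n) (two dX)))) Z dZ
      where
      start : ∀ X → Dangerous X → (∀ Y → Dangerous Y → μ X < μ Y → ⊥) →
        ∃[ t ] Neighbour H t × 1 ≤ #I (X t) → ⊥
      start X dX maxX (t , nt , p) = go (label-1 (X t) p)
        where
        label-1 : ∀ a → 1 ≤ #I a → a ≡ I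
        label-1 I _ = refl
        go : X t ≡ I → ⊥
        go xt = second (dangerous-nbr dX xt)
          where
          second : ∃[ y ] Neighbour H y × X y ≡ O → ⊥
          second (y , ny , xy) = dangerous-pair nt ny (λ { refl → I≢O xt xy }) λ Y₀ dY₀ y₀t y₀y →
            with-maximal (Escaping X t)
              (λ Y eY maxY → let (y , ny , xy , yy) = escapes eY in
                with-parallel dX maxX nt xt (dangerous eY) (centre eY) ny xy yy (third-set dX maxX nt xt eY maxY))
              Y₀ (record { dangerous = dY₀ ; centre = y₀t ; escapes = y , ny , xy , y₀y })

-- Families of tight bi-sets with a common wall

Disjoint : ∀ {n} → Labeling n → Labeling n → Set
Disjoint X Y = ∀ v → X v ≡ I → Y v ≡ I → ⊥

Covered : ∀ {n} → List (Labeling n) → Fin n → Set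
Covered C v = Any (λ Y → Y v ≡ I) C

module _ {n : ℕ} (k : ℕ) (H : Graph n) where

  open Basic k H

  Member : Fin n → Labeling n → Set
  Member t Y = Tight t Y × (∃[ x ] Neighbour H x × Y x ≡ I)

  record Family (t : Fin n) : Set where
    field
      members : List (Labeling n)
      tights : All (Member t) members
      disjoint : AllPairs Disjoint members
      covers : ∀ {v} → Neighbour H v → ¬ v ≡ t → Covered members v

    tight-member : ∀ {Y} → Y ∈ members → Tight t Y
    tight-member Y∈ = proj₁ (All.lookup tights Y∈)

    member-nbr : ∀ {Y} → Y ∈ members → ∃[ x ] Neighbour H x × Y x ≡ I
    member-nbr Y∈ = proj₂ (All.lookup tights Y∈)

    unique : ∀ {X Y v} → X ∈ members → Y ∈ members → X v ≡ I → Y v ≡ I → X ≡ Y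
    unique {X} {Y} {v} = go disjoint
      where
      go : ∀ {C} → AllPairs Disjoint C → X ∈ C → Y ∈ C → X v ≡ I → Y v ≡ I → X ≡ Y
      go (_ ∷ _) (here refl) (here refl) _ _ = refl
      go (d ∷ _) (here refl) (there Y∈) p q = ⊥-elim (All.lookup d Y∈ v p q)
      go (d ∷ _) (there X∈) (here refl) p q = ⊥-elim (All.lookup d X∈ v q p)
      go (_ ∷ ds) (there X∈) (there Y∈) p q = go ds X∈ Y∈ p q

    cover : ∀ {v} → Neighbour H v → ¬ v ≡ t → ∃[ Y ] Y ∈ members × Y v ≡ I
    cover nv ne = find (covers nv ne)

module Families {n : ℕ} (k : ℕ) (H : Graph n) (conn : Conn k H)
  (half : ℕ) (even : degree H ≡ 2 * half) where

  open Unblocked k H conn half even public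

  tight-≢-centre : ∀ {t Y v} → Tight t Y → Y v ≡ I → ¬ v ≡ t
  tight-≢-centre tY yv refl = I≢W yv (at tY)

  tight-label : ∀ {t Y v} → Tight t Y → ¬ v ≡ t → ¬ Y v ≡ I → Y v ≡ O
  tight-label {t} {Y} {v} tY ne ni with Y v in eq
  ... | O = refl
  ... | W = ⊥-elim (ne (only tY eq))
  ... | I = ⊥-elim (ni refl)

  tight-posimodular : ∀ {t X Y c} → Tight t X → Tight t Y → Y c ≡ I → X c ≡ O →
    𝔽 (X ⊖ Y) + 𝔻 (λ v → shared (X v) (Y v)) ≤ 2 * k
  tight-posimodular {t} {X} {Y} {c} tX tY yc xc = ≮⇒≥ λ lt → refute 6 (λ a b s x y k →
    a ⊕ b ⊕ s ⊑ x ⊕ y ∷ con 1 ⊕ 2 ⊛ k ⊑ a ⊕ s ∷ 2 ⊛ k ⊑ b ∷ x ⊑ 2 ⊛ k ∷ y ⊑ 2 ⊛ k ∷ [])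
    (𝔽 (X ⊖ Y) ∷ 𝔽 (Y ⊖ X) ∷ 𝔻 (λ v → shared (X v) (Y v)) ∷ 𝔽 X ∷ 𝔽 Y ∷ k ∷ [])
    (posimodular X Y ∷ lt ∷
     conn (Y ⊖ X) c o (cong₂ _⊖ᴸ_ yc xc) (cong (_⊓ᴸ ∁ (X o)) yo) ∷
     bound tX ∷ bound tY ∷ [])
    where
    o : Fin n
    o = proj₁ (out tY)
    yo : Y o ≡ O
    yo = proj₂ (out tY)

  tight-difference : ∀ {t X Y c} → Tight t X → Tight t Y → Y c ≡ I → X c ≡ O → Tight t (X ⊖ Y)
  tight-difference tX tY yc xc .at = cong₂ _⊖ᴸ_ (at tX) (at tY)
  tight-difference {t} {X} {Y} tX tY yc xc .only {v} e with X v in ex | Y v in ey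
  ... | W | _ = only tX ex
  ... | I | W = only tY ey
  tight-difference {X = X} {Y} tX tY yc xc .out = let (o , xo) = out tX in o , cong (_⊓ᴸ ∁ (Y o)) xo
  tight-difference tX tY yc xc .bound = ≤-trans (m≤m+n _ _) (tight-posimodular tX tY yc xc)

  -- Both differences already cost 2k, so posimodularity leaves no room for a lost edge at s.
  tight-no-common : ∀ {t X Y b c x} → Tight t X → Tight t Y → X b ≡ I → Y b ≡ O → Y c ≡ I → X c ≡ O →
    Neighbour H x → X x ≡ I → Y x ≡ I → ⊥
  tight-no-common {t} {X} {Y} {b} {c} {x} tX tY xb yb yc xc nx xx yx = refute 4 (λ a s d k →
    a ⊕ s ⊑ 2 ⊛ k ∷ 2 ⊛ k ⊑ a ∷ d ⊑ s ∷ con 1 ⊑ d ∷ [])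
    (𝔽 (X ⊖ Y) ∷ 𝔻 (λ v → shared (X v) (Y v)) ∷ 𝔻 (δ x) ∷ k ∷ [])
    (tight-posimodular tX tY yc xc ∷
     conn (X ⊖ Y) b o (cong₂ _⊖ᴸ_ xb yb) (cong (_⊓ᴸ ∁ (Y o)) xo) ∷
     𝔻-δ (≤-trans (s≤s z≤n) (value-≥ refl (cong₂ shared xx yx))) ∷ nx ∷ [])
    where
    o : Fin n
    o = proj₁ (out tX)
    xo : X o ≡ O
    xo = proj₂ (out tX)

  -- `keeps` speaks of neighbours of s only, since passing to a difference may lose other vertices.
  -- `within` ensures that later members stay disjoint from those already passed.
  record Insertion (t : Fin n) (X : Labeling n) (C : List (Labeling n)) : Set where
    field
      result : List (Labeling n)
      tights : All (Member k H t) result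
      disjoint : AllPairs Disjoint result
      keeps : ∀ {v} → Neighbour H v → X v ≡ I ⊎ Covered C v → Covered result v
      within : ∀ {v} → Covered result v → X v ≡ I ⊎ Covered C v

  open Insertion

  -- Since no edge of s ends in the intersection of two crossing tight
  -- bi-sets, X may be replaced by its difference with a member of C.
  insert : ∀ {t X} C → Member k H t X → All (Member k H t) C → AllPairs Disjoint C → Insertion t X C
  insert [] mX [] [] = record
    { result = _ ∷ [] ; tights = mX ∷ [] ; disjoint = [] ∷ []
    ; keeps = λ { _ (inj₁ e) → here e }
    ; within = λ { (here e) → inj₁ e }
    }
  insert {t} {X} (Y ∷ C) mX (mY ∷ mC) (dY ∷ dC)
    with Fin.any? (λ v → (X v ≟ᴸ I) ×-dec (Y v ≟ᴸ O)) | Fin.any? (λ v → (Y v ≟ᴸ I) ×-dec (X v ≟ᴸ O))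
  ... | no ∄ | _ = record
    { result = Y ∷ C ; tights = mY ∷ mC ; disjoint = dY ∷ dC
    ; keeps = λ { {v} _ (inj₁ e) → here (label-I (λ o → ∄ (v , e , o))
                    (λ w → tight-≢-centre (proj₁ mX) e (only (proj₁ mY) w))) ; _ (inj₂ c) → c }
    ; within = inj₂
    }
  ... | yes _ | no ∄ = let R = insert C mX mC dC in record
    { result = result R ; tights = tights R ; disjoint = disjoint R
    ; keeps = λ { nv (inj₁ e) → keeps R nv (inj₁ e)
                ; {v} nv (inj₂ (here e)) → keeps R nv (inj₁ (label-I (λ o → ∄ (v , e , o))
                    (λ w → tight-≢-centre (proj₁ mY) e (only (proj₁ mX) w))))
                ; nv (inj₂ (there c)) → keeps R nv (inj₂ c) }
    ; within = λ c → [ inj₁ , inj₂ ∘ there ]′ (within R c)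
    }
  ... | yes (b , xb , yb) | yes (c , yc , xc) = record
    { result = Y ∷ result R
    ; tights = mY ∷ tights R
    ; disjoint = All.tabulate apart ∷ disjoint R
    ; keeps = λ { nv (inj₁ e) → there (keeps R nv (inj₁ (minus nv e)))
                ; nv (inj₂ (here e)) → here e
                ; nv (inj₂ (there d)) → there (keeps R nv (inj₂ d)) }
    ; within = λ { (here e) → inj₂ (here e) ; {v} (there d) → [ inj₁ ∘ from-X v , inj₂ ∘ there ]′ (within R d) }
    }
    where
    minus : ∀ {v} → Neighbour H v → X v ≡ I → (X ⊖ Y) v ≡ I
    minus nv e = cong₂ _⊖ᴸ_ e (tight-label (proj₁ mY) (tight-≢-centre (proj₁ mX) e)
      (tight-no-common (proj₁ mX) (proj₁ mY) xb yb yc xc nv e))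
    from-X : ∀ v → (X ⊖ Y) v ≡ I → X v ≡ I
    from-X v e with X v
    ... | I = refl
    ... | W with Y v
    ...   | O with () ← e
    ...   | W with () ← e
    ...   | I with () ← e
    not-Y : ∀ v → (X ⊖ Y) v ≡ I → Y v ≡ I → ⊥
    not-Y v e f with X v
    ... | I = I≢O e (cong ∁ f)
    ... | W with Y v
    ...   | I with () ← e
    R : Insertion t (X ⊖ Y) C
    R = insert C (tight-difference (proj₁ mX) (proj₁ mY) yc xc ,
      (let (x , nx , xx) = proj₂ mX in x , nx , minus nx xx)) mC dC
    apart : ∀ {Z} → Z ∈ result R → Disjoint Y Z
    apart Z∈ v yv zv with within R (Any.map (λ { refl → zv }) Z∈)
    ... | inj₁ e = not-Y v e yv
    ... | inj₂ d = All.lookupWith (λ dis e → dis v yv e) dY d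

  family : ∀ {t} → (∀ {v} → Neighbour H v → ¬ v ≡ t → (Blocked t v → ⊥) → ⊥) → (Family k H t → ⊥) → ⊥
  family {t} blocked κ = build (allFin n) λ C mC dC cov → κ (record
    { members = C ; tights = mC ; disjoint = dC ; covers = λ {v} → cov (∈-allFin v) })
    where
    Covers : List (Fin n) → List (Labeling n) → Set
    Covers vs C = ∀ {v} → v ∈ vs → Neighbour H v → ¬ v ≡ t → Covered C v
    build : ∀ vs → (∀ C → All (Member k H t) C → AllPairs Disjoint C → Covers vs C → ⊥) → ⊥
    build [] κ = κ [] [] [] λ ()
    build (v ∷ vs) κ = build vs λ C mC dC cov → add C mC dC cov (1 ≤? 𝔻 (δ v)) (v Fin.≟ t)
      where
      add : ∀ C → All (Member k H t) C → AllPairs Disjoint C → Covers vs C → Dec (Neighbour H v) → Dec (v ≡ t) → ⊥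
      add C mC dC cov (no ¬nv) _ = κ C mC dC λ { (here refl) nv _ → ⊥-elim (¬nv nv) ; (there v∈) → cov v∈ }
      add C mC dC cov _ (yes v≡t) = κ C mC dC λ { (here refl) _ ne → ⊥-elim (ne v≡t) ; (there v∈) → cov v∈ }
      add C mC dC cov (yes nv) (no ne) = blocked nv ne λ (X , tX , xv) →
        let R = insert C (tX , v , nv , xv) mC dC in
        κ (result R) (tights R) (disjoint R) λ
          { (here refl) _ _ → keeps R nv (inj₁ xv)
          ; (there v∈) nu u≢t → keeps R nu (inj₂ (cov v∈ nu u≢t)) }

  -- Bi-sets that obstruct the pair (st,st)

  module _ {t : Fin n} {Z : Labeling n} (two-at-t : 2 ≤ 𝔻 (δ t)) (zt : Z t ≡ I) (oZ : ∃[ o ] Z o ≡ O)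
    (small : 𝔽 Z ≤ 1 + 2 * k) where

    -- Two copies of st are lost, against a slack of only 1. So a tight Y that leaves Z must contain
    -- nearly all of Z; the next two lemmas say how.
    escaping-small : ∀ {Y v} → Tight t Y → Y v ≡ I → Z v ≡ O → 2 * k ≤ 𝔽 (Z ⊖ Y) → ⊥
    escaping-small {Y} {v} tY yv zv le = refute 7 (λ a b s z y k d →
      a ⊕ b ⊕ s ⊑ z ⊕ y ∷ 2 ⊛ k ⊑ a ∷ 2 ⊛ k ⊑ b ∷ con 2 ⊑ d ∷ d ⊑ s ∷ z ⊑ con 1 ⊕ 2 ⊛ k ∷ y ⊑ 2 ⊛ k ∷ [])
      (𝔽 (Z ⊖ Y) ∷ 𝔽 (Y ⊖ Z) ∷ 𝔻 (λ v → shared (Z v) (Y v)) ∷ 𝔽 Z ∷ 𝔽 Y ∷ k ∷ 𝔻 (δ t) ∷ [])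
      (posimodular Z Y ∷ le ∷ conn (Y ⊖ Z) v t (cong₂ _⊖ᴸ_ yv zv) (cong₂ _⊖ᴸ_ (at tY) zt) ∷
       two-at-t ∷ 𝔻-δ (value-≥ refl (cong₂ shared zt (at tY))) ∷ small ∷ bound tY ∷ [])

    inner-within : ∀ {Y v u} → Tight t Y → Y v ≡ I → Z v ≡ O → Z u ≡ I → ¬ Y u ≡ O
    inner-within {Y} tY yv zv zu yu = let (o , zo) = oZ in
      escaping-small tY yv zv (conn (Z ⊖ Y) _ o (cong₂ _⊖ᴸ_ zu yu) (cong (_⊓ᴸ ∁ (Y o)) zo))

    wall-within : ∀ {Y v u} → Tight t Y → Y v ≡ I → Z v ≡ O → Z u ≡ W → Y u ≡ I
    wall-within {Y} {v} {u} tY yv zv zu with Y u in yu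
    ... | I = refl
    ... | W with refl ← only tY yu = ⊥-elim (I≢W zt zu)
    ... | O = ⊥-elim (escaping-small tY yv zv (≤-trans (m≤m+n _ _)
      (two-walls (Z ⊖ Y) (λ e → I≢W zt (subst (λ v → Z v ≡ W) (sym e) zu)) (cong₂ _⊖ᴸ_ zt (at tY)) (cong₂ _⊖ᴸ_ zu yu))))

    -- Otherwise the inner-set of Z is in the outer-sets of both Y₁ and Y₂ and its wall in both
    -- inner-sets, so Z is {t} without a wall. Then `star-≤` compares 6k + 2 with 6k + 1.
    disjoint-within : ∀ {Y₁ Y₂ y} → Tight t Y₁ → Tight t Y₂ → Disjoint Y₁ Y₂ → Y₂ y ≡ I → ∀ {v} → Y₁ v ≡ I → ¬ Z v ≡ O
    disjoint-within {Y₁} {Y₂} {y} t₁ t₂ dis y∈ {v} v∈ zv = refute 8 (λ a b w d i z y k →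
      a ⊕ (b ⊕ (w ⊕ w)) ⊕ i ⊑ z ⊕ (y ⊕ d) ∷ 2 ⊛ k ⊑ a ∷ 2 ⊛ k ⊑ b ∷ k ⊑ w ∷ k ⊑ w ∷ con 2 ⊑ i ∷
      z ⊑ con 1 ⊕ 2 ⊛ k ∷ y ⊑ 2 ⊛ k ∷ d ⊑ 2 ⊛ k ∷ [])
      (𝔽 (Y₁ ⊖ Z) ∷ 𝔽 (Y₂ ⊖ Z) ∷ 𝔽 (wall-only ∘ Y₁) ∷ 𝔽 Y₂ ∷ 𝔻 (#I ∘ Z) ∷ 𝔽 Z ∷ 𝔽 Y₁ ∷ k ∷ [])
      (star-≤ Z Y₁ Y₂ (λ u → T-star (Z u) (Y₁ u) (Y₂ u)
        (λ w → dis u (wall-within t₁ v∈ zv w) (wall-within t₂ y∈ zy w))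
        (λ w → subst (λ u → Z u ≡ I) (sym (only t₁ w)) zt)
        (λ w → subst (λ u → Z u ≡ I) (sym (only t₂ w)) zt)
        (at-centre t₁ t₂ dis v∈ zv y∈ zy) (at-centre t₂ t₁ (λ v p q → dis v q p) y∈ zy v∈ zv) (dis u)) ∷
       conn (Y₁ ⊖ Z) v t (cong₂ _⊖ᴸ_ v∈ zv) (cong₂ _⊖ᴸ_ (at t₁) zt) ∷
       conn (Y₂ ⊖ Z) y t (cong₂ _⊖ᴸ_ y∈ zy) (cong₂ _⊖ᴸ_ (at t₂) zt) ∷
       one-wall (wall-only ∘ Y₁) (cong wall-only (at t₁)) ∷ one-wall (wall-only ∘ Y₁) (cong wall-only (at t₁)) ∷
       ≤-trans two-at-t (𝔻-δ (value-≥ refl (cong #I zt))) ∷ small ∷ bound t₁ ∷ bound t₂ ∷ [])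
      where
      y∉Y₁ : Y₁ y ≡ O
      y∉Y₁ = tight-label t₁ (tight-≢-centre t₂ y∈) (λ e → dis y e y∈)
      zy : Z y ≡ O
      zy with Z y in eq
      ... | O = refl
      ... | W = ⊥-elim (I≢O (wall-within t₁ v∈ zv eq) y∉Y₁)
      ... | I = ⊥-elim (inner-within t₁ v∈ zv eq y∉Y₁)
      at-centre : ∀ {Y Y′ v y u} → Tight t Y → Tight t Y′ → Disjoint Y Y′ → Y v ≡ I → Z v ≡ O → Y′ y ≡ I → Z y ≡ O →
        Z u ≡ I → Y u ≡ W
      at-centre {Y} {Y′} {u = u} tY tY′ dis yv zv yy zy zu with Y u in eq
      ... | O = ⊥-elim (inner-within tY yv zv zu eq)
      ... | W = refl
      ... | I = ⊥-elim (inner-within tY′ yy zy zu (tight-label tY′ (tight-≢-centre tY eq) (dis u eq)))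

  -- An obstructing Z leaves out a neighbour z, and the member covering z leaves out another
  -- neighbour by `balance`. So there are two members, and `disjoint-within` puts z back into Z.
  centre-pair-admissible : ∀ {t} → Family k H t → 2 ≤ 𝔻 (δ t) → Inadmissible t t → ⊥
  centre-pair-admissible {t} fam two-at-t inadmissible = inadmissible λ where
      Z oZ (left zt zt′ _) → I≢W zt zt′
      Z oZ (right zt′ zt _) → I≢W zt zt′
      Z oZ (both zt _ le) → first Z oZ zt le (dangerous-nbr (record
        { outside = oZ ; small = le ; two = ≤-trans two-at-t (𝔻-δ (value-≥ refl (cong #I zt))) }) zt)
    where
    open Family fam using (cover; tight-member; unique; members)
    other : ∀ {Y z} → Tight t Y → Neighbour H z → Y z ≡ I → ∃[ y ] Neighbour H y × Y y ≡ O
    other {Y} {z} tY nz yz = nbr-outside Y (≮⇒≥ λ lt → refute 5 (λ i o f k d →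
      i ⊕ 2 ⊛ k ⊑ f ⊕ o ∷ f ⊑ 2 ⊛ k ∷ con 1 ⊕ o ⊑ con 1 ∷ con 1 ⊑ d ∷ d ⊑ i ∷ [])
      (𝔻 (#I ∘ Y) ∷ 𝔻 (#O ∘ Y) ∷ 𝔽 Y ∷ k ∷ 𝔻 (δ z) ∷ [])
      (balance Y yz (proj₂ (out tY)) ∷ bound tY ∷ lt ∷ nz ∷ 𝔻-δ (value-≥ refl (cong #I yz)) ∷ []))
    first : ∀ Z → ∃[ o ] Z o ≡ O → Z t ≡ I → 𝔽 Z ≤ 1 + 2 * k → ∃[ z ] Neighbour H z × Z z ≡ O → ⊥
    first Z oZ zt le (z , nz , zz) = second (cover nz (λ { refl → I≢O zt zz }))
      where
      second : ∃[ Y ] Y ∈ members × Y z ≡ I → ⊥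
      second (Y , Y∈ , yz) = third (other (tight-member Y∈) nz yz)
        where
        third : ∃[ y ] Neighbour H y × Y y ≡ O → ⊥
        third (y , ny , yy) = fourth (cover ny (λ { refl → O≢W yy (at (tight-member Y∈)) }))
          where
          fourth : ∃[ Y′ ] Y′ ∈ members × Y′ y ≡ I → ⊥
          fourth (Y′ , Y′∈ , y′y) = disjoint-within two-at-t zt oZ le (tight-member Y∈) (tight-member Y′∈)
            (λ v p q → I≢O (subst (λ Y → Y y ≡ I) (sym (unique Y∈ Y′∈ p q)) y′y) yy) y′y yz zz

-- Splitting off

module _ {n : ℕ} where

  -- A canonical choice among parallel edges: the pairs to be tried are then given by their
  -- end-vertices, which makes `Splittable` decidable.
  pick : Fin n → Graph n → Maybe (Graph n)
  pick u [] = nothing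
  pick u (e ∷ H) with joins? nothing (just u) e
  ... | yes _ = just H
  ... | no _ = Maybe.map (e ∷_) (pick u H)

  pick-permutes : ∀ {u} H {R} → pick u H ≡ just R → ∃[ e ] Joins nothing (just u) e × H ↭ e ∷ R
  pick-permutes {u} (e ∷ H) eq with joins? nothing (just u) e
  pick-permutes {u} (e ∷ H) refl | yes j = e , j , ↭-refl
  pick-permutes {u} (e ∷ H) eq | no _ with pick u H in eq′
  pick-permutes {u} (e ∷ H) refl | no _ | just R =
    let (e′ , j , p) = pick-permutes H eq′ in e′ , j , ↭-trans (prep e p) (swap e e′ ↭-refl)

  sumᴱ-↭ : ∀ (w : Edge n → ℕ) {H H′} → H ↭ H′ → sumᴱ w H ≡ sumᴱ w H′
  sumᴱ-↭ w _↭_.refl = refl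
  sumᴱ-↭ w (prep e p) = cong (w e +_) (sumᴱ-↭ w p)
  sumᴱ-↭ w (swap e e′ p) = trans (exchange (w e) (w e′) _) (cong (λ m → w e′ + (w e + m)) (sumᴱ-↭ w p))
    where
    exchange : ∀ a b d → a + (b + d) ≡ b + (a + d)
    exchange = solve-∀
  sumᴱ-↭ w (_↭_.trans p q) = trans (sumᴱ-↭ w p) (sumᴱ-↭ w q)

  atSᴱ-joins : ∀ g {u e} → Joins {n} nothing (just u) e → atSᴱ g e ≡ g u
  atSᴱ-joins g (inj₁ refl) = refl
  atSᴱ-joins g (inj₂ refl) = refl

  cutᴱ-joins : ∀ L {u e} → Joins {n} nothing (just u) e → cutᴱ L e ≡ #I (L u)
  cutᴱ-joins L {u} (inj₁ refl) with L u
  ... | O = refl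
  ... | W = refl
  ... | I = refl
  cutᴱ-joins L {u} (inj₂ refl) with L u
  ... | O = refl
  ... | W = refl
  ... | I = refl

  D-pick : ∀ H {u R} → pick u H ≡ just R → ∀ g → D H g ≡ g u + D R g
  D-pick H {R = R} eq g = let (_ , j , p) = pick-permutes H eq in
    trans (sumᴱ-↭ (atSᴱ g) p) (cong (_+ D R g) (atSᴱ-joins g j))

  pick-neighbour : ∀ H {u} → Neighbour H u → ∃[ R ] pick u H ≡ just R
  pick-neighbour (e ∷ H) {u} nu with joins? nothing (just u) e
  ... | yes _ = H , refl
  ... | no ¬j with pick-neighbour H {u} (≤-trans nu (≤-reflexive (cong (_+ D H (δ u)) (zero-at e ¬j))))
    where
    zero-at : ∀ e → ¬ Joins nothing (just u) e → atSᴱ (δ u) e ≡ 0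
    zero-at (nothing , nothing) _ = refl
    zero-at (nothing , just v) ¬j = δ-≢ λ { refl → ¬j (inj₁ refl) }
    zero-at (just v , nothing) ¬j = δ-≢ λ { refl → ¬j (inj₂ refl) }
    zero-at (just _ , just _) _ = refl
  ...   | R , eq rewrite eq = e ∷ R , refl

  record Split (H : Graph n) (u v : Fin n) (H′ : Graph n) : Set where
    field
      {R₁ R₂} : Graph n
      first : pick u H ≡ just R₁
      second : pick v R₁ ≡ just R₂
      result : H′ ≡ (just u , just v) ∷ R₂

  -- All that the counting needs to know of a splitting-off. Unlike `Split` it can be turned around,
  -- so either end may be taken as the first.
  record Effect (H : Graph n) (u v : Fin n) (H′ : Graph n) : Set where
    field
      F-effect : ∀ k L → F k H′ L + (#I (L u) + #I (L v)) ≡ F k H L + entering (L u) (L v)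
      D-effect : ∀ g → D H g ≡ D H′ g + (g u + g v)

  open Effect public

  pair-effect : ∀ {H u v R} → PairAtS H u v R → Effect H u v ((just u , just v) ∷ R)
  pair-effect {H} {u} {v} {R} (e₁ , e₂ , j₁ , j₂ , p) = record
    { F-effect = λ k L → trans (arrange (entering (L u) (L v)) _ (k * sumᶠ (#W ∘ L)) (#I (L u)) (#I (L v)))
        (cong (λ m → m + k * sumᶠ (#W ∘ L) + entering (L u) (L v))
          (sym (trans (sumᴱ-↭ (cutᴱ L) p) (cong₂ (λ a b → a + (b + sumᴱ (cutᴱ L) R)) (cutᴱ-joins L j₁) (cutᴱ-joins L j₂)))))
    ; D-effect = λ g → trans (trans (sumᴱ-↭ (atSᴱ g) p) (cong₂ (λ a b → a + (b + D R g)) (atSᴱ-joins g j₁) (atSᴱ-joins g j₂)))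
        (rotate (g u) (g v) (D R g))
    }
    where
    arrange : ∀ c r w a b → c + r + w + (a + b) ≡ a + (b + r) + w + c
    arrange = solve-∀
    rotate : ∀ a b r → a + (b + r) ≡ r + (a + b)
    rotate = solve-∀

  split-pair : ∀ {H u v H′} (S : Split H u v H′) → PairAtS H u v (Split.R₂ S)
  split-pair {H} record { R₁ = R₁ ; first = p ; second = q } =
    let (e₁ , j₁ , p₁) = pick-permutes H p
        (e₂ , j₂ , p₂) = pick-permutes R₁ q
    in e₁ , e₂ , j₁ , j₂ , ↭-trans p₁ (prep e₁ p₂)

  effect : ∀ {H u v H′} → Split H u v H′ → Effect H u v H′
  effect {H} {u} {v} S = subst (Effect H u v) (sym (Split.result S)) (pair-effect (split-pair S))

  entering-comm : ∀ a b → entering a b ≡ entering b a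
  entering-comm O O = refl
  entering-comm O W = refl
  entering-comm O I = refl
  entering-comm W O = refl
  entering-comm W W = refl
  entering-comm W I = refl
  entering-comm I O = refl
  entering-comm I W = refl
  entering-comm I I = refl

  effect-swap : ∀ {H u v H′} → Effect H u v H′ → Effect H v u H′
  effect-swap {H} {u} {v} {H′} E = record
    { F-effect = λ k L → trans (cong (F k H′ L +_) (+-comm (#I (L v)) _))
        (trans (F-effect E k L) (cong (F k H L +_) (entering-comm (L u) (L v))))
    ; D-effect = λ g → trans (D-effect E g) (cong (D H′ g +_) (+-comm (g u) (g v)))
    }

  split-exists : ∀ H {u v} → Neighbour H u → Neighbour H v → (u ≡ v → 2 ≤ D H (δ u)) → ∃[ H′ ] Split H u v H′
  split-exists H {u} {v} nu nv two =
    let (R₁ , p) = pick-neighbour H nu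
        (R₂ , q) = pick-neighbour R₁ (remains R₁ (D-pick H p (δ v)))
    in _ , record { first = p ; second = q ; result = refl }
    where
    remains : ∀ R → D H (δ v) ≡ δ v u + D R (δ v) → Neighbour R v
    remains R eq with v Fin.≟ u
    ... | no _ = subst (1 ≤_) eq nv
    ... | yes refl = s≤s⁻¹ (subst (2 ≤_) eq (two refl))

module _ {n : ℕ} {H H′ : Graph n} {u v : Fin n} (E : Effect H u v H′) where

  neighbour-up : ∀ {z} → Neighbour H′ z → Neighbour H z
  neighbour-up {z} nz = ≤-trans nz (≤-trans (m≤m+n _ _) (≤-reflexive (sym (D-effect E (δ z)))))

  neighbour-down : ∀ {z} → Neighbour H z → ¬ z ≡ u → ¬ z ≡ v → Neighbour H′ z
  neighbour-down {z} nz z≢u z≢v = ≤-trans nz (≤-reflexive (trans (D-effect E (δ z))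
    (trans (cong (D H′ (δ z) +_) (cong₂ _+_ (δ-≢ z≢u) (δ-≢ z≢v))) (+-identityʳ _))))

  D-labels : ∀ (g : Label → ℕ) L {a b} → L u ≡ a → L v ≡ b → D H (g ∘ L) ≡ D H′ (g ∘ L) + (g a + g b)
  D-labels g L refl refl = D-effect E (g ∘ L)

  F-labels : ∀ k L {a b} → L u ≡ a → L v ≡ b → F k H′ L + (#I a + #I b) ≡ F k H L + entering a b
  F-labels k L refl refl = F-effect E k L

  F-same : ∀ k L {a b} → L u ≡ a → L v ≡ b → #I a + #I b ≡ entering a b → F k H L ≡ F k H′ L
  F-same k L {a} {b} p q eq = sym (+-cancelʳ-≡ (entering a b) _ _
    (trans (cong (F k H′ L +_) (sym eq)) (F-labels k L p q)))

  F-decreases : ∀ k L → F k H′ L ≤ F k H L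
  F-decreases k L = +-cancelʳ-≤ (#I (L u) + #I (L v)) _ _ (≤-trans (≤-reflexive (F-effect E k L))
    (+-monoʳ-≤ (F k H L) (entering-≤ (L u) (L v))))
    where
    entering-≤ : ∀ a b → entering a b ≤ #I a + #I b
    entering-≤ O O = z≤n
    entering-≤ O W = z≤n
    entering-≤ O I = s≤s z≤n
    entering-≤ W O = z≤n
    entering-≤ W W = z≤n
    entering-≤ W I = z≤n
    entering-≤ I O = s≤s z≤n
    entering-≤ I W = z≤n
    entering-≤ I I = z≤n

module Splitting {n : ℕ} (k : ℕ) (H : Graph n) (conn : Conn k H)
  (half : ℕ) (even : degree H ≡ 2 * half) where

  open Families k H conn half even public

  not-connected : ∀ {u v H′} → Effect H u v H′ → (Conn k H′ → ⊥) → Inadmissible u v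
  not-connected {u} {v} {H′} E ¬conn κ = ¬conn λ L i o li lo → ≮⇒≥ λ lt →
    cases L (o , lo) lt (conn L i o li lo) _ _ refl refl
    where
    cases : ∀ L → ∃[ o ] L o ≡ O → F k H′ L < 2 * k → 2 * k ≤ 𝔽 L → ∀ a b → L u ≡ a → L v ≡ b → ⊥
    cases L out lt ge I I p q = κ L out (both p q (≮⇒≥ λ f → refute 3 (λ f g k →
      f ⊑ g ⊕ con 2 ∷ con 1 ⊕ g ⊑ 2 ⊛ k ∷ con 2 ⊕ 2 ⊛ k ⊑ f ∷ []) (𝔽 L ∷ F k H′ L ∷ k ∷ [])
      (≤-reflexive (trans (sym (+-identityʳ _)) (sym (F-labels E k L p q))) ∷ lt ∷ f ∷ [])))
    cases L out lt ge I W p q = κ L out (left p q (≮⇒≥ λ f → refute 3 (λ f g k →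
      f ⊑ g ⊕ con 1 ∷ con 1 ⊕ g ⊑ 2 ⊛ k ∷ con 1 ⊕ 2 ⊛ k ⊑ f ∷ []) (𝔽 L ∷ F k H′ L ∷ k ∷ [])
      (≤-reflexive (trans (sym (+-identityʳ _)) (sym (F-labels E k L p q))) ∷ lt ∷ f ∷ [])))
    cases L out lt ge W I p q = κ L out (right p q (≮⇒≥ λ f → refute 3 (λ f g k →
      f ⊑ g ⊕ con 1 ∷ con 1 ⊕ g ⊑ 2 ⊛ k ∷ con 1 ⊕ 2 ⊛ k ⊑ f ∷ []) (𝔽 L ∷ F k H′ L ∷ k ∷ [])
      (≤-reflexive (trans (sym (+-identityʳ _)) (sym (F-labels E k L p q))) ∷ lt ∷ f ∷ [])))
    cases L out lt ge O O p q = <⇒≱ lt (≤-trans ge (≤-reflexive (F-same E k L p q refl)))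
    cases L out lt ge O W p q = <⇒≱ lt (≤-trans ge (≤-reflexive (F-same E k L p q refl)))
    cases L out lt ge O I p q = <⇒≱ lt (≤-trans ge (≤-reflexive (F-same E k L p q refl)))
    cases L out lt ge W O p q = <⇒≱ lt (≤-trans ge (≤-reflexive (F-same E k L p q refl)))
    cases L out lt ge W W p q = <⇒≱ lt (≤-trans ge (≤-reflexive (F-same E k L p q refl)))
    cases L out lt ge I O p q = <⇒≱ lt (≤-trans ge (≤-reflexive (F-same E k L p q refl)))

  module _ {t j} (odd : 𝔻 (δ t) ≡ 1 + 2 * j) where

    odd-neighbour : Neighbour H t
    odd-neighbour = ≤-trans (s≤s z≤n) (≤-reflexive (sym odd))

    -- `balance` gives the inequality without the 1. Equality would make d_H(s) odd, since the
    -- remaining edges are the oddly many copies of st.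
    odd-balance : ∀ {Y z} → Tight t Y → Y z ≡ I → 1 + 𝔻 (#I ∘ Y) ≤ 𝔻 (#O ∘ Y)
    odd-balance {Y} {z} tY yz = ≤∧≢⇒< le λ eq → even≢odd half (𝔻 (#I ∘ Y) + j) (begin
      2 * half                                    ≡⟨ degree-partition Y ⟩
      𝔻 (#I ∘ Y) + 𝔻 (#O ∘ Y) + 𝔻 (#W ∘ Y)        ≡⟨ cong₂ (λ a b → 𝔻 (#I ∘ Y) + a + b) (sym eq) wall-degree ⟩
      𝔻 (#I ∘ Y) + 𝔻 (#I ∘ Y) + (1 + 2 * j)       ≡⟨ arrange (𝔻 (#I ∘ Y)) j ⟩
      1 + 2 * (𝔻 (#I ∘ Y) + j)                    ∎)
      where
      open ≡-Reasoning
      arrange : ∀ a j → a + a + (1 + 2 * j) ≡ 1 + 2 * (a + j)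
      arrange = solve-∀
      le : 𝔻 (#I ∘ Y) ≤ 𝔻 (#O ∘ Y)
      le = ≮⇒≥ λ lt → refute 4 (λ i o f k → i ⊕ 2 ⊛ k ⊑ f ⊕ o ∷ f ⊑ 2 ⊛ k ∷ con 1 ⊕ o ⊑ i ∷ [])
        (𝔻 (#I ∘ Y) ∷ 𝔻 (#O ∘ Y) ∷ 𝔽 Y ∷ k ∷ []) (balance Y yz (proj₂ (out tY)) ∷ bound tY ∷ lt ∷ [])
      wall-at : ∀ v → #W (Y v) ≡ δ t v
      wall-at v with Y v in eq
      ... | W rewrite only tY eq = sym (δ-refl t)
      ... | O = sym (δ-≢ λ { refl → O≢W eq (at tY) })
      ... | I = sym (δ-≢ λ { refl → I≢W eq (at tY) })
      wall-degree : 𝔻 (#W ∘ Y) ≡ 1 + 2 * j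
      wall-degree = trans (𝔻-cong wall-at) odd

    odd-outside : ∀ {Y z} → Tight t Y → Y z ≡ I → ∃[ y ] Neighbour H y × Y y ≡ O
    odd-outside {Y} tY yz = nbr-outside Y (≤-trans (s≤s z≤n) (odd-balance tY yz))

    odd-another : ∃[ v ] Neighbour H v × ¬ v ≡ t
    odd-another = another t (≤∧≢⇒< le λ eq → even≢odd half j (trans (sym eq) odd))
      where
      le : 𝔻 (δ t) ≤ 2 * half
      le = ≤-trans (D-mono H (δ-≤ (s≤s z≤n))) (≤-reflexive even)

#I≤1 : ∀ a → #I a ≤ 1
#I≤1 O = z≤n
#I≤1 W = z≤n
#I≤1 I = s≤s z≤n

-- Obstacles that arise from splitting off an admissible pair

-- H′ arises from H by splitting off (sa,sb) and has an obstacle at t ≠ b.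
module NewObstacle {n : ℕ} (k : ℕ)
  (H : Graph n) (conn : Conn k H) (half : ℕ) (even : degree H ≡ 2 * half)
  (H′ : Graph n) (conn′ : Conn k H′) (half′ : ℕ) (even′ : degree H′ ≡ 2 * half′)
  {a b t : Fin n} (E : Effect H a b H′) (b≢t : ¬ b ≡ t) (fam : Family k H′ t)
  {j : ℕ} (odd : D H′ (δ t) ≡ 1 + 2 * j) where

  open Splitting k H conn half even public
  module S′ = Splitting k H′ conn′ half′ even′

  open Family fam using (members; tight-member; member-nbr; unique; cover)

  -- Such a member of the family need not be tight in H.
  Special : Labeling n → Set
  Special X = X b ≡ I × (a ≡ t ⊎ X a ≡ I)

  special? : ∀ X → Dec (Special X)
  special? X = (X b ≟ᴸ I) ×-dec ((a Fin.≟ t) ⊎-dec (X a ≟ᴸ I))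

  label-at : ∀ {X v} → X ∈ members → ¬ v ≡ t → ¬ X v ≡ I → X v ≡ O
  label-at X∈ = S′.tight-label (tight-member X∈)

  ordinary-bound : ∀ {X} → X ∈ members → ¬ Special X → 𝔽 X ≤ 2 * k
  ordinary-bound {X} X∈ ns = ≤-trans (≤-reflexive same) (Basic.bound (tight-member X∈))
    where
    same : 𝔽 X ≡ F k H′ X
    same with X b ≟ᴸ I
    ... | yes xb = F-same E k X (label-at X∈ (λ e → ns (xb , inj₁ e)) (λ i → ns (xb , inj₂ i))) xb refl
    ... | no nb with X a in xa
    ...   | O = F-same E k X xa (label-at X∈ b≢t nb) refl
    ...   | W = F-same E k X xa (label-at X∈ b≢t nb) refl
    ...   | I = F-same E k X xa (label-at X∈ b≢t nb) refl

  ordinary-tight : ∀ {X} → X ∈ members → ¬ Special X → Tight t X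
  ordinary-tight X∈ ns = record
    { at = Basic.at (tight-member X∈) ; only = Basic.only (tight-member X∈)
    ; out = Basic.out (tight-member X∈) ; bound = ordinary-bound X∈ ns }

  special-unique : ∀ {X Y} → X ∈ members → Y ∈ members → Special X → Special Y → X ≡ Y
  special-unique X∈ Y∈ (xb , _) (yb , _) = unique X∈ Y∈ xb yb

  not-special : ∀ {X Y v} → X ∈ members → Y ∈ members → Special X → X v ≡ O → Y v ≡ I → ¬ Special Y
  not-special X∈ Y∈ sX xv yv sY = I≢O (subst (λ Z → Z _ ≡ I) (sym (special-unique X∈ Y∈ sX sY)) yv) xv

  outside-≢ : ∀ {X z} → X ∈ members → X z ≡ O → ¬ z ≡ t
  outside-≢ X∈ xz refl = O≢W xz (Basic.at (tight-member X∈))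

  members-disjoint : ∀ {X Y v} → X ∈ members → Y ∈ members → X v ≡ O → Y v ≡ I → Disjoint X Y
  members-disjoint X∈ Y∈ xv yv u p q = I≢O (subst (λ Z → Z _ ≡ I) (sym (unique X∈ Y∈ p q)) yv) xv

  ordinary-blocked : ∀ {X v} → X ∈ members → ¬ Special X → X v ≡ I → Blocked t v
  ordinary-blocked X∈ ns xv = _ , ordinary-tight X∈ ns , xv

  cover-blocked : (∀ {X} → X ∈ members → ¬ Special X) → ∀ {v} → Neighbour H′ v → ¬ v ≡ t → Blocked t v
  cover-blocked none nv ne = let (X , X∈ , xv) = cover nv ne in ordinary-blocked X∈ (none X∈) xv

  any-special? : Dec (∃[ X ] X ∈ members × Special X)
  any-special? with Any.any? special? members
  ... | yes p = yes (find p)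
  ... | no ¬p = no λ (X , X∈ , sX) → ¬p (Any.map (λ { refl → sX }) X∈)

  beside-special : ∀ {X z} → X ∈ members → Special X → Neighbour H′ z → X z ≡ O →
    ∃[ Y ] Y ∈ members × Y z ≡ I × ¬ Special Y
  beside-special X∈ sX nz xz =
    let (Y , Y∈ , yz) = cover nz (outside-≢ X∈ xz)
    in Y , Y∈ , yz , not-special X∈ Y∈ sX xz yz

  beyond : ∀ {X} → X ∈ members → ∃[ z ] Neighbour H′ z × X z ≡ O
  beyond X∈ = let (x , _ , xx) = member-nbr X∈ in S′.odd-outside {j = j} odd (tight-member X∈) xx

  some-ordinary : ∃[ X ] ∃[ z ] X ∈ members × Neighbour H′ z × X z ≡ I × ¬ Special X
  some-ordinary with any-special?
  ... | yes (X , X∈ , sX) = let (z , nz , xz) = beyond X∈ ; (Y , Y∈ , yz , ns) = beside-special X∈ sX nz xz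
                            in Y , z , Y∈ , nz , yz , ns
  ... | no none = let (z , nz , z≢t) = S′.odd-another {j = j} odd ; (Y , Y∈ , yz) = cover nz z≢t
                  in Y , z , Y∈ , nz , yz , λ s → none (Y , Y∈ , s)

  -- A split edge at the centre: the pair (st,st) is admissible

  module _ (a≡t : a ≡ t) where

    record TwoOrdinary : Set where
      field
        {Y₁ Y₂} : Labeling n
        {y₁ y₂} : Fin n
        Y₁∈ : Y₁ ∈ members
        Y₂∈ : Y₂ ∈ members
        ordinary₁ : ¬ Special Y₁
        ordinary₂ : ¬ Special Y₂
        nbr₁ : Neighbour H′ y₁
        nbr₂ : Neighbour H′ y₂
        in₁ : Y₁ y₁ ≡ I
        in₂ : Y₂ y₂ ≡ I
        apart : Disjoint Y₁ Y₂

    -- The edges outside X end inside Y or outside both, and vice versa. Adding `odd-balance` for X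
    -- and Y leaves at least one edge outside both.
    outside-two : ∀ {X Y} → X ∈ members → Y ∈ members → ∃[ z ] Neighbour H′ z × X z ≡ O × Y z ≡ O
    outside-two {X} {Y} X∈ Y∈ =
      let (z , nz , p) = D-positive H′ (λ v → #OO (X v) (Y v)) positive in z , nz , labels-OO (X z) (Y z) p
      where
      tX = tight-member X∈
      tY = tight-member Y∈
      labels-OO : ∀ a b → 1 ≤ #OO a b → a ≡ O × b ≡ O
      labels-OO O O _ = refl , refl
      split : ∀ {X Y} → S′.Tight t X → S′.Tight t Y → ∀ v → #O (X v) ≤ #OO (X v) (Y v) + #I (Y v)
      split {X} {Y} tX tY v with X v in ex | Y v in ey
      ... | O | O = s≤s z≤n
      ... | O | W rewrite Basic.only tY ey = ⊥-elim (O≢W ex (Basic.at tX))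
      ... | O | I = s≤s z≤n
      ... | W | _ = z≤n
      ... | I | _ = z≤n
      comm : ∀ v → #OO (Y v) (X v) ≤ #OO (X v) (Y v)
      comm v = ≤-reflexive (*-comm (#O (Y v)) (#O (X v)))
      balanced : ∀ {Y} → Y ∈ members → 1 + D H′ (#I ∘ Y) ≤ D H′ (#O ∘ Y)
      balanced Y∈ = let (x , _ , yx) = member-nbr Y∈ in S′.odd-balance {j = j} odd (tight-member Y∈) yx
      positive : 1 ≤ D H′ (λ v → #OO (X v) (Y v))
      positive = ≮⇒≥ λ lt → refute 6 (λ oo iX oX iY oY oo′ →
        con 1 ⊕ oo ⊑ con 1 ∷ con 1 ⊕ oo ⊑ con 1 ∷ con 1 ⊕ iX ⊑ oX ∷ con 1 ⊕ iY ⊑ oY ∷ oX ⊑ oo ⊕ iY ∷ oY ⊑ oo′ ⊕ iX ∷ oo′ ⊑ oo ∷ [])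
        (D H′ (λ v → #OO (X v) (Y v)) ∷ D H′ (#I ∘ X) ∷ D H′ (#O ∘ X) ∷ D H′ (#I ∘ Y) ∷ D H′ (#O ∘ Y) ∷ D H′ (λ v → #OO (Y v) (X v)) ∷ [])
        (lt ∷ lt ∷ balanced X∈ ∷ balanced Y∈ ∷
         ≤-trans (D-mono H′ (split tX tY)) (≤-reflexive (D-+ H′ _ _)) ∷
         ≤-trans (D-mono H′ (split tY tX)) (≤-reflexive (D-+ H′ _ _)) ∷ D-mono H′ comm ∷ [])

    two-ordinary : TwoOrdinary
    two-ordinary with any-special?
    ... | yes (X , X∈ , sX) =
      let (y₁ , n₁ , x₁) = beyond X∈
          (Y₁ , Y₁∈ , i₁ , o₁) = beside-special X∈ sX n₁ x₁
          (y₂ , n₂ , x₂ , z₂) = outside-two X∈ Y₁∈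
          (Y₂ , Y₂∈ , i₂ , o₂) = beside-special X∈ sX n₂ x₂
      in record { Y₁∈ = Y₁∈ ; Y₂∈ = Y₂∈ ; ordinary₁ = o₁ ; ordinary₂ = o₂ ; nbr₁ = n₁ ; nbr₂ = n₂
                ; in₁ = i₁ ; in₂ = i₂ ; apart = members-disjoint Y₁∈ Y₂∈ z₂ i₂ }
    ... | no none =
      let (Y₁ , y₁ , Y₁∈ , n₁ , i₁ , o₁) = some-ordinary
          (y₂ , n₂ , z₂) = beyond Y₁∈
          (Y₂ , Y₂∈ , i₂) = cover n₂ (outside-≢ Y₁∈ z₂)
      in record { Y₁∈ = Y₁∈ ; Y₂∈ = Y₂∈ ; ordinary₁ = o₁ ; ordinary₂ = λ s → none (Y₂ , Y₂∈ , s) ; nbr₁ = n₁ ; nbr₂ = n₂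
                ; in₁ = i₁ ; in₂ = i₂ ; apart = members-disjoint Y₁∈ Y₂∈ z₂ i₂ }

    degree-at-t : 𝔻 (δ t) ≡ 2 * (1 + j)
    degree-at-t = trans (D-effect E (δ t)) (trans (cong₂ _+_ odd (cong₂ _+_ (trans (cong (δ t) a≡t) (δ-refl t)) (δ-≢ (b≢t ∘ sym))))
      (arrange j))
      where
      arrange : ∀ j → 1 + 2 * j + (1 + 0) ≡ 2 * (1 + j)
      arrange = solve-∀

    two-at-t : 2 ≤ 𝔻 (δ t)
    two-at-t = ≤-trans (*-monoʳ-≤ 2 (s≤s z≤n)) (≤-reflexive (sym degree-at-t))

    module _ {Z : Labeling n} (oZ : ∃[ o ] Z o ≡ O) (zt : Z t ≡ I) (le : 𝔽 Z ≤ 1 + 2 * k) where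

      open TwoOrdinary two-ordinary

      dZ : Dangerous Z
      dZ = record { outside = oZ ; small = le ; two = ≤-trans two-at-t (𝔻-δ (value-≥ refl (cong #I zt))) }

      inside₁ : ∀ {v} → Y₁ v ≡ I → ¬ Z v ≡ O
      inside₁ = disjoint-within two-at-t zt oZ le (ordinary-tight Y₁∈ ordinary₁) (ordinary-tight Y₂∈ ordinary₂) apart in₂

      inside₂ : ∀ {v} → Y₂ v ≡ I → ¬ Z v ≡ O
      inside₂ = disjoint-within two-at-t zt oZ le (ordinary-tight Y₂∈ ordinary₂) (ordinary-tight Y₁∈ ordinary₁) (λ v p q → apart v q p) in₁

      ordinary-inside : ∀ {Y v} → Y ∈ members → ¬ Special Y → Y v ≡ I → ¬ Z v ≡ O
      ordinary-inside Y∈ ns yv zv = disjoint-within two-at-t zt oZ le (ordinary-tight Y∈ ns) (ordinary-tight Y₁∈ ordinary₁)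
        (λ u p q → inside₁ (subst (λ X → X _ ≡ I) (unique Y∈ Y₁∈ p q) yv) zv) in₁ yv zv

      -- The wall of Z cannot contain both y₁ and y₂.
      inner-ordinary : ∃[ Y ] ∃[ y ] Y ∈ members × ¬ Special Y × Neighbour H′ y × Y y ≡ I × Z y ≡ I
      inner-ordinary with Z y₁ in z₁ | Z y₂ in z₂
      ... | I | _ = Y₁ , y₁ , Y₁∈ , ordinary₁ , nbr₁ , in₁ , z₁
      ... | O | _ = ⊥-elim (inside₁ in₁ z₁)
      ... | W | I = Y₂ , y₂ , Y₂∈ , ordinary₂ , nbr₂ , in₂ , z₂
      ... | W | O = ⊥-elim (inside₂ in₂ z₂)
      ... | W | W = ⊥-elim (apart y₁ in₁ (subst (λ y → Y₂ y ≡ I) (dangerous-wall dZ z₂ z₁) in₂))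

      -- Two copies of st and the edge sy make at least three edges into Z, and `balance` allows a
      -- surplus of one.
      outside-degree-2 : ∃[ Y ] ∃[ y ] Y ∈ members × ¬ Special Y × Neighbour H′ y × Y y ≡ I × Z y ≡ I → 2 ≤ 𝔻 (#O ∘ Z)
      outside-degree-2 (Y , y , Y∈ , ns , ny , yy , zy) = ≮⇒≥ λ lt → refute 6 (λ i o f k t y →
        i ⊕ 2 ⊛ k ⊑ f ⊕ o ∷ f ⊑ con 1 ⊕ 2 ⊛ k ∷ con 1 ⊕ o ⊑ con 2 ∷ con 2 ⊑ t ∷ con 1 ⊑ y ∷ t ⊕ y ⊑ i ∷ [])
        (𝔻 (#I ∘ Z) ∷ 𝔻 (#O ∘ Z) ∷ 𝔽 Z ∷ k ∷ 𝔻 (δ t) ∷ 𝔻 (δ y) ∷ [])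
        (balance Z zt (proj₂ oZ) ∷ le ∷ lt ∷ two-at-t ∷ neighbour-up E ny ∷
         𝔻-δδ (λ { refl → I≢W yy (Basic.at (tight-member Y∈)) }) (value-≥ refl (cong #I zt)) (value-≥ refl (cong #I zy)) ∷ [])

      2≤outside : 2 ≤ 𝔻 (#O ∘ Z)
      2≤outside = outside-degree-2 inner-ordinary

      -- All members are tight in H and inside Z, so b is the only possible neighbour outside Z. A
      -- second copy of sb would survive in H′ and make the member covering b special.
      no-special : (∀ {X} → X ∈ members → ¬ Special X) → ⊥
      no-special none = refute 4 (λ o b b′ c → con 2 ⊑ o ∷ o ⊑ b ∷ b ⊑ b′ ⊕ con 1 ∷ b′ ⊑ con 0 ∷ [])
        (𝔻 (#O ∘ Z) ∷ 𝔻 (δ b) ∷ D H′ (δ b) ∷ 0 ∷ [])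
        (2≤outside ∷ D-nbr-mono H only-b ∷
         ≤-reflexive (trans (D-effect E (δ b)) (cong (D H′ (δ b) +_) (cong₂ _+_ (trans (cong (δ b) a≡t) (δ-≢ b≢t)) (δ-refl b)))) ∷
         ≮⇒≥ (λ nb → let (X , X∈ , xb) = cover nb b≢t in none X∈ (xb , inj₁ a≡t)) ∷ [])
        where
        only-b : ∀ v → Neighbour H v → #O (Z v) ≤ δ b v
        only-b v nv with Z v in zv
        ... | W = z≤n
        ... | I = z≤n
        ... | O with b Fin.≟ v
        ...   | yes _ = s≤s z≤n
        ...   | no b≢v = ⊥-elim (ordinary-inside X∈ (none X∈) xv zv)
          where
          v≢t : ¬ v ≡ t
          v≢t refl = I≢O zt zv
          covering : ∃[ X ] X ∈ members × X v ≡ I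
          covering = cover (neighbour-down E nv (λ e → v≢t (trans e a≡t)) (b≢v ∘ sym)) v≢t
          X∈ = proj₁ (proj₂ covering)
          xv = proj₂ (proj₂ covering)

      module _ {X : Labeling n} (X∈ : X ∈ members) (sX : Special X) where

        xt : X t ≡ W
        xt = Basic.at (tight-member X∈)

        xb : X b ≡ I
        xb = proj₁ sX

        outside-in-special : ∀ {v} → Neighbour H v → Z v ≡ O → X v ≡ I
        outside-in-special {v} nv zv = by-cases (v Fin.≟ b) (X v ≟ᴸ I)
          where
          v≢t : ¬ v ≡ t
          v≢t refl = I≢O zt zv
          by-cases : Dec (v ≡ b) → Dec (X v ≡ I) → X v ≡ I
          by-cases (yes refl) _ = xb
          by-cases _ (yes i) = i
          by-cases (no v≢b) (no ni) =
            let (Y , Y∈ , yv) = cover (neighbour-down E nv (λ e → v≢t (trans e a≡t)) v≢b) v≢t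
            in ⊥-elim (ordinary-inside Y∈ (not-special X∈ Y∈ sX (label-at X∈ v≢t ni) yv) yv zv)

        special-bound : 𝔽 X ≤ 1 + 2 * k
        special-bound = ≤-trans (≤-reflexive (trans (sym (+-identityʳ _)) (trans (sym (F-labels E k X (trans (cong X a≡t) xt) xb)) (+-comm _ 1))))
          (s≤s (Basic.bound (tight-member X∈)))

        -- Z ⊖ X has t and q in its wall and receives sy, X ⊖ Z contains z, and two copies of st are
        -- lost: 4k + 3 against 4k + 2.
        wall-outside : ∃[ q ] Neighbour H q × Z q ≡ W × X q ≡ O → ⊥
        wall-outside (q , nq , zq , xq) = go inner-ordinary (nbr-outside Z (≤-trans (s≤s z≤n) 2≤outside))
          where
          go : ∃[ Y ] ∃[ y ] Y ∈ members × ¬ Special Y × Neighbour H′ y × Y y ≡ I × Z y ≡ I → ∃[ z ] Neighbour H z × Z z ≡ O → ⊥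
          go (Y , y , Y∈ , ns , ny , yy , zy) (z , nz , zz) = refute 8 (λ a b s i d y x k →
            a ⊕ b ⊕ s ⊑ y ⊕ x ∷ 2 ⊛ k ⊕ i ⊑ a ∷ 2 ⊛ k ⊑ b ∷ con 1 ⊑ i ∷ con 2 ⊑ d ∷ d ⊑ s ∷ y ⊑ con 1 ⊕ 2 ⊛ k ∷ x ⊑ con 1 ⊕ 2 ⊛ k ∷ [])
            (𝔽 (Z ⊖ X) ∷ 𝔽 (X ⊖ Z) ∷ 𝔻 (λ v → shared (Z v) (X v)) ∷ 𝔻 (#I ∘ (Z ⊖ X)) ∷ 𝔻 (δ t) ∷ 𝔽 Z ∷ 𝔽 X ∷ k ∷ [])
            (posimodular Z X ∷
             two-walls (Z ⊖ X) (λ e → O≢W xq (subst (λ v → X v ≡ W) e xt)) (cong₂ _⊖ᴸ_ zt xt) (cong₂ _⊖ᴸ_ zq xq) ∷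
             conn (X ⊖ Z) z t (cong₂ _⊖ᴸ_ (outside-in-special nz zz) zz) (cong₂ _⊖ᴸ_ xt zt) ∷
             ≤-trans (neighbour-up E ny) (𝔻-δ (value-≥ refl (cong #I (cong₂ _⊖ᴸ_ zy xy)))) ∷
             two-at-t ∷ 𝔻-δ (value-≥ refl (cong₂ shared zt xt)) ∷ le ∷ special-bound ∷ [])
            where
            xy : X y ≡ O
            xy = label-at X∈ (λ { refl → I≢W yy (Basic.at (tight-member Y∈)) })
              (λ i → ns (subst Special (unique X∈ Y∈ i yy) sX))

        with-special : ⊥
        with-special = by-cases (Fin.any? (λ q → (1 ≤? 𝔻 (δ q)) ×-dec (Z q ≟ᴸ W) ×-dec (X q ≟ᴸ O)))
          where
          by-cases : Dec (∃[ q ] Neighbour H q × Z q ≡ W × X q ≡ O) → ⊥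
          by-cases (yes w) = wall-outside w
          -- Every edge at s outside X ends inside Z, and every one outside Z ends inside X. This
          -- gives oX + 2 ≤ iZ ≤ oZ + 1 ≤ iX + 1 ≤ iX′ + 2 ≤ oX′ + 1 ≤ oX + 1.
          by-cases (no ∄) = refute 9 (λ iX oX iZ oZ f k t iX′ oX′ →
            iZ ⊕ 2 ⊛ k ⊑ f ⊕ oZ ∷ f ⊑ con 1 ⊕ 2 ⊛ k ∷ con 2 ⊑ t ∷ t ⊕ oX ⊑ iZ ∷ oZ ⊑ iX ∷
            iX ⊑ iX′ ⊕ con 1 ∷ con 1 ⊕ iX′ ⊑ oX′ ∷ oX′ ⊑ oX ∷ [])
            (𝔻 (#I ∘ X) ∷ 𝔻 (#O ∘ X) ∷ 𝔻 (#I ∘ Z) ∷ 𝔻 (#O ∘ Z) ∷ 𝔽 Z ∷ k ∷ 𝔻 (δ t) ∷ D H′ (#I ∘ X) ∷ D H′ (#O ∘ X) ∷ [])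
            (balance Z zt (proj₂ oZ) ∷ le ∷ two-at-t ∷
             ≤-trans (≤-reflexive (sym (D-+ H (δ t) (#O ∘ X)))) (D-nbr-mono H below) ∷
             D-nbr-mono H above ∷
             ≤-reflexive (D-labels E #I X (trans (cong X a≡t) xt) xb) ∷
             S′.odd-balance {j = j} odd (tight-member X∈) (proj₂ (proj₂ (member-nbr X∈))) ∷
             ≤-trans (m≤m+n _ _) (≤-reflexive (sym (D-effect E (#O ∘ X)))) ∷ [])
            where
            above : ∀ v → Neighbour H v → #O (Z v) ≤ #I (X v)
            above v nv with Z v in zv
            ... | W = z≤n
            ... | I = z≤n
            ... | O = value-≥ refl (cong #I (outside-in-special nv zv))
            below : ∀ v → Neighbour H v → δ t v + #O (X v) ≤ #I (Z v)
            below v nv with t Fin.≟ v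
            ... | yes refl rewrite xt | zt = s≤s z≤n
            ... | no _ with X v in xv
            ...   | W = z≤n
            ...   | I = z≤n
            ...   | O = value-≥ refl (cong #I (label-I (λ zv → I≢O (outside-in-special nv zv) xv) (λ zv → ∄ (v , nv , zv , xv))))

    centre-pair : Inadmissible t t → ⊥
    centre-pair inadmissible = inadmissible λ where
        Z oZ (left zt zt′ _) → I≢W zt zt′
        Z oZ (right zt′ zt _) → I≢W zt zt′
        Z oZ (both zt _ le) → by-cases oZ zt le any-special?
      where
      by-cases : ∀ {Z} → ∃[ o ] Z o ≡ O → Z t ≡ I → 𝔽 Z ≤ 1 + 2 * k → Dec (∃[ X ] X ∈ members × Special X) → ⊥
      by-cases oZ zt le (yes (X , X∈ , sX)) = with-special oZ zt le X∈ sX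
      by-cases oZ zt le (no none) = no-special oZ zt le λ X∈ s → none (_ , X∈ , s)

  -- The pair (st,sc) that is split off instead of (sa,sb)

  data Partner (c : Fin n) : Set where
    free : ¬ c ≡ t → Neighbour H c → ¬ Blocked t c → Partner c
    twice : c ≡ t → a ≡ t → Partner c

  module Second (H″ : Graph n) (conn″ : Conn k H″) (half″ : ℕ) (even″ : degree H″ ≡ 2 * half″)
    {c r : Fin n} (E″ : Effect H t c H″) (r≢t : ¬ r ≡ t) (fam″ : Family k H″ r)
    {j″ : ℕ} (odd″ : D H″ (δ r) ≡ 1 + 2 * j″) (partner : Partner c) where

    module S″ = Splitting k H″ conn″ half″ even″
    module M″ = Family fam″

    nr : Neighbour H r
    nr = neighbour-up E″ (S″.odd-neighbour {j = j″} odd″)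

    nt : Neighbour H t
    nt = neighbour-up E (S′.odd-neighbour {j = j} odd)

    at-r : ∀ {P} → P ∈ M″.members → P r ≡ W
    at-r P∈ = Basic.at (M″.tight-member P∈)

    label-at-t : ∀ {P} → P ∈ M″.members → P t ≡ O ⊎ P t ≡ I
    label-at-t {P} P∈ with P t in pt
    ... | O = inj₁ refl
    ... | W = ⊥-elim (r≢t (sym (Basic.only (M″.tight-member P∈) pt)))
    ... | I = inj₂ refl

    bound-without-t : ∀ {P} → P ∈ M″.members → P t ≡ O → 𝔽 P ≤ 2 * k
    bound-without-t {P} P∈ pt = ≤-trans (≤-reflexive same) (Basic.bound (M″.tight-member P∈))
      where
      same : 𝔽 P ≡ F k H″ P
      same with P c in pc
      ... | O = F-same E″ k P pt pc refl
      ... | W = F-same E″ k P pt pc refl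
      ... | I = F-same E″ k P pt pc refl

    tight-without-t : ∀ {P} → P ∈ M″.members → P t ≡ O → Tight r P
    tight-without-t P∈ pt = record
      { at = at-r P∈ ; only = Basic.only (M″.tight-member P∈)
      ; out = Basic.out (M″.tight-member P∈) ; bound = bound-without-t P∈ pt }

    bound-with-t : ∀ {P} → P ∈ M″.members → P t ≡ I → 𝔽 P ≤ 2 * k + (1 + #I (P c))
    bound-with-t {P} P∈ pt = ≤-trans (m≤m+n _ _) (≤-trans (≤-reflexive (sym (F-labels E″ k P pt refl)))
      (+-monoˡ-≤ _ (Basic.bound (M″.tight-member P∈))))

    -- The second centre r is blocked with t

    module _ {Y : Labeling n} (tY : Tight t Y) (yr : Y r ≡ I) where

      c≢r : ¬ c ≡ r
      c≢r c≡r = by-partner partner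
        where
        by-partner : Partner c → ⊥
        by-partner (free _ _ ¬blocked) = ¬blocked (Y , tY , subst (λ v → Y v ≡ I) (sym c≡r) yr)
        by-partner (twice c≡t _) = r≢t (trans (sym c≡r) c≡t)

      -- Both st and sr are lost, as t and r are each in one wall and in the other inner-set. This
      -- exceeds the slack in each case: if c is outside P, then P is tight in value; if c is
      -- inside, being unblocked raises P ⊖ Y to 2k + 1; if c = t, then st is at least double.
      not-crossing : ∀ {P z w} → P ∈ M″.members → P t ≡ I → P z ≡ I → Y z ≡ O → Y w ≡ I → P w ≡ O → ⊥
      not-crossing {P} {z} {w} P∈ pt pz yz yw pw = by-partner partner
        where
        pos : 𝔽 (P ⊖ Y) + 𝔽 (Y ⊖ P) + 𝔻 (λ v → shared (P v) (Y v)) ≤ 𝔽 P + 𝔽 Y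
        pos = posimodular P Y
        2k≤Y⊖P : 2 * k ≤ 𝔽 (Y ⊖ P)
        2k≤Y⊖P = conn (Y ⊖ P) w t (cong₂ _⊖ᴸ_ yw pw) (cong₂ _⊖ᴸ_ (at tY) pt)
        pyr : (P ⊖ Y) r ≡ O
        pyr = cong₂ _⊖ᴸ_ (at-r P∈) yr
        2k≤P⊖Y : 2 * k ≤ 𝔽 (P ⊖ Y)
        2k≤P⊖Y = conn (P ⊖ Y) z r (cong₂ _⊖ᴸ_ pz yz) pyr
        shared-≥ : 𝔻 (δ t) + 𝔻 (δ r) ≤ 𝔻 (λ v → shared (P v) (Y v))
        shared-≥ = 𝔻-δδ (r≢t ∘ sym) (value-≥ refl (cong₂ shared pt (at tY))) (value-≥ refl (cong₂ shared (at-r P∈) yr))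
        finish : 𝔽 P + 2 * k ≤ 1 + (𝔽 (P ⊖ Y) + 𝔽 (Y ⊖ P)) → ⊥
        finish le = refute 8 (λ a b s p y k t r →
          a ⊕ b ⊕ s ⊑ p ⊕ y ∷ p ⊕ 2 ⊛ k ⊑ con 1 ⊕ (a ⊕ b) ∷ y ⊑ 2 ⊛ k ∷ t ⊕ r ⊑ s ∷ con 1 ⊑ t ∷ con 1 ⊑ r ∷ [])
          (𝔽 (P ⊖ Y) ∷ 𝔽 (Y ⊖ P) ∷ 𝔻 (λ v → shared (P v) (Y v)) ∷ 𝔽 P ∷ 𝔽 Y ∷ k ∷ 𝔻 (δ t) ∷ 𝔻 (δ r) ∷ [])
          (pos ∷ le ∷ bound tY ∷ shared-≥ ∷ nt ∷ nr ∷ [])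
        by-partner : Partner c → ⊥
        by-partner (twice c≡t a≡t) = refute 9 (λ a b s p y k t r i →
          a ⊕ b ⊕ s ⊑ p ⊕ y ∷ 2 ⊛ k ⊑ a ∷ 2 ⊛ k ⊑ b ∷ y ⊑ 2 ⊛ k ∷ t ⊕ r ⊑ s ∷ con 2 ⊑ t ∷ con 1 ⊑ r ∷
          p ⊑ 2 ⊛ k ⊕ (con 1 ⊕ i) ∷ i ⊑ con 1 ∷ [])
          (𝔽 (P ⊖ Y) ∷ 𝔽 (Y ⊖ P) ∷ 𝔻 (λ v → shared (P v) (Y v)) ∷ 𝔽 P ∷ 𝔽 Y ∷ k ∷ 𝔻 (δ t) ∷ 𝔻 (δ r) ∷ #I (P c) ∷ [])
          (pos ∷ 2k≤P⊖Y ∷ 2k≤Y⊖P ∷ bound tY ∷ shared-≥ ∷ two-at-t a≡t ∷ nr ∷ bound-with-t P∈ pt ∷ #I≤1 (P c) ∷ [])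
        by-partner (free c≢t nc ¬blocked) with P c in pc
        ... | W = c≢r (Basic.only (M″.tight-member P∈) pc)
        ... | O = finish (refute-≥ (≤-trans (≤-reflexive (F-same E″ k P pt pc refl)) (Basic.bound (M″.tight-member P∈))))
          where
          refute-≥ : 𝔽 P ≤ 2 * k → 𝔽 P + 2 * k ≤ 1 + (𝔽 (P ⊖ Y) + 𝔽 (Y ⊖ P))
          refute-≥ le = m≤n⇒m≤1+n (+-mono-≤ (≤-trans le 2k≤P⊖Y) 2k≤Y⊖P)
        ... | I = refute 8 (λ a b s p y k t r →
          a ⊕ b ⊕ s ⊑ p ⊕ y ∷ con 1 ⊕ 2 ⊛ k ⊑ a ∷ 2 ⊛ k ⊑ b ∷ y ⊑ 2 ⊛ k ∷ t ⊕ r ⊑ s ∷ con 1 ⊑ t ∷ con 1 ⊑ r ∷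
          p ⊑ 2 ⊛ k ⊕ con 2 ∷ [])
          (𝔽 (P ⊖ Y) ∷ 𝔽 (Y ⊖ P) ∷ 𝔻 (λ v → shared (P v) (Y v)) ∷ 𝔽 P ∷ 𝔽 Y ∷ k ∷ 𝔻 (δ t) ∷ 𝔻 (δ r) ∷ [])
          (pos ∷ not-blocked ¬blocked (cong₂ _⊖ᴸ_ pt (at tY)) (cong₂ _⊖ᴸ_ pc yc) nc (r , pyr) ∷ 2k≤Y⊖P ∷ bound tY ∷ shared-≥ ∷
           nt ∷ nr ∷ subst (λ m → 𝔽 P ≤ 2 * k + (1 + #I m)) pc (bound-with-t P∈ pt) ∷ [])
          where
          yc : Y c ≡ O
          yc = tight-label tY c≢t (λ e → ¬blocked (Y , tY , e))

      without-t-inside : ∀ {P z} → P ∈ M″.members → P t ≡ O → P z ≡ I → Y z ≡ I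
      without-t-inside P∈ pt = tight-nested tY nr yr (at-r P∈) pt (bound-without-t P∈ pt)

      -- A neighbour outside P lies in a member without t, hence in Y by `tight-nested`. So a P
      -- containing t and leaving Y would cross Y.
      member-inside : ∀ {P z} → P ∈ M″.members → P z ≡ I → ¬ Y z ≡ O
      member-inside {P} {z} P∈ pz yz = [ (λ pt → I≢O (without-t-inside P∈ pt pz) yz) , with-t ]′ (label-at-t P∈)
        where
        with-t : P t ≡ I → ⊥
        with-t pt = go (let (x , _ , px) = M″.member-nbr P∈ in S″.odd-outside {j = j″} odd″ (M″.tight-member P∈) px)
          where
          go : ∃[ w ] Neighbour H″ w × P w ≡ O → ⊥
          go (w , nw , pw) = go′ (M″.cover nw (λ { refl → O≢W pw (at-r P∈) }))
            where
            go′ : ∃[ Q ] Q ∈ M″.members × Q w ≡ I → ⊥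
            go′ (Q , Q∈ , qw) = [ (λ qt → not-crossing P∈ pt pz yz (without-t-inside Q∈ qt qw) pw) ,
              (λ qt → I≢O (subst (λ Z → Z w ≡ I) (M″.unique Q∈ P∈ qt pt) qw) pw) ]′ (label-at-t Q∈)

      -- By `balance` in H″ some neighbour of s is outside Y, and the member covering it leaves Y.
      blocked-centre : ⊥
      blocked-centre = go (D-positive H″ (#O ∘ Y) positive)
        where
        positive : 1 ≤ D H″ (#O ∘ Y)
        positive = ≮⇒≥ λ lt → refute 6 (λ i o f g k d →
          i ⊕ 2 ⊛ k ⊑ f ⊕ o ∷ f ⊑ g ∷ g ⊑ 2 ⊛ k ∷ con 1 ⊕ o ⊑ con 1 ∷ con 1 ⊑ d ∷ d ⊑ i ∷ [])
          (D H″ (#I ∘ Y) ∷ D H″ (#O ∘ Y) ∷ F k H″ Y ∷ 𝔽 Y ∷ k ∷ D H″ (δ r) ∷ [])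
          (S″.balance Y yr (proj₂ (out tY)) ∷ F-decreases E″ k Y ∷ bound tY ∷ lt ∷ S″.odd-neighbour {j = j″} odd″ ∷
           S″.𝔻-δ (value-≥ refl (cong #I yr)) ∷ [])
        go : ∃[ z ] Neighbour H″ z × 1 ≤ #O (Y z) → ⊥
        go (z , nz , p) with Y z in yz
        ... | O = let (P , P∈ , pz) = M″.cover nz (λ { refl → I≢O yr yz }) in member-inside P∈ pz yz

    -- The second centre r is not blocked with t

    module _ (r-free : ¬ Blocked t r) where

      c≢blocked : ∀ {x} → Blocked t x → ¬ x ≡ c
      c≢blocked bx x≡c = by-partner partner
        where
        by-partner : Partner c → ⊥
        by-partner (free _ _ ¬blocked) = ¬blocked (subst (Blocked t) x≡c bx)
        by-partner (twice c≡t _) = tight-≢-centre (proj₁ (proj₂ bx)) (proj₂ (proj₂ bx)) (trans x≡c c≡t)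

      -- A member without t is tight in H with wall {r}, and `tight-disjoint` applies to it. As
      -- members are disjoint, one P serves for all blocked x.
      blocked-with-t : ∀ {x} → Neighbour H x → Blocked t x → ∃[ P ] P ∈ M″.members × P x ≡ I × P t ≡ I
      blocked-with-t {x} nx (Y , tY , yx) =
        let x≢t = tight-≢-centre tY yx
            (P , P∈ , px) = M″.cover (neighbour-down E″ nx x≢t (c≢blocked (Y , tY , yx))) (λ { refl → r-free (Y , tY , yx) })
        in P , P∈ , px , [ (λ pt → ⊥-elim (tight-disjoint tY (tight-without-t P∈ pt) (r≢t ∘ sym) pt
             (tight-label tY r≢t (λ e → r-free (Y , tY , e))) yx px nx)) , (λ pt → pt) ]′ (label-at-t P∈)

      module _ {P : Labeling n} (P∈ : P ∈ M″.members) (pt : P t ≡ I) where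

        blocked-inside : ∀ {x} → Neighbour H x → Blocked t x → P x ≡ I
        blocked-inside nx bx = let (Q , Q∈ , qx , qt) = blocked-with-t nx bx in subst (λ Z → Z _ ≡ I) (M″.unique Q∈ P∈ qt pt) qx

        outside-free : ∀ {z} → Neighbour H z → P z ≡ O → ¬ Blocked t z
        outside-free nz pz bz = I≢O (blocked-inside nz bz) pz

        module _ {X : Labeling n} (X∈ : X ∈ members) (sX : Special X) where

          free-inside : ∀ {z} → Neighbour H z → ¬ z ≡ t → ¬ Blocked t z → X z ≡ I
          free-inside {z} nz z≢t ¬bz = by-cases (z Fin.≟ b) (z Fin.≟ a) (X z ≟ᴸ I)
            where
            by-cases : Dec (z ≡ b) → Dec (z ≡ a) → Dec (X z ≡ I) → X z ≡ I
            by-cases (yes refl) _ _ = proj₁ sX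
            by-cases _ (yes refl) _ = [ ⊥-elim ∘ z≢t , (λ xa → xa) ]′ (proj₂ sX)
            by-cases _ _ (yes i) = i
            by-cases (no z≢b) (no z≢a) (no ni) =
              let (Y , Y∈ , yz) = cover (neighbour-down E nz z≢a z≢b) z≢t
              in ⊥-elim (¬bz (ordinary-blocked Y∈ (not-special X∈ Y∈ sX (label-at X∈ z≢t ni) yz) yz))

          X-t : X t ≡ W
          X-t = Basic.at (tight-member X∈)

          xr : X r ≡ I
          xr = free-inside nr r≢t r-free

          #PX #XP #both : Fin n → ℕ
          #PX v = #IO (P v) (X v)
          #XP v = #IO (X v) (P v)
          #both v = #II (P v) (X v)

          split-I : ∀ p x → #IO p x + #II p x ≤ #I p
          split-I O x = z≤n
          split-I W x = z≤n
          split-I I O = s≤s z≤n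
          split-I I W = z≤n
          split-I I I = s≤s z≤n

          inner-P : 𝔻 (δ t) + (𝔻 #PX + 𝔻 #both) ≤ 𝔻 (#I ∘ P)
          inner-P = ≤-trans (≤-reflexive (cong (𝔻 (δ t) +_) (sym (D-+ H #PX #both)))) (𝔻-δ-+ (λ v → split-I (P v) (X v)) strict)
            where
            strict : #PX t + #both t < #I (P t)
            strict rewrite pt | X-t = s≤s z≤n

          inner-X : 𝔻 (δ r) + (𝔻 #XP + 𝔻 #both) ≤ 𝔻 (#I ∘ X)
          inner-X = ≤-trans (≤-reflexive (cong (𝔻 (δ r) +_) (sym (D-+ H #XP #both)))) (𝔻-δ-+ below strict)
            where
            below : ∀ v → #XP v + #both v ≤ #I (X v)
            below v = ≤-trans (≤-reflexive (cong (#XP v +_) (*-comm (#I (P v)) (#I (X v))))) (split-I (X v) (P v))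
            strict : #XP r + #both r < #I (X r)
            strict rewrite at-r P∈ | xr = s≤s z≤n

          outer-P : ∀ v → Neighbour H″ v → #O (P v) ≤ #XP v
          outer-P v nv = go (P v) refl
            where
            go : ∀ p → P v ≡ p → #O (P v) ≤ #XP v
            go W pv = ≤-trans (≤-reflexive (cong #O pv)) z≤n
            go I pv = ≤-trans (≤-reflexive (cong #O pv)) z≤n
            go O pv = value-≥ (cong #O pv) (cong₂ #IO
              (free-inside (neighbour-up E″ nv) (λ { refl → I≢O pt pv }) (outside-free (neighbour-up E″ nv) pv)) pv)

          outer-X : ∀ v → Neighbour H′ v → #O (X v) ≤ #PX v
          outer-X v nv with X v in xv | P v ≟ᴸ I
          ... | W | _ = z≤n
          ... | I | _ = z≤n
          ... | O | yes pv rewrite pv = s≤s z≤n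
          ... | O | no pv = ⊥-elim (I≢O (free-inside (neighbour-up E nv) (outside-≢ X∈ xv)
            (λ bv → pv (blocked-inside (neighbour-up E nv) bv))) xv)

          -- The sum of the inequalities odd-balance for P in H″ and for X in H′.
          exchange : 𝔻 (δ t) + 𝔻 (δ r) + (𝔻 #both + 𝔻 #both) + #XP c ≤ #I (P c) + #I (X a)
          exchange = ≮⇒≥ λ lt → refute 16 (λ t r i κ π xpc pc xa iP iX iP″ oP″ iX′ oX′ xp″ px′ →
            con 1 ⊕ (pc ⊕ xa) ⊑ t ⊕ r ⊕ (i ⊕ i) ⊕ xpc ∷ t ⊕ (κ ⊕ i) ⊑ iP ∷ r ⊕ (π ⊕ i) ⊑ iX ∷
            iP ⊑ iP″ ⊕ (con 1 ⊕ pc) ∷ con 1 ⊕ iP″ ⊑ oP″ ∷ oP″ ⊑ xp″ ∷ xp″ ⊕ (con 0 ⊕ xpc) ⊑ π ∷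
            iX ⊑ iX′ ⊕ (xa ⊕ con 1) ∷ con 1 ⊕ iX′ ⊑ oX′ ∷ oX′ ⊑ px′ ∷ px′ ⊑ κ ∷ [])
            (𝔻 (δ t) ∷ 𝔻 (δ r) ∷ 𝔻 #both ∷ 𝔻 #PX ∷ 𝔻 #XP ∷ #XP c ∷ #I (P c) ∷ #I (X a) ∷ 𝔻 (#I ∘ P) ∷ 𝔻 (#I ∘ X) ∷
             D H″ (#I ∘ P) ∷ D H″ (#O ∘ P) ∷ D H′ (#I ∘ X) ∷ D H′ (#O ∘ X) ∷ D H″ #XP ∷ D H′ #PX ∷ [])
            (lt ∷ inner-P ∷ inner-X ∷
             ≤-reflexive (D-labels E″ #I P pt refl) ∷
             S″.odd-balance {j = j″} odd″ (M″.tight-member P∈) (proj₂ (proj₂ (M″.member-nbr P∈))) ∷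
             D-nbr-mono H″ outer-P ∷
             ≤-reflexive (sym (trans (D-effect E″ #XP) (cong (λ m → D H″ #XP + (m + #XP c)) (cong₂ #IO X-t pt)))) ∷
             ≤-reflexive (D-labels E #I X refl (proj₁ sX)) ∷
             S′.odd-balance {j = j} odd (tight-member X∈) (proj₂ (proj₂ (member-nbr X∈))) ∷
             D-nbr-mono H′ outer-X ∷
             ≤-trans (m≤m+n _ _) (≤-reflexive (sym (D-effect E #PX))) ∷ [])

          -- st and sr put at least 2 on the left of `exchange`. On the right c and a count at most
          -- 1 each; for c = t the term of a vanishes, as a is in the wall of X, and otherwise c
          -- inside P is paid for by the edge sc common to P and X.
          special-impossible : ⊥
          special-impossible = by-partner partner
            where
            by-partner : Partner c → ⊥
            by-partner (twice c≡t a≡t) = refute 6 (λ t r i xpc pc xa →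
              t ⊕ r ⊕ (i ⊕ i) ⊕ xpc ⊑ pc ⊕ xa ∷ con 1 ⊑ t ∷ con 1 ⊑ r ∷ pc ⊑ con 1 ∷ xa ⊑ con 0 ∷ [])
              (𝔻 (δ t) ∷ 𝔻 (δ r) ∷ 𝔻 #both ∷ #XP c ∷ #I (P c) ∷ #I (X a) ∷ [])
              (exchange ∷ nt ∷ nr ∷ #I≤1 (P c) ∷ ≤-reflexive (cong #I (trans (cong X a≡t) X-t)) ∷ [])
            by-partner (free c≢t nc ¬bc) = refute 6 (λ t r i xpc pc xa →
              t ⊕ r ⊕ (i ⊕ i) ⊕ xpc ⊑ pc ⊕ xa ∷ con 1 ⊑ t ∷ con 1 ⊑ r ∷ pc ⊑ i ∷ xa ⊑ con 1 ∷ [])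
              (𝔻 (δ t) ∷ 𝔻 (δ r) ∷ 𝔻 #both ∷ #XP c ∷ #I (P c) ∷ #I (X a) ∷ [])
              (exchange ∷ nt ∷ nr ∷ shared-c (P c) refl ∷ #I≤1 (X a) ∷ [])
              where
              shared-c : ∀ p → P c ≡ p → #I (P c) ≤ 𝔻 #both
              shared-c O pc = ≤-trans (≤-reflexive (cong #I pc)) z≤n
              shared-c W pc = ≤-trans (≤-reflexive (cong #I pc)) z≤n
              shared-c I pc = ≤-trans (≤-reflexive (cong #I pc)) (≤-trans nc (𝔻-δ (value-≥ refl (cong₂ #II pc (free-inside nc c≢t ¬bc)))))

        module _ (none : ∀ {X} → X ∈ members → ¬ Special X) where

          free-not-nbr : ∀ {z} → Neighbour H z → ¬ z ≡ t → ¬ Blocked t z → D H′ (δ z) ≤ 0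
          free-not-nbr nz z≢t ¬bz = ≮⇒≥ λ n′z → ¬bz (cover-blocked none n′z z≢t)

          free-ends : ∀ {z} → Neighbour H z → ¬ z ≡ t → ¬ Blocked t z → z ≡ a ⊎ z ≡ b
          free-ends {z} nz z≢t ¬bz with z Fin.≟ a | z Fin.≟ b
          ... | yes e | _ = inj₁ e
          ... | no _ | yes e = inj₂ e
          ... | no z≢a | no z≢b = ⊥-elim (<⇒≱ (neighbour-down E nz z≢a z≢b) (free-not-nbr nz z≢t ¬bz))

          -- All edges at the free vertices belong to the pair (sa,sb).
          simple-end : ∀ {z} → ¬ a ≡ b → Neighbour H z → ¬ z ≡ t → ¬ Blocked t z → 𝔻 (δ z) ≤ 1
          simple-end {z} a≢b nz z≢t ¬bz = ≤-trans (≤-reflexive (D-effect E (δ z))) (+-mono-≤ (free-not-nbr nz z≢t ¬bz) ends)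
            where
            ends : δ z a + δ z b ≤ 1
            ends with z Fin.≟ a | z Fin.≟ b
            ... | yes refl | yes e = ⊥-elim (a≢b e)
            ... | yes _ | no _ = s≤s z≤n
            ... | no _ | yes _ = s≤s z≤n
            ... | no _ | no _ = z≤n

          -- Now a and b are the only possible unblocked neighbours, while r and y are two distinct
          -- ones. So c coincides with r or y, whose edge survives the second splitting-off and must
          -- be double in H, against `simple-end`.
          ordinary-impossible : ∃[ y ] Neighbour H″ y × P y ≡ O → ⊥
          ordinary-impossible (y , ny , py) = by-partner partner
            where
            y≢t : ¬ y ≡ t
            y≢t refl = I≢O pt py
            r≢y : ¬ r ≡ y
            r≢y refl = O≢W py (at-r P∈)
            Ny : Neighbour H y
            Ny = neighbour-up E″ ny
            y-free : ¬ Blocked t y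
            y-free = outside-free Ny py
            double : ∀ {z} → Neighbour H″ z → z ≡ c → 2 ≤ 𝔻 (δ z)
            double {z} nz refl = ≤-trans (+-mono-≤ nz (≤-trans (≤-reflexive (sym (δ-refl z))) (m≤n+m _ (δ z t)))) (≤-reflexive (sym (D-effect E″ (δ z))))
            by-partner : Partner c → ⊥
            by-partner (twice _ a≡t) = r≢y (trans (end nr r≢t r-free) (sym (end Ny y≢t y-free)))
              where
              end : ∀ {z} → Neighbour H z → ¬ z ≡ t → ¬ Blocked t z → z ≡ b
              end nz z≢t ¬bz = [ (λ e → ⊥-elim (z≢t (trans e a≡t))) , (λ e → e) ]′ (free-ends nz z≢t ¬bz)
            by-partner (free c≢t nc ¬bc) = contradict (r-or-y (free-ends nr r≢t r-free) (free-ends Ny y≢t y-free) (free-ends nc c≢t ¬bc))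
              where
              a≢b : ¬ a ≡ b
              a≢b a≡b = r≢y (trans (end nr r≢t r-free) (sym (end Ny y≢t y-free)))
                where
                end : ∀ {z} → Neighbour H z → ¬ z ≡ t → ¬ Blocked t z → z ≡ b
                end nz z≢t ¬bz = [ (λ e → trans e a≡b) , (λ e → e) ]′ (free-ends nz z≢t ¬bz)
              r-or-y : r ≡ a ⊎ r ≡ b → y ≡ a ⊎ y ≡ b → c ≡ a ⊎ c ≡ b → r ≡ c ⊎ y ≡ c
              r-or-y (inj₁ r≡a) _ (inj₁ c≡a) = inj₁ (trans r≡a (sym c≡a))
              r-or-y (inj₂ r≡b) _ (inj₂ c≡b) = inj₁ (trans r≡b (sym c≡b))
              r-or-y _ (inj₁ y≡a) (inj₁ c≡a) = inj₂ (trans y≡a (sym c≡a))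
              r-or-y _ (inj₂ y≡b) (inj₂ c≡b) = inj₂ (trans y≡b (sym c≡b))
              r-or-y (inj₁ r≡a) (inj₁ y≡a) (inj₂ _) = ⊥-elim (r≢y (trans r≡a (sym y≡a)))
              r-or-y (inj₂ r≡b) (inj₂ y≡b) (inj₁ _) = ⊥-elim (r≢y (trans r≡b (sym y≡b)))
              contradict : r ≡ c ⊎ y ≡ c → ⊥
              contradict (inj₁ e) = <⇒≱ (double (S″.odd-neighbour {j = j″} odd″) e) (simple-end a≢b nr r≢t r-free)
              contradict (inj₂ e) = <⇒≱ (double ny e) (simple-end a≢b Ny y≢t y-free)

      free-centre : ⊥
      free-centre = go some-ordinary
        where
        go′ : ∀ {P} → P ∈ M″.members → P t ≡ I → Dec (∃[ X ] X ∈ members × Special X) → ⊥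
        go′ P∈ pt (yes (X , X∈ , sX)) = special-impossible P∈ pt X∈ sX
        go′ P∈ pt (no none) = ordinary-impossible P∈ pt (λ X∈ sX → none (_ , X∈ , sX))
          (let (x , _ , px) = M″.member-nbr P∈ in S″.odd-outside {j = j″} odd″ (M″.tight-member P∈) px)
        go : ∃[ X ] ∃[ z ] X ∈ members × Neighbour H′ z × X z ≡ I × ¬ Special X → ⊥
        go (X , z , X∈ , nz , xz , ns) =
          let (P , P∈ , _ , pt) = blocked-with-t (neighbour-up E nz) (ordinary-blocked X∈ ns xz) in go′ P∈ pt any-special?

    no-second-obstacle : ⊥
    no-second-obstacle = free-centre λ (Y , tY , yr) → blocked-centre tY yr

-- Complete splitting-off

NoObstacle : ∀ {n} → ℕ → Graph n → Set
NoObstacle k H = ∀ t j → D H (δ t) ≡ 1 + 2 * j → Family k H t → ⊥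

parity : ∀ d → (∃[ j ] d ≡ 2 * j) ⊎ (∃[ j ] d ≡ 1 + 2 * j)
parity zero = inj₁ (0 , refl)
parity (suc d) with parity d
... | inj₁ (j , refl) = inj₂ (j , refl)
... | inj₂ (j , refl) = inj₁ (1 + j , sym (*-distribˡ-+ 2 1 j))

even-after : ∀ {n m u v} {H H′ : Graph n} → degree H ≡ 2 * suc m → Effect H u v H′ → degree H′ ≡ 2 * m
even-after {m = m} even E = +-cancelʳ-≡ 2 _ _ (trans (sym (D-effect E (λ _ → 1))) (trans even (arrange m)))
  where
  arrange : ∀ m → 2 * suc m ≡ 2 * m + 2
  arrange = solve-∀

-- A splitting-off that creates no obstacle

module GoodSplit {n : ℕ} (k : ℕ) (2≤k : 2 ≤ k) (H : Graph n) (conn : Conn k H)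
  (m : ℕ) (even : degree H ≡ 2 * suc m) (no-obstacle : NoObstacle k H)
  (bad : ∀ {u v H′} → Split H u v H′ → Conn k H′ → NoObstacle k H′ → ⊥) where

  open Splitting k H conn (suc m) even

  inadmissible : ∀ {u v} → Neighbour H u → Neighbour H v → (u ≡ v → 2 ≤ 𝔻 (δ u)) →
    (∀ {H′} → Split H u v H′ → Conn k H′ → ⊥) → Inadmissible u v
  inadmissible nu nv two κ = let (_ , S) = split-exists H nu nv two in not-connected (effect S) (κ S)

  all-blocked : ∀ {t j} → 𝔻 (δ t) ≡ 1 + 2 * j → (∀ {v} → Neighbour H v → ¬ v ≡ t → (Blocked t v → ⊥) → ⊥) → ⊥
  all-blocked {t} {j} odd blocked = family blocked (no-obstacle t j odd)

  module Resolve {H′ : Graph n} {a b t : Fin n} (E : Effect H a b H′) (b≢t : ¬ b ≡ t) (conn′ : Conn k H′)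
    {j : ℕ} (odd : D H′ (δ t) ≡ 1 + 2 * j) (fam : Family k H′ t) where

    module N = NewObstacle k H conn (suc m) even H′ conn′ m (even-after {m = m} even E) E b≢t fam {j} odd

    nt : Neighbour H t
    nt = neighbour-up E (≤-trans (s≤s z≤n) (≤-reflexive (sym odd)))

    with-centre : a ≡ t → ⊥
    with-centre a≡t = N.centre-pair a≡t (inadmissible nt nt (λ _ → N.two-at-t a≡t) λ S″ conn″ → bad S″ conn″ λ r j″ odd″ fam″ →
      N.Second.no-second-obstacle _ conn″ m (even-after {m = m} even (effect S″)) (effect S″) (r≢t (effect S″) j″ odd″) fam″ {j″} odd″ (N.twice refl a≡t))
      where
      arrange : ∀ j → 1 + 2 * j + (1 + 1) ≡ 1 + 2 * (1 + j)
      arrange = solve-∀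
      -- Two copies of st disappear, so d(s,t) stays even and t cannot be the new centre.
      r≢t : ∀ {H″ r} → Effect H t t H″ → ∀ j″ → D H″ (δ r) ≡ 1 + 2 * j″ → ¬ r ≡ t
      r≢t E″ j″ odd″ refl = even≢odd (1 + j) (1 + j″) (trans (sym (N.degree-at-t a≡t)) (trans (D-effect E″ (δ t))
        (trans (cong₂ _+_ odd″ (cong₂ _+_ (δ-refl t) (δ-refl t))) (arrange j″))))

    without-centre : ¬ a ≡ t → ⊥
    without-centre a≢t = go N.some-ordinary
      where
      odd-H : 𝔻 (δ t) ≡ 1 + 2 * j
      odd-H = trans (D-effect E (δ t)) (trans (cong₂ _+_ odd (cong₂ _+_ (δ-≢ (a≢t ∘ sym)) (δ-≢ (b≢t ∘ sym)))) (+-identityʳ _))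
      arrange : ∀ j → 1 + 2 * j + (1 + 0) ≡ 2 * (1 + j)
      arrange = solve-∀
      -- Exactly one copy of st disappears, so d(s,t) turns from odd to even.
      r≢t : ∀ {w H″ r} → ¬ w ≡ t → Effect H t w H″ → ∀ j″ → D H″ (δ r) ≡ 1 + 2 * j″ → ¬ r ≡ t
      r≢t w≢t E″ j″ odd″ refl = even≢odd (1 + j″) j (trans (sym (trans (D-effect E″ (δ t))
        (trans (cong₂ _+_ odd″ (cong₂ _+_ (δ-refl t) (δ-≢ (w≢t ∘ sym)))) (arrange j″)))) odd-H)
      bad-at-t : ∀ {w} → Neighbour H w → ¬ w ≡ t → ¬ Blocked t w → Inadmissible t w
      bad-at-t nw w≢t ¬bw = inadmissible nt nw (⊥-elim ∘ w≢t ∘ sym) λ S″ conn″ → bad S″ conn″ λ r j″ odd″ fam″ →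
        N.Second.no-second-obstacle _ conn″ m (even-after {m = m} even (effect S″)) (effect S″) (r≢t w≢t (effect S″) j″ odd″) fam″ {j″} odd″
          (N.free w≢t nw ¬bw)
      go : ∃[ X ] ∃[ z ] X ∈ Family.members fam × Neighbour H′ z × X z ≡ I × ¬ N.Special X → ⊥
      go (X , z , X∈ , nz , xz , ns) = all-blocked {j = j} odd-H λ nw w≢t ¬bw →
        some-admissible nt (N.ordinary-tight X∈ ns) (neighbour-up E nz) xz bad-at-t nw w≢t ¬bw

    resolve : ⊥
    resolve = without-centre with-centre

  -- Together with `bad` this leaves no admissible pair at all: a pair that creates an obstacle
  -- would give way to a second one that contradicts `bad`. `effect-swap` provides for b ≠ t.
  no-new-obstacle : ∀ {a b H′} → Effect H a b H′ → Conn k H′ → NoObstacle k H′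
  no-new-obstacle {a} {b} {H′} E conn′ t j odd fam with b Fin.≟ t | a Fin.≟ t
  ... | no b≢t | _ = Resolve.resolve E b≢t conn′ {j} odd fam
  ... | yes _ | no a≢t = Resolve.resolve (effect-swap E) a≢t conn′ {j} odd fam
  -- The pair is (st,st). It changes f_H on no bi-set with t in its wall and keeps d(s,t) odd, so
  -- the obstacle was already one of H.
  ... | yes refl | yes refl = all-blocked {j = 1 + j} (trans (D-effect E (δ t)) (trans (cong₂ _+_ odd (cong₂ _+_ (δ-refl t) (δ-refl t))) (arrange j)))
      λ nv v≢t ¬bv → let (X , X∈ , xv) = Family.cover fam (neighbour-down E nv v≢t v≢t) v≢t in ¬bv (X , lift (Family.tight-member fam X∈) , xv)
    where
    arrange : ∀ j → 1 + 2 * j + (1 + 1) ≡ 1 + 2 * (1 + j)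
    arrange = solve-∀
    lift : ∀ {X} → Basic.Tight k H′ t X → Tight t X
    lift {X} tX = record { at = Basic.at tX ; only = Basic.only tX ; out = Basic.out tX
      ; bound = ≤-trans (≤-reflexive (F-same E k X (Basic.at tX) (Basic.at tX) refl)) (Basic.bound tX) }

  all-inadmissible : ∀ {u v} → Neighbour H u → Neighbour H v → (u ≡ v → 2 ≤ 𝔻 (δ u)) → Inadmissible u v
  all-inadmissible nu nv two = inadmissible nu nv two λ S conn′ → bad S conn′ (no-new-obstacle (effect S) conn′)

  -- One blocked neighbour would make all of them blocked. Then d_H(s,t) odd means an obstacle, and
  -- d_H(s,t) even makes (st,st) admissible.
  unblocked : ∀ {t x} → Neighbour H t → Neighbour H x → ¬ Blocked t x
  unblocked {t} {x} nt nx (M , tM , mx) = by-parity (parity (𝔻 (δ t)))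
    where
    blocked : ∀ {v} → Neighbour H v → ¬ v ≡ t → (Blocked t v → ⊥) → ⊥
    blocked = some-admissible nt tM nx mx (λ nw w≢t _ → all-inadmissible nt nw (⊥-elim ∘ w≢t ∘ sym))
    two-at : ∀ j → 𝔻 (δ t) ≡ 2 * j → 2 ≤ 𝔻 (δ t)
    two-at zero eq = ⊥-elim (<⇒≱ nt (≤-reflexive eq))
    two-at (suc j) eq = ≤-trans (*-monoʳ-≤ 2 (s≤s z≤n)) (≤-reflexive (sym eq))
    by-parity : (∃[ j ] 𝔻 (δ t) ≡ 2 * j) ⊎ (∃[ j ] 𝔻 (δ t) ≡ 1 + 2 * j) → ⊥
    by-parity (inj₂ (j , odd)) = all-blocked {j = j} odd blocked
    by-parity (inj₁ (j , eq)) = family blocked λ fam →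
      centre-pair-admissible fam (two-at j eq) (all-inadmissible nt nt (λ _ → two-at j eq))

  impossible : ⊥
  impossible = some-unblocked-admissible 2≤k (s≤s z≤n) unblocked all-inadmissible

-- The existence of a complete admissible splitting-off is decidable, hence
-- may be proved by contradiction.

-- Labelings are functions and agree with the enumerated ones only pointwise, hence the condition
-- that `P` respects pointwise equality.
any-labeling? : ∀ {n} (P : Labeling n → Set) → (∀ {L L′} → (∀ v → L v ≡ L′ v) → P L → P L′) →
  (∀ L → Dec (P L)) → Dec (∃[ L ] P L)
any-labeling? {zero} P resp P? with P? (λ ())
... | yes p = yes (_ , p)
... | no ¬p = no λ (L , p) → ¬p (resp (λ ()) p)
any-labeling? {suc n} P resp P? with
  any-labeling? (P ∘ extend O) (resp ∘ extend-cong) (P? ∘ extend O) |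
  any-labeling? (P ∘ extend W) (resp ∘ extend-cong) (P? ∘ extend W) |
  any-labeling? (P ∘ extend I) (resp ∘ extend-cong) (P? ∘ extend I)
  where
  extend : Label → Labeling n → Labeling (suc n)
  extend a L zero = a
  extend a L (suc v) = L v
  extend-cong : ∀ {a L L′} → (∀ v → L v ≡ L′ v) → ∀ v → extend a L v ≡ extend a L′ v
  extend-cong p zero = refl
  extend-cong p (suc v) = p v
... | yes (L , p) | _ | _ = yes (_ , p)
... | _ | yes (L , p) | _ = yes (_ , p)
... | _ | _ | yes (L , p) = yes (_ , p)
... | no ¬o | no ¬w | no ¬i = no λ (L , p) → split L (L zero) refl p
  where
  split : ∀ L a → L zero ≡ a → P L → ⊥
  split L O e p = ¬o (L ∘ suc , resp (λ { zero → e ; (suc v) → refl }) p)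
  split L W e p = ¬w (L ∘ suc , resp (λ { zero → e ; (suc v) → refl }) p)
  split L I e p = ¬i (L ∘ suc , resp (λ { zero → e ; (suc v) → refl }) p)

any-just : ∀ {A : Set} {P : A → Set} {m : Maybe A} → MaybeAny.Any P m → ∃[ x ] m ≡ just x × P x
any-just (MaybeAny.just p) = _ , refl , p

module _ {n : ℕ} (k : ℕ) where

  conn? : (H : Graph n) → Dec (Conn k H)
  conn? H with any-labeling? Broken
      (λ p ((i , li) , (o , lo) , lt) → (i , trans (sym (p i)) li) , (o , trans (sym (p o)) lo) ,
        ≤-trans (s≤s (F-mono k H (sym ∘ p))) lt)
      (λ L → Fin.any? (λ i → L i ≟ᴸ I) ×-dec (Fin.any? (λ o → L o ≟ᴸ O) ×-dec (suc (F k H L) ≤? 2 * k)))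
    where
    Broken : Labeling n → Set
    Broken L = (∃[ i ] L i ≡ I) × (∃[ o ] L o ≡ O) × F k H L < 2 * k
  ... | yes (L , (i , li) , (o , lo) , lt) = no λ conn → <⇒≱ lt (conn L i o li lo)
  ... | no ∄ = yes λ L i o li lo → ≮⇒≥ λ lt → ∄ (L , (i , li) , (o , lo) , lt)

  Splittable : ℕ → Graph n → Set
  Splittable zero H = Conn k H
  Splittable (suc m) H = ∃[ u ] ∃[ v ] MaybeAny.Any (λ R₁ →
    MaybeAny.Any (λ R₂ → Splittable m ((just u , just v) ∷ R₂)) (pick v R₁)) (pick u H)

  splittable? : ∀ m H → Dec (Splittable m H)
  splittable? zero H = conn? H
  splittable? (suc m) H = Fin.any? λ u → Fin.any? λ v → MaybeAny.dec (λ R₁ →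
    MaybeAny.dec (λ R₂ → splittable? m _) (pick v R₁)) (pick u H)

  split-splittable : ∀ {m H u v H′} → Split H u v H′ → Splittable m H′ → Splittable (suc m) H
  split-splittable {u = u} {v} record { first = p ; second = q ; result = refl } h = u , v ,
    subst (MaybeAny.Any _) (sym p) (MaybeAny.just (subst (MaybeAny.Any _) (sym q) (MaybeAny.just h)))

  splittable : 2 ≤ k → ∀ m H → Conn k H → degree H ≡ 2 * m → NoObstacle k H → (Splittable m H → ⊥) → ⊥
  splittable 2≤k zero H conn even none κ = κ conn
  splittable 2≤k (suc m) H conn even none κ = GoodSplit.impossible k 2≤k H conn m even none λ S conn′ none′ →
    splittable 2≤k m _ conn′ (even-after {m = m} even (effect S)) none′ (κ ∘ split-splittable S)

  splittable-sound : ∀ m {H} → Splittable m H → ∃[ H′ ] SplitOffs m H H′ × Conn k H′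
  splittable-sound zero h = _ , done , h
  splittable-sound (suc m) {H} (u , v , h) =
    let (R₁ , first , h₁) = any-just h
        (R₂ , second , h₂) = any-just h₁
        (H′ , off , conn) = splittable-sound m h₂
        S = record { first = first ; second = second ; result = refl }
    in H′ , step (u , v , R₂ , split-pair S , refl) off , conn

-- Bi-sets as labelings

─-∉ : ∀ {n} (p q : Subset n) {x} → x ∈ˢ p ─ q → x ∉ˢ q
─-∉ (_ ∷ p) (false ∷ q) (there x∈) (there x∈q) = ─-∉ p q x∈ x∈q
─-∉ (_ ∷ p) (true ∷ q) (there x∈) (there x∈q) = ─-∉ p q x∈ x∈q

∣∣≡sumᶠ : ∀ {n} (p : Subset n) {g : Fin n → ℕ} → (∀ {v} → v ∈ˢ p → g v ≡ 1) → (∀ {v} → v ∉ˢ p → g v ≡ 0) →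
  ∣ p ∣ ≡ sumᶠ g
∣∣≡sumᶠ [] _ _ = refl
∣∣≡sumᶠ (true ∷ p) one zero′ = cong₂ _+_ (sym (one here)) (∣∣≡sumᶠ p (one ∘ there) (λ v∉ → zero′ λ { (there v∈) → v∉ v∈ }))
∣∣≡sumᶠ (false ∷ p) one zero′ = cong₂ _+_ (sym (zero′ λ ())) (∣∣≡sumᶠ p (one ∘ there) (λ v∉ → zero′ λ { (there v∈) → v∉ v∈ }))

length-filter : ∀ {n} {P : Edge n → Set} (P? : ∀ e → Dec (P e)) (w : Edge n → ℕ) →
  (∀ e → P e → w e ≡ 1) → (∀ e → ¬ P e → w e ≡ 0) → ∀ H → length (filter P? H) ≡ sumᴱ w H
length-filter P? w one zero′ [] = refl
length-filter P? w one zero′ (e ∷ H) with P? e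
... | yes p = cong₂ _+_ (sym (one e p)) (length-filter P? w one zero′ H)
... | no ¬p = cong₂ _+_ (sym (zero′ e ¬p)) (length-filter P? w one zero′ H)

module _ {n : ℕ} where

  labeling : BiSet {n} → Labeling n
  labeling X v with v ∈? inner X | v ∈? outer X
  ... | yes _ | _ = I
  ... | no _ | yes _ = W
  ... | no _ | no _ = O

  labeling-I : ∀ X {v} → v ∈ˢ inner X → labeling X v ≡ I
  labeling-I X {v} v∈ with v ∈? inner X | v ∈? outer X
  ... | yes _ | _ = refl
  ... | no v∉ | _ = ⊥-elim (v∉ v∈)

  labeling-O : ∀ X {v} → v ∉ˢ outer X → labeling X v ≡ O
  labeling-O X {v} v∉ with v ∈? inner X | v ∈? outer X
  ... | yes v∈ | _ = ⊥-elim (v∉ (inner⊆outer X v∈))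
  ... | no _ | yes v∈ = ⊥-elim (v∉ v∈)
  ... | no _ | no _ = refl

  labeling-W : ∀ X {v} → v ∈ˢ wall X → labeling X v ≡ W
  labeling-W X {v} v∈ with v ∈? inner X | v ∈? outer X
  ... | yes v∈′ | _ = ⊥-elim (─-∉ (outer X) (inner X) v∈ v∈′)
  ... | no _ | yes _ = refl
  ... | no _ | no v∉ = ⊥-elim (v∉ (p─q⊆p (outer X) (inner X) v∈))

  I-inner : ∀ X {v} → labeling X v ≡ I → v ∈ˢ inner X
  I-inner X {v} e with v ∈? inner X | v ∈? outer X
  ... | yes v∈ | _ = v∈
  ... | no _ | yes _ with () ← e
  ... | no _ | no _ with () ← e

  O-outer : ∀ X {v} → labeling X v ≡ O → v ∉ˢ outer X
  O-outer X {v} e with v ∈? inner X | v ∈? outer X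
  ... | no _ | no v∉ = v∉
  ... | no _ | yes _ with () ← e
  ... | yes _ | _ with () ← e

  W-wall : ∀ X {v} → labeling X v ≡ W → v ∈ˢ wall X
  W-wall X {v} e with v ∈? inner X | v ∈? outer X
  ... | no v∉ | yes v∈ = x∈p∧x∉q⇒x∈p─q v∈ v∉
  ... | no _ | no _ with () ← e
  ... | yes _ | _ with () ← e

  cut-enters : ∀ X e → Enters X e → cutᴱ (labeling X) e ≡ 1
  cut-enters X (x , y) = [ (λ (p , q) → cong₂ entering (in-I x p) (out-O y q)) , (λ (p , q) → cong₂ entering (out-O x q) (in-I y p)) ]′
    where
    in-I : ∀ x → x ∈ⱽ inner X → labelⱽ (labeling X) x ≡ I
    in-I (just v) (MaybeAny.just v∈) = labeling-I X v∈
    out-O : ∀ y → ¬ y ∈ⱽ outer X → labelⱽ (labeling X) y ≡ O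
    out-O nothing _ = refl
    out-O (just v) v∉ = labeling-O X (v∉ ∘ MaybeAny.just)

  cut-avoids : ∀ X e → ¬ Enters X e → cutᴱ (labeling X) e ≡ 0
  cut-avoids X (x , y) ¬enters = go _ _ refl refl
    where
    in-I : ∀ x → labelⱽ (labeling X) x ≡ I → x ∈ⱽ inner X
    in-I (just v) e = MaybeAny.just (I-inner X e)
    out-O : ∀ y → labelⱽ (labeling X) y ≡ O → ¬ y ∈ⱽ outer X
    out-O (just v) e (MaybeAny.just v∈) = O-outer X e v∈
    go : ∀ a b → labelⱽ (labeling X) x ≡ a → labelⱽ (labeling X) y ≡ b → entering a b ≡ 0
    go I O p q = ⊥-elim (¬enters (inj₁ (in-I x p , out-O y q)))
    go O I p q = ⊥-elim (¬enters (inj₂ (in-I y q , out-O x p)))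
    go O O _ _ = refl
    go O W _ _ = refl
    go W O _ _ = refl
    go W W _ _ = refl
    go W I _ _ = refl
    go I W _ _ = refl
    go I I _ _ = refl

  f≡F : ∀ k H X → f k H X ≡ F k H (labeling X)
  f≡F k H X = cong₂ _+_ (length-filter (enters? X) (cutᴱ (labeling X)) (cut-enters X) (cut-avoids X) H)
    (cong (k *_) (∣∣≡sumᶠ (wall X) (cong #W ∘ labeling-W X) (λ {v} v∉ → not-wall (labeling X v) refl v∉)))
    where
    not-wall : ∀ {v} a → labeling X v ≡ a → v ∉ˢ wall X → #W (labeling X v) ≡ 0
    not-wall O e _ = cong #W e
    not-wall W e v∉ = ⊥-elim (v∉ (W-wall X e))
    not-wall I e _ = cong #W e

  degS≡degree : ∀ (H : Graph n) → degS H ≡ degree H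
  degS≡degree = length-filter (atS? {n}) (atSᴱ (λ _ → 1)) one none
    where
    one : ∀ e → AtS {n} e → atSᴱ (λ _ → 1) e ≡ 1
    one e (v , j) = atSᴱ-joins (λ _ → 1) j
    none : ∀ e → ¬ AtS {n} e → atSᴱ (λ _ → 1) e ≡ 0
    none (nothing , nothing) _ = refl
    none (nothing , just v) ¬at = ⊥-elim (¬at (v , inj₁ refl))
    none (just v , nothing) ¬at = ⊥-elim (¬at (v , inj₂ refl))
    none (just _ , just _) _ = refl

  δ-joins : ∀ t e → ¬ Joins {n} nothing (just t) e → atSᴱ (δ t) e ≡ 0
  δ-joins t (nothing , nothing) _ = refl
  δ-joins t (nothing , just v) ¬j = δ-≢ λ { refl → ¬j (inj₁ refl) }
  δ-joins t (just v , nothing) ¬j = δ-≢ λ { refl → ¬j (inj₂ refl) }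
  δ-joins t (just _ , just _) _ = refl

  degST≡D : ∀ (H : Graph n) t → degST H t ≡ D H (δ t)
  degST≡D H t = length-filter (joins? {n} nothing (just t)) (atSᴱ (δ t))
    (λ e j → trans (atSᴱ-joins (δ t) j) (δ-refl t)) (δ-joins t) H

  neighbour⁺ : ∀ {H : Graph n} {v} → NeighbourOfS H v → Neighbour H v
  neighbour⁺ {e ∷ H} {v} (here j) = m≤n⇒m≤n+o _ (≤-reflexive (sym (trans (atSᴱ-joins (δ v) j) (δ-refl v))))
  neighbour⁺ {e ∷ H} {v} (there p) = ≤-trans (neighbour⁺ p) (m≤n+m _ (atSᴱ (δ v) e))

  neighbour⁻ : ∀ {v} H → Neighbour H v → NeighbourOfS H v
  neighbour⁻ {v} (e ∷ H) p with joins? nothing (just v) e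
  ... | yes j = here j
  ... | no ¬j = there (neighbour⁻ H (subst (λ m → 1 ≤ m + D H (δ v)) (δ-joins v e ¬j) p))

  outer-vertex : ∀ X → NonTrivial X → ∃[ o ] labeling X o ≡ O
  outer-vertex X nt with Fin.any? (λ v → ¬? (v ∈? outer X))
  ... | yes (o , o∉) = o , labeling-O X o∉
  ... | no ∄ = ⊥-elim (nt (inj₂ (⊆-antisym ⊆⊤ (λ {v} _ → decidable-stable (v ∈? outer X) (λ v∉ → ∄ (v , v∉))))))

  inner-vertex : ∀ X → NonTrivial X → ∃[ i ] labeling X i ≡ I
  inner-vertex X nt with nonempty? (inner X)
  ... | yes (i , i∈) = i , labeling-I X i∈
  ... | no empty = ⊥-elim (nt (inj₁ (Empty-unique empty)))

  bi-set : Labeling n → BiSet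
  bi-set L = record
    { outer = Vec.tabulate (not ∘ isOᵇ ∘ L)
    ; inner = Vec.tabulate (isIᵇ ∘ L)
    ; inner⊆outer = λ {v} v∈ → ∈-tabulate (not ∘ isOᵇ ∘ L) (not-O v (tabulate-∈ (isIᵇ ∘ L) v∈))
    }
    where
    ∈-tabulate : ∀ (g : Fin n → Bool) {v} → g v ≡ true → v ∈ˢ Vec.tabulate g
    ∈-tabulate g {v} e = lookup⇒[]= v (Vec.tabulate g) (trans (lookup∘tabulate g v) e)
    tabulate-∈ : ∀ (g : Fin n → Bool) {v} → v ∈ˢ Vec.tabulate g → g v ≡ true
    tabulate-∈ g {v} v∈ = trans (sym (lookup∘tabulate g v)) ([]=⇒lookup v∈)
    not-O : ∀ v → isIᵇ (L v) ≡ true → not (isOᵇ (L v)) ≡ true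
    not-O v e with L v
    ... | I = refl

  labeling-bi-set : ∀ L v → labeling (bi-set L) v ≡ L v
  labeling-bi-set L v = go (L v) refl
    where
    inner⁻ : v ∈ˢ inner (bi-set L) → isIᵇ (L v) ≡ true
    inner⁻ v∈ = trans (sym (lookup∘tabulate (isIᵇ ∘ L) v)) ([]=⇒lookup v∈)
    outer⁻ : v ∈ˢ outer (bi-set L) → not (isOᵇ (L v)) ≡ true
    outer⁻ v∈ = trans (sym (lookup∘tabulate (not ∘ isOᵇ ∘ L) v)) ([]=⇒lookup v∈)
    inner⁺ : isIᵇ (L v) ≡ true → v ∈ˢ inner (bi-set L)
    inner⁺ e = lookup⇒[]= v _ (trans (lookup∘tabulate (isIᵇ ∘ L) v) e)
    outer⁺ : not (isOᵇ (L v)) ≡ true → v ∈ˢ outer (bi-set L)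
    outer⁺ e = lookup⇒[]= v _ (trans (lookup∘tabulate (not ∘ isOᵇ ∘ L) v) e)
    go : ∀ a → L v ≡ a → labeling (bi-set L) v ≡ L v
    go I e = trans (labeling-I (bi-set L) (inner⁺ (cong isIᵇ e))) (sym e)
    go O e = trans (labeling-O (bi-set L) (λ v∈ → O-not (trans (sym (cong (not ∘ isOᵇ) e)) (outer⁻ v∈)))) (sym e)
      where
      O-not : not (isOᵇ O) ≡ true → ⊥
      O-not ()
    go W e = trans (labeling-W (bi-set L) (x∈p∧x∉q⇒x∈p─q (outer⁺ (cong (not ∘ isOᵇ) e))
      (λ v∈ → W-not (trans (sym (cong isIᵇ e)) (inner⁻ v∈))))) (sym e)
      where
      W-not : isIᵇ W ≡ true → ⊥
      W-not ()

  non-trivial : ∀ L {i o} → L i ≡ I → L o ≡ O → NonTrivial (bi-set L)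
  non-trivial L {i} {o} li lo (inj₁ e) = ∉⊥ (subst (i ∈ˢ_) e (I-inner (bi-set L) (trans (labeling-bi-set L i) li)))
  non-trivial L {i} {o} li lo (inj₂ e) = O-outer (bi-set L) (trans (labeling-bi-set L o) lo) (subst (o ∈ˢ_) (sym e) ∈⊤)

  f-bi-set : ∀ k H L → f k H (bi-set L) ≡ F k H L
  f-bi-set k H L = trans (f≡F k H (bi-set L)) (≤-antisym (F-mono k H (labeling-bi-set L)) (F-mono k H (sym ∘ labeling-bi-set L)))

  connected⇒conn : ∀ k H → Connected k H → Conn k H
  connected⇒conn k H (_ , c) L i o li lo = ≤-trans (c (bi-set L) (non-trivial L li lo)) (≤-reflexive (f-bi-set k H L))

  conn⇒connected : ∀ k H → 3 ≤ n → Conn k H → Connected k H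
  conn⇒connected k H 3≤n c = 3≤n , λ X nt →
    let (i , xi) = inner-vertex X nt ; (o , xo) = outer-vertex X nt
    in ≤-trans (c (labeling X) i o xi xo) (≤-reflexive (sym (f≡F k H X)))

-- Obstacles

module _ {n : ℕ} (k : ℕ) (H : Graph n) where

  open Basic k H

  family⇒obstacle : ∀ {t j} → D H (δ t) ≡ 1 + 2 * j → Family k H t → HasObstacle k H
  family⇒obstacle {t} {j} odd-t fam = t , map bi-set members , record
    { neighbour = neighbour⁻ H nt
    ; odd = λ (divides q eq) → even≢odd q j (trans (*-comm 2 q) (trans (sym eq) (trans (degST≡D H t) odd-t)))
    ; critical = All.map⁺ (All.map critical tights)
    ; walls = All.map⁺ (All.map (wall-t ∘ proj₁) tights)
    ; disjoint = AllPairs.map⁺ (AllPairs.map inner-disjoint disjoint)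
    ; covers = λ v nv v≢t → Any.map⁺ (Any.map (λ {Y} yv → I-inner (bi-set Y) (trans (labeling-bi-set Y v) yv)) (covers (neighbour⁺ nv) v≢t))
    }
    where
    open Family fam
    nt : Neighbour H t
    nt = ≤-trans (s≤s z≤n) (≤-reflexive (sym odd-t))
    wall-t : ∀ {Y} → Tight t Y → wall (bi-set Y) ≡ ⁅ t ⁆
    wall-t {Y} tY = ⊆-antisym
      (λ {v} v∈ → subst (_∈ˢ ⁅ t ⁆) (sym (only tY (trans (sym (labeling-bi-set Y v)) (labeling-W (bi-set Y) v∈)))) (x∈⁅x⁆ t))
      (λ {v} v∈ → subst (_∈ˢ wall (bi-set Y)) (sym (x∈⁅y⁆⇒x≡y t v∈)) (W-wall (bi-set Y) (trans (labeling-bi-set Y t) (at tY))))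
    critical : ∀ {Y} → Member k H t Y → CriticalPair k H (bi-set Y)
    critical {Y} (tY , x , nx , yx) =
      non-trivial Y yx (proj₂ (out tY)) ,
      x , t , (_ , split-pair (proj₂ (split-exists H nx nt (λ { refl → ⊥-elim (I≢W yx (at tY)) })))) ,
      I-inner (bi-set Y) (trans (labeling-bi-set Y x) yx) , wall-t tY , ≤-trans (≤-reflexive (f-bi-set k H Y)) (bound tY)
    inner-disjoint : ∀ {X Y} → Disjoint X Y → InnerlyDisjoint (bi-set X) (bi-set Y)
    inner-disjoint {X} {Y} dis = Empty-unique λ (v , v∈) → let (v∈X , v∈Y) = x∈p∩q⁻ _ _ v∈ in
      dis v (trans (sym (labeling-bi-set X v)) (labeling-I (bi-set X) v∈X)) (trans (sym (labeling-bi-set Y v)) (labeling-I (bi-set Y) v∈Y))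

  obstacle⇒blocked : ∀ {t C} → IsObstacle k H t C → ∀ {v} → Neighbour H v → ¬ v ≡ t → Blocked t v
  obstacle⇒blocked {t} {C} obs {v} nv v≢t =
    let (X , X∈ , v∈) = find (IsObstacle.covers obs v (neighbour⁻ H nv) v≢t)
        (nt , _ , _ , _ , _ , _ , le) = All.lookup (IsObstacle.critical obs) X∈
        w = All.lookup (IsObstacle.walls obs) X∈
    in labeling X , record
      { at = labeling-W X (subst (t ∈ˢ_) (sym w) (x∈⁅x⁆ t))
      ; only = λ {u} e → x∈⁅y⁆⇒x≡y t (subst (u ∈ˢ_) w (W-wall X e))
      ; out = outer-vertex X nt
      ; bound = ≤-trans (≤-reflexive (sym (f≡F k H X))) le
      } , labeling-I X v∈

-- At a centre t of odd degree, st is eventually split off together with an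
-- edge sv with v ≠ t, which violates connectivity.

module _ {n : ℕ} (k : ℕ) where

  F-splitoffs : ∀ {m} {H H′ : Graph n} → SplitOffs m H H′ → ∀ L → F k H′ L ≤ F k H L
  F-splitoffs done L = ≤-refl
  F-splitoffs (step (u , v , R , p , refl) off) L = ≤-trans (F-splitoffs off L) (F-decreases (pair-effect p) k L)

  module _ {t : Fin n} where

    -- Blocking survives every step because f never increases, and the parity of d(s,t) changes only
    -- in a step that uses st exactly once.
    odd-blocked : ∀ {m j} {H H′ : Graph n} → SplitOffs m H H′ → Conn k H′ → degree H ≡ 2 * m → D H (δ t) ≡ 1 + 2 * j →
      (∀ {v} → Neighbour H v → ¬ v ≡ t → Basic.Blocked k H t v) → ⊥
    odd-blocked {j = j} {H} done conn even odd blocked =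
      <⇒≱ (≤-trans (≤-trans (s≤s z≤n) (≤-reflexive (sym odd))) (D-mono H (δ-≤ {t = t} (s≤s z≤n)))) (≤-reflexive even)
    odd-blocked {suc m} {j} {H} {H′} (step (u , v , R , p , refl) off) conn even odd blocked = by-cases (t Fin.≟ u) (t Fin.≟ v)
      where
      E : Effect H u v ((just u , just v) ∷ R)
      E = pair-effect p
      D-t : ∀ {a b} → δ t u ≡ a → δ t v ≡ b → 1 + 2 * j ≡ D R (δ t) + (a + b)
      D-t refl refl = trans (sym odd) (D-effect E (δ t))
      neighbour-u : Neighbour H u
      neighbour-u = ≤-trans (≤-trans (≤-reflexive (sym (δ-refl u))) (≤-trans (m≤m+n _ (δ u v)) (m≤n+m _ (D R (δ u))))) (≤-reflexive (sym (D-effect E (δ u))))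
      neighbour-v : Neighbour H v
      neighbour-v = ≤-trans (≤-trans (≤-reflexive (sym (δ-refl v))) (≤-trans (m≤n+m _ (δ v u)) (m≤n+m _ (D R (δ v))))) (≤-reflexive (sym (D-effect E (δ v))))
      blocked′ : ∀ {z} → Neighbour ((just u , just v) ∷ R) z → ¬ z ≡ t → Basic.Blocked k ((just u , just v) ∷ R) t z
      blocked′ nz z≢t = let (L , tL , lz) = blocked (neighbour-up E nz) z≢t in
        L , record { at = Basic.at tL ; only = Basic.only tL ; out = Basic.out tL
                   ; bound = ≤-trans (F-decreases E k L) (Basic.bound tL) } , lz
      again : ∀ j′ → D R (δ t) ≡ 1 + 2 * j′ → ⊥
      again j′ odd′ = odd-blocked {j = j′} off conn (even-after {m = m} even E) odd′ blocked′
      violated : ∀ {z} → Basic.Blocked k H t z → (∀ L → L t ≡ W → L z ≡ I → F k ((just u , just v) ∷ R) L + 1 ≡ F k H L + 0) → ⊥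
      violated (L , tL , lz) eq = refute 4 (λ f g h k → h ⊑ g ∷ g ⊕ con 1 ⊑ f ⊕ con 0 ∷ f ⊑ 2 ⊛ k ∷ 2 ⊛ k ⊑ h ∷ [])
        (F k H L ∷ F k ((just u , just v) ∷ R) L ∷ F k H′ L ∷ k ∷ [])
        (F-splitoffs off L ∷ ≤-reflexive (eq L (Basic.at tL) lz) ∷ Basic.bound tL ∷
         conn L _ (proj₁ (Basic.out tL)) lz (proj₂ (Basic.out tL)) ∷ [])
      by-cases : Dec (t ≡ u) → Dec (t ≡ v) → ⊥
      -- The other edge ends inside a tight bi-set with wall {t}, whose f drops below 2k and never
      -- recovers.
      by-cases (yes refl) (no t≢v) = violated (blocked neighbour-v (t≢v ∘ sym)) λ L lt lz → F-labels E k L lt lz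
      by-cases (no t≢u) (yes refl) = violated (blocked neighbour-u (t≢u ∘ sym)) λ L lt lz → F-labels E k L lz lt
      by-cases (no t≢u) (no t≢v) = again j (sym (trans (D-t (δ-≢ t≢u) (δ-≢ t≢v)) (+-identityʳ _)))
      by-cases (yes refl) (yes refl) = two-less j (D-t (δ-refl t) (δ-refl t))
        where
        two-less : ∀ j → 1 + 2 * j ≡ D R (δ t) + 2 → ⊥
        -- A single edge st cannot supply both edges of the pair.
        two-less zero eq = <⇒≱ (m≤n+m 2 (D R (δ t))) (≤-reflexive (sym eq))
        two-less (suc j′) eq = again j′ (+-cancelʳ-≡ 2 _ _ (trans (sym eq) (arrange j′)))
          where
          arrange : ∀ j → 1 + 2 * suc j ≡ 1 + 2 * j + 2
          arrange = solve-∀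

theorem6p7 : ∀ (n k : ℕ) (H : Graph n) → 2 ≤ k → Connected k H →
    4 ≤ degS H → 2 ∣ degS H →
    HasCompleteAdmissibleSplittingOff k H ⇔ (¬ HasObstacle k H)
theorem6p7 n k H 2≤k connected _ (divides q eq) = mk⇔ necessary sufficient
  where
  even : degree H ≡ 2 * q
  even = trans (sym (degS≡degree H)) (trans eq (*-comm q 2))
  half : ⌊ degS H /2⌋ ≡ q
  half = trans (cong ⌊_/2⌋ (trans eq (trans (*-comm q 2) (cong (q +_) (+-identityʳ q))))) (sym (n≡⌊n+n/2⌋ q))
  necessary : HasCompleteAdmissibleSplittingOff k H → ¬ HasObstacle k H
  necessary (H′ , off , connected′) (t , C , obs) = by-parity (parity (D H (δ t)))
    where
    by-parity : (∃[ j ] D H (δ t) ≡ 2 * j) ⊎ (∃[ j ] D H (δ t) ≡ 1 + 2 * j) → ⊥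
    by-parity (inj₁ (j , e)) = IsObstacle.odd obs (divides j (trans (degST≡D H t) (trans e (*-comm 2 j))))
    by-parity (inj₂ (j , e)) = odd-blocked k {j = j} (subst (λ m → SplitOffs m H H′) half off) (connected⇒conn k H′ connected′) even e (obstacle⇒blocked k H obs)
  sufficient : ¬ HasObstacle k H → HasCompleteAdmissibleSplittingOff k H
  sufficient no-obstacle = let (H′ , off , conn′) = splittable-sound k q found in
    H′ , subst (λ m → SplitOffs m H H′) (sym half) off , conn⇒connected k H′ (proj₁ connected) conn′
    where
    found : Splittable k q H
    found = decidable-stable (splittable? k q H) λ ¬splittable →
      splittable k 2≤k q H (connected⇒conn k H connected) even (λ t j odd fam → no-obstacle (family⇒obstacle k H {j = j} odd fam)) ¬splittable
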